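{- For the Armstrong–Stump–Thomas bijection $\Theta_W\colon \mathcal{A}(\Phi^+)\to \mathrm{NC}(W,c_Lc_R)$ described below, we have \[\Theta_W \cdot (\mathrm{Row}^{ -1} \cdot \mathrm{Rvac}) = \mathrm{Flip}\cdot \Theta_W,\] where $\mathrm{Flip}\colon \mathrm{NC}(W,c_Lc_R)\to\mathrm{NC}(W,c_Lc_R)$ is the involutive poset automorphism defined by $\mathrm{Flip}(w) \coloneqq c_L w^{ -1} c_L^{ -1}$.
   Context: Let $\Phi$ be a crystallographic root system of rank $r$ with Weyl group $W$, simple roots $\alpha_1,\dots,\alpha_r$, simple reflections $s_1,\dots,s_r$, and root poset $\Phi^+$ (positive roots, with $\alpha\le\beta$ iff $\beta-\alpha$ is a nonnegative sum of simple roots); this poset is ranked by $\mathrm{rk}(\alpha)=\mathrm{height}(\alpha)-1$. Let $\mathcal{A}(\Phi^+)$ be the set of antichains of $\Phi^+$ (the $W$-nonnesting partitions). For a ranked poset $P$ and $p\in P$, the toggle $\tau_p$ on antichains removes $p$ if $p\in A$, adds $p$ if $p\notin A$ and $A\cup\{p\}$ is an antichain, and otherwise does nothing; the rank toggle $\boldsymbol{\tau}_i$ is the product of $\tau_p$ over all $p$ of rank $i$. Rowmotion is $\mathrm{Row}=\boldsymbol{\tau}_{\mathrm{rk}(P)}\cdots\boldsymbol{\tau}_0$ (equivalently $\mathrm{Row}(A)=\min\{x\in P: x\not\le y \text{ for all } y\in A\}$), and rowvacuation is $\mathrm{Rvac}=(\boldsymbol{\tau}_{\mathrm{rk}(P)})(\boldsymbol{\tau}_{\mathrm{rk}(P)}\boldsymbol{\tau}_{\mathrm{rk}(P)-1})\cdots(\boldsymbol{\tau}_{\mathrm{rk}(P)}\cdots\boldsymbol{\tau}_0)$.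 Fix a bipartition $L\sqcup R=[r]$ of the Dynkin diagram, let $c_X=\prod_{i\in X}s_i$, and let $c=c_Lc_R$ be the bipartite Coxeter element. Let $T$ be the set of reflections, $\ell_T$ the absolute length, absolute order $u\le w$ iff $\ell_T(w)=\ell_T(u)+\ell_T(u^{ -1}w)$, and $\mathrm{NC}(W,c)$ the interval $[e,c]$ in absolute order (the $W$-noncrossing partitions). The Kreweras complement is $\mathrm{Krew}(w)=cw^{ -1}$. For $J\subseteq[r]$, $W_J$ is the parabolic subgroup generated by $s_i$, $i\in J$, and for an antichain $A$, $\mathrm{supp}(A)=\{i: \alpha_i\le\alpha \text{ for some }\alpha\in A\}$. By Armstrong–Stump–Thomas, $\Theta_W\colon\mathcal{A}(\Phi^+)\to\mathrm{NC}(W,c_Lc_R)$ is the unique bijection such that: $\Theta_W(\{\alpha_i: i\in L\})=e$; $\Theta_W\cdot\mathrm{Row}=\mathrm{Krew}\cdot\Theta_W$; and $\Theta_W(A)=\prod_{i\in L\setminus\mathrm{supp}(A)}s_i\cdot\Theta_{W_{\mathrm{supp}(A)}}(A)$ (parabolic induction, with $\mathrm{NC}(W_{\mathrm{supp}(A)},c_{L\cap\mathrm{supp}(A)}c_{R\cap\mathrm{supp}(A)})\subseteq\mathrm{NC}(W,c_Lc_R)$). -}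

module Defs where

open import Data.Nat as ℕ using (ℕ; zero; suc; _∸_; _⊔_; _<_)
open import Data.Integer as ℤ using (ℤ; +_; _≤ᵇ_)
open import Data.Bool using (Bool; true; false; not; _∧_; _∨_; if_then_else_; T)
open import Data.Fin using (Fin)
open import Data.Fin.Properties using () renaming (_≟_ to _≟F_)
open import Data.Fin.Subset using (Subset; _∈_; _∪_; _∩_; _─_; ∁; ⁅_⁆)
open import Data.Vec as Vec using (Vec; lookup; tabulate; _[_]≔_)
open import Data.Vec.Properties using (≡-dec)
open import Data.List as List using (List; []; _∷_; _++_; reverse; concat; length; allFin; filterᵇ)
open import Data.Bool.ListAction using (all; any)
open import Data.List.Relation.Unary.All using (All)
open import Data.Product using (Σ; _×_; _,_)
open import Relation.Nullary using (¬_; ⌊_⌋)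
open import Relation.Binary.PropositionalEquality using (_≡_; _≢_)

-- Root-lattice vectors (coordinates w.r.t. the simple roots α₁ … α_r)

e : ∀ {r} → Fin r → Vec ℤ r
e i = tabulate (λ k → if ⌊ k ≟F i ⌋ then + 1 else + 0)

sumℤ : ∀ {m} → Vec ℤ m → ℤ
sumℤ = Vec.foldr _ ℤ._+_ (+ 0)

leqᵇ : ∀ {r} → Vec ℤ r → Vec ℤ r → Bool
leqᵇ {r} u v = all (λ k → lookup u k ≤ᵇ lookup v k) (allFin r)

eqᵇ : ∀ {r} → Vec ℤ r → Vec ℤ r → Bool
eqᵇ u v = ⌊ ≡-dec ℤ._≟_ u v ⌋

height : ∀ {r} → Vec ℤ r → ℤ
height = sumℤ

-- Weyl group of a Cartan matrix C, with C i j = ⟨α_j , α_i^∨⟩.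
-- Elements are words in the simple reflections; the word i₁ i₂ … i_k
-- stands for s_{i₁} s_{i₂} ⋯ s_{i_k}, so concatenation is the product
-- and reverse is the inverse.

Cartan : ℕ → Set
Cartan r = Fin r → Fin r → ℤ

Word : ℕ → Set
Word r = List (Fin r)

module _ {r : ℕ} (C : Cartan r) where

  pairing : Fin r → Vec ℤ r → ℤ
  pairing i v = sumℤ (tabulate (λ j → C i j ℤ.* lookup v j))

  sref : Fin r → Vec ℤ r → Vec ℤ r
  sref i v = tabulate (λ k → if ⌊ k ≟F i ⌋ then lookup v k ℤ.- pairing i v else lookup v k)

  act : Word r → Vec ℤ r → Vec ℤ r
  act []      v = v
  act (i ∷ w) v = sref i (act w v)

  -- equality in W (the action on the root lattice is faithful)
  _≈W_ : Word r → Word r → Set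
  u ≈W w = ∀ j → act u (e j) ≡ act w (e j)

  IsRoot : Vec ℤ r → Set
  IsRoot v = Σ (Word r) λ w → Σ (Fin r) λ i → act w (e i) ≡ v

  IsPositiveRoot : Vec ℤ r → Set
  IsPositiveRoot v = IsRoot v × (∀ k → ℤ._≤_ (+ 0) (lookup v k))

  IsCartanMatrix : Set
  IsCartanMatrix = (∀ i → C i i ≡ + 2)
                 × (∀ i j → i ≢ j → ℤ._≤_ (C i j) (+ 0))
                 × (∀ i j → C i j ≡ + 0 → C j i ≡ + 0)

  IsBipartition : Subset r → Set
  IsBipartition L = ∀ i j → i ≢ j → C i j ≢ + 0 → lookup L i ≢ lookup L j

  WordIn : Subset r → Word r → Set
  WordIn J w = All (λ i → i ∈ J) w

  IsReflection : Subset r → Word r → Set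
  IsReflection J t = Σ (Word r) λ w → Σ (Fin r) λ i →
    WordIn J w × i ∈ J × (t ≈W (w ++ i ∷ reverse w))

  ReflFact : Subset r → Word r → ℕ → Set
  ReflFact J w k = Σ (List (Word r)) λ ts →
    length ts ≡ k × All (IsReflection J) ts × (concat ts ≈W w)

  AbsLength : Subset r → Word r → ℕ → Set
  AbsLength J w k = ReflFact J w k × (∀ m → m < k → ¬ ReflFact J w m)

  AbsLe : Subset r → Word r → Word r → Set
  AbsLe J u w = Σ ℕ λ a → Σ ℕ λ b →
    AbsLength J u a × AbsLength J (reverse u ++ w) b × AbsLength J w (a ℕ.+ b)

  NC : Subset r → Word r → Word r → Set
  NC J c w = AbsLe J [] w × AbsLe J w c

-- c_X = ∏_{i ∈ X} s_i (these commute when X is independent)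
cX : ∀ {r} → Subset r → Word r
cX {r} X = filterᵇ (lookup X) (allFin r)

coxJ : ∀ {r} → Subset r → Subset r → Word r
coxJ L J = cX (L ∩ J) ++ cX (∁ L ∩ J)

-- The root poset Φ⁺, given by an enumeration roots : Vec (Vec ℤ r) n,
-- subsets of Φ⁺ are Subset n (indices into the enumeration), and
-- parabolic root posets Φ_J⁺ are the roots supported in J.

module _ {r n : ℕ} (roots : Vec (Vec ℤ r) n) where

  root : Fin n → Vec ℤ r
  root = lookup roots

  rk : Fin n → ℕ
  rk p = ℤ.∣ height (root p) ∣ ∸ 1

  inΦJ : Subset r → Fin n → Bool
  inΦJ J p = all (λ k → lookup J k ∨ ⌊ lookup (root p) k ℤ.≟ + 0 ⌋) (allFin r)

  isAntichainᵇ : Subset n → Bool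
  isAntichainᵇ A = all (λ p → all (λ q →
      not (lookup A p ∧ lookup A q ∧ not ⌊ p ≟F q ⌋) ∨ not (leqᵇ (root p) (root q)))
    (allFin n)) (allFin n)

  IsAntichainIn : Subset r → Subset n → Set
  IsAntichainIn J A = T (all (λ p → not (lookup A p) ∨ inΦJ J p) (allFin n) ∧ isAntichainᵇ A)

  toggle : Fin n → Subset n → Subset n
  toggle p A = if lookup A p then A [ p ]≔ false
               else (if isAntichainᵇ (A ∪ ⁅ p ⁆) then A ∪ ⁅ p ⁆ else A)

  rankToggle : Subset r → ℕ → Subset n → Subset n
  rankToggle J i A = List.foldr (λ p B → if inΦJ J p ∧ (rk p ℕ.≡ᵇ i) then toggle p B else B)
                                A (allFin n)

  maxRank : Subset r → ℕ
  maxRank J = List.foldr (λ p m → if inΦJ J p then rk p ⊔ m else m) 0 (allFin n)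

  seqUp : Subset r → ℕ → ℕ → Subset n → Subset n
  seqUp J j zero    A = A
  seqUp J j (suc k) A = seqUp J (suc j) k (rankToggle J j A)

  seqDown : Subset r → ℕ → ℕ → Subset n → Subset n
  seqDown J j zero    A = A
  seqDown J j (suc k) A = rankToggle J j (seqDown J (suc j) k A)

  Row : Subset r → Subset n → Subset n
  Row J = seqUp J 0 (suc (maxRank J))

  -- Row⁻¹ = τ_0 ⋯ τ_M (each τ_i is an involution)
  RowInv : Subset r → Subset n → Subset n
  RowInv J = seqDown J 0 (suc (maxRank J))

  Rvac : Subset r → Subset n → Subset n
  Rvac J A = go 0 (suc M) A
    where
      M = maxRank J
      go : ℕ → ℕ → Subset n → Subset n
      go j zero    B = B
      go j (suc k) B = go (suc j) k (seqUp J j (suc M ∸ j) B)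

  supp : Subset n → Subset r
  supp A = tabulate (λ i → any (λ p → lookup A p ∧ leqᵇ (e i) (root p)) (allFin n))

  simpleSet : Subset r → Subset n
  simpleSet X = tabulate (λ p → any (λ i → lookup X i ∧ eqᵇ (root p) (e i)) (allFin r))

module _ {r : ℕ} (C : Cartan r) where

  EnumeratesΦ⁺ : {n : ℕ} → Vec (Vec ℤ r) n → Set
  EnumeratesΦ⁺ {n} roots =
      (∀ p → IsPositiveRoot C (lookup roots p))
    × (∀ p q → lookup roots p ≡ lookup roots q → p ≡ q)
    × (∀ v → IsPositiveRoot C v → Σ (Fin n) λ p → lookup roots p ≡ v)

  -- Θ = (Θ_{W_J})_J is the Armstrong–Stump–Thomas family: for every J,
  -- Θ_J is a bijection from antichains of Φ_J⁺ onto NC(W_J, c_{L∩J}c_{R∩J}),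
  -- with the normalisation, rowmotion/Kreweras and parabolic induction properties.
  record IsASTFamily {n : ℕ} (roots : Vec (Vec ℤ r) n) (L : Subset r)
                     (Θ : Subset r → Subset n → Word r) : Set where
    field
      into      : ∀ J A → IsAntichainIn roots J A → NC C J (coxJ L J) (Θ J A)
      injective : ∀ J A B → IsAntichainIn roots J A → IsAntichainIn roots J B →
                  _≈W_ C (Θ J A) (Θ J B) → A ≡ B
      onto      : ∀ J w → NC C J (coxJ L J) w →
                  Σ (Subset n) λ A → IsAntichainIn roots J A × _≈W_ C (Θ J A) w
      base      : ∀ J → _≈W_ C (Θ J (simpleSet roots (L ∩ J))) []
      rowKrew   : ∀ J A → IsAntichainIn roots J A →
                  _≈W_ C (Θ J (Row roots J A)) (coxJ L J ++ reverse (Θ J A))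
      parabolic : ∀ J A → IsAntichainIn roots J A →
                  _≈W_ C (Θ J A) (cX ((L ∩ J) ─ supp roots A) ++ Θ (supp roots A) A)

-- Put ψ = Row⁻¹ · Rvac. By induction on J, Θ_J ψ = Flip Θ_J on the antichains of Φ_J⁺. Two facts about ψ are
-- combinatorial: ψ Row = Row⁻¹ ψ, and ψ commutes with the inclusion of the antichains of Φ_K⁺, K ⊆ J. Since
-- Flip Krew = Krew⁻¹ Flip, the first shows that the identity spreads along Row-orbits, and by parabolic
-- induction the second proves it on antichains of Φ_K⁺ with K smaller than J. It remains to see that every
-- Row-orbit contains such an antichain, which is read off on the noncrossing side: conjugation by a power of the
-- Coxeter element c makes the first factor of a shortest reflection factorization a simple reflection sᵢ, because
-- c fixes no nonnegative vector and so every c-orbit of roots changes sign; removing sᵢ then leaves an element of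
-- NC(W_{J − i}). The latter needs that the roots in a shortest factorization of c_K lie in the span of Φ_K.
--
-- Finiteness enters through the W-invariant form D(f,g) = Σ f(β) g(β) over the positive roots, which is positive
-- definite on functionals and replaces a symmetrization of the Cartan matrix.
module Submission where

open import Defs
open import Data.Nat as ℕ using (ℕ; zero; suc; z≤n; s≤s; _∸_; _⊔_)
import Data.Nat.Properties as ℕₚ
open import Data.Integer using (ℤ; -[1+_]; _+_; _*_; _-_; -_; _≤_; _<_; 0ℤ; 1ℤ; -1ℤ; _≤?_; _<?_; ∣_∣; _≤ᵇ_; nonNegative) renaming (+_ to pos)
import Data.Integer as ℤ
open import Data.Integer.Properties
open import Data.Integer.Tactic.RingSolver using (solve-∀)
import Algebra.Properties.CommutativeMonoid.Sum +-0-commutativeMonoid as Sum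
open import Data.Fin using (Fin; zero; suc; toℕ; fromℕ<; punchIn; punchOut; inject≤)
open import Data.Fin.Properties using (all?; any?; toℕ-fromℕ<; toℕ<n; pigeonhole; punchIn-punchOut; inject≤-injective) renaming (_≟_ to _≟F_)
import Data.Fin.Permutation as Perm
open import Data.Fin.Subset using (Subset; _∈_; _∉_; _⊆_; _⊂_; _∪_; _∩_; _─_; ∁; ⁅_⁆; ⊤)
open import Data.Fin.Subset.Properties
  using (_∈?_; ⊆-antisym; nonempty?; x∈⁅x⁆; x∈⁅y⁆⇒x≡y; x∈p∪q⁺; x∈p∪q⁻; x∈p∩q⁺; x∈p∩q⁻; x∈∁p⇒x∉p; x∉p⇒x∈∁p; ∩-identityʳ; p─q⊆p; x∈p∧x∉q⇒x∈p─q; x∈p⇒p-x⊂p)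
open import Data.Fin.Subset.Induction using (⊂-wellFounded)
open import Data.Vec as Vec using (Vec; lookup; tabulate; _[_]≔_; _∷_; there)
open import Data.Vec.Properties
  using (lookup∘tabulate; tabulate∘lookup; tabulate-cong; lookup-map; lookup-zipWith; ≡-dec; []=⇒lookup; lookup⇒[]=; lookup∘update; lookup∘update′)
open import Data.List as List using (List; []; _∷_; _++_; _∷ʳ_; reverse; length; concat; map; foldr; allFin; initLast; _∷ʳ′_)
open import Data.List.Properties
  using (unfold-reverse; reverse-++; reverse-involutive; ++-assoc; map-++; length-map; length-++; concat-++)
open import Data.List.Relation.Unary.All as All using (All; []; _∷_)
import Data.List.Relation.Unary.All.Properties as Allₚ
open import Data.List.Relation.Unary.AllPairs using ([]; _∷_)
open import Data.List.Relation.Unary.Any as Any using (here; there)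
import Data.List.Relation.Unary.Any.Properties as Anyₚ
open import Data.List.Relation.Unary.Unique.Propositional using (Unique)
import Data.List.Relation.Unary.Unique.Propositional.Properties as Uniqueₚ
open import Data.List.Membership.Propositional using () renaming (_∈_ to _∈ˡ_; _∉_ to _∉ˡ_)
open import Data.List.Membership.Propositional.Properties
  using (∈-lookup; ∈-filter⁺; ∈-filter⁻; ∈-allFin; ∈-++⁺ˡ; ∈-++⁺ʳ; ∈-++⁻)
open import Data.Bool as Bool using (Bool; true; false; not; T; _∧_; _∨_; if_then_else_)
open import Data.Bool.Properties using (not-involutive; ¬-not; T?; T-≡; T-∧; T-∨)
open import Data.Bool.ListAction using (all)
open import Data.Product using (Σ; ∃; _×_; _,_; proj₁; proj₂)
import Data.Product.Properties as Productₚ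
open import Data.Sum as Sum⊎ using (_⊎_; inj₁; inj₂; [_,_]′)
open import Data.Empty using (⊥-elim)
open import Data.Unit using (tt)
open import Function using (_∘_)
open import Function.Bundles using (Equivalence)
open import Induction.WellFounded using (Acc; acc)
open import Relation.Nullary using (¬_; Dec; yes; no; contradiction; ⌊_⌋)
open import Relation.Nullary.Decidable using (_×-dec_; _⊎-dec_; ¬?; map′; fromWitness; toWitness; from-yes)
open import Relation.Binary.PropositionalEquality
open import Relation.Binary.Definitions using (Tri; tri<; tri≈; tri>)
open import Data.Nat.Induction using (<-wellFounded)

-- Toggles on a ranked poset

-- Row-orbits see conjugation by c because Krew applied twice is w ↦ c w c⁻¹. Once the first factor
-- of w is sᵢ, the colour of i decides how to descend; let c' be the Coxeter element of J - i. For i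
-- ∈ L one has c = sᵢ c', and w = sᵢ z with z ∈ NC(W_{J-i}, c') has exactly the shape that parabolic
-- induction gives to an antichain of Φ_{J-i}⁺. For i ∈ R one has c = c' sᵢ, parabolic induction
-- prefixes nothing, and one more application of Row is needed. The identity has no first factor,
-- but Row takes it to c. Absolute length is the minimal length of a factorization inside each W_J
-- separately. The lengths for J and J - i are compared through two facts only: a piece of a
-- shortest factorization is shortest, and a product of distinct simple reflections fixes no
-- functional that is nonzero on one of its letters. Positivity of roots and covers in Φ⁺ are not
-- part of the data. The former comes from an analysis of rank-two subgroups, the latter from the
-- form D.

module Operators {X : Set} (τ : ℕ → X → X) where

  -- Rowmotion, its inverse and rowvacuation confined to the `k` ranks from `j` on. Storing the
  -- start and the number of ranks lets an induction strip the lowest rank.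
  up down vac : ℕ → ℕ → X → X
  up j zero    A = A
  up j (suc k) A = up (suc j) k (τ j A)
  down j zero    A = A
  down j (suc k) A = τ j (down (suc j) k A)
  vac j zero    A = A
  vac j (suc k) A = vac (suc j) k (up j (suc k) A)

  module _ {T : ℕ} (triv : ∀ {k} A → T ℕ.≤ k → τ k A ≡ A) where

    up-stable : ∀ j k A → T ℕ.≤ j ℕ.+ k → up j (suc k) A ≡ up j k A
    up-stable j zero    A l = triv A (subst (T ℕ.≤_) (ℕₚ.+-identityʳ j) l)
    up-stable j (suc k) A l = up-stable (suc j) k (τ j A) (subst (T ℕ.≤_) (ℕₚ.+-suc j k) l)

    down-stable : ∀ j k A → T ℕ.≤ j ℕ.+ k → down j (suc k) A ≡ down j k A
    down-stable j zero    A l = triv A (subst (T ℕ.≤_) (ℕₚ.+-identityʳ j) l)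
    down-stable j (suc k) A l = cong (τ j) (down-stable (suc j) k A (subst (T ℕ.≤_) (ℕₚ.+-suc j k) l))

    vac-stable : ∀ j k A → T ℕ.≤ j ℕ.+ k → vac j (suc k) A ≡ vac j k A
    vac-stable j zero    A l = triv A (subst (T ℕ.≤_) (ℕₚ.+-identityʳ j) l)
    vac-stable j (suc k) A l =
      trans (cong (λ X → vac (suc j) (suc k) X) (up-stable j (suc k) A l))
            (vac-stable (suc j) k (up j (suc k) A) (subst (T ℕ.≤_) (ℕₚ.+-suc j k) l))

    -- Lets Row⁻¹ Rvac be computed with more ranks than the poset has, so that two posets of
    -- different maximal rank can be run in step.
    down-vac-stable : ∀ d A → down 0 (d ℕ.+ T) (vac 0 (d ℕ.+ T) A) ≡ down 0 T (vac 0 T A)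
    down-vac-stable zero    A = refl
    down-vac-stable (suc d) A =
      trans (down-stable 0 (d ℕ.+ T) (vac 0 (suc d ℕ.+ T) A) (ℕₚ.m≤n+m T d))
            (trans (cong (down 0 (d ℕ.+ T)) (vac-stable 0 (d ℕ.+ T) A (ℕₚ.m≤n+m T d))) (down-vac-stable d A))

-- Gradedness enters as `cover`: a strict relation can be routed through an element one rank above
-- its lower end. This is what confines the effect of a toggle on a filter to two adjacent ranks.
record RankedPoset (n : ℕ) : Set₁ where
  field
    _≼_     : Fin n → Fin n → Set
    _≼?_    : ∀ p q → Dec (p ≼ q)
    ≼-refl  : ∀ {p} → p ≼ p
    ≼-trans : ∀ {p q s} → p ≼ q → q ≼ s → p ≼ s
    rank      : Fin n → ℕ
    rank-mono : ∀ {p q} → p ≼ q → p ≢ q → rank p ℕ.< rank q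
    cover   : ∀ {p q} → p ≼ q → p ≢ q → ∃ λ z → rank z ≡ suc (rank p) × p ≼ z × z ≼ q

  rank-mono-≤ : ∀ {p q} → p ≼ q → rank p ℕ.≤ rank q
  rank-mono-≤ {p} {q} le with p ≟F q
  ... | yes refl = ℕₚ.≤-refl
  ... | no  ne   = ℕₚ.<⇒≤ (rank-mono le ne)

  ≼-rank≡ : ∀ {p q} → p ≼ q → rank p ≡ rank q → p ≡ q
  ≼-rank≡ {p} {q} le e with p ≟F q
  ... | yes eq = eq
  ... | no  ne = ⊥-elim (ℕₚ.<-irrefl e (rank-mono le ne))

  IsAnti : (Fin n → Set) → Subset n → Set
  IsAnti D A = (∀ {p} → p ∈ A → D p) × (∀ {p q} → p ∈ A → q ∈ A → p ≼ q → p ≡ q)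

  Comparable : Subset n → Fin n → Set
  Comparable A p = ∃ λ q → q ∈ A × (q ≼ p ⊎ p ≼ q)

  Above : Subset n → Fin n → Set
  Above A p = ∃ λ q → q ∈ A × q ≼ p

  Below : Subset n → Fin n → Set
  Below A p = ∃ λ q → q ∈ A × p ≼ q

  Comparable? : ∀ A p → Dec (Comparable A p)
  Comparable? A p = any? λ q → (q ∈? A) ×-dec ((q ≼? p) ⊎-dec (p ≼? q))

  -- Since `≼` is reflexive, `Comparable A p` holds for every p in `A`. So "p is present afterwards
  -- iff it was not comparable to `A`" covers both removal and insertion. The predicate `D` is the
  -- ambient down-set, so that the root posets of all parabolic subgroups share one index set.
  record IsRankToggle (D : Fin n → Set) (τ : ℕ → Subset n → Subset n) : Set where
    field
      anti  : ∀ {k A} → IsAnti D A → IsAnti D (τ k A)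
      in→   : ∀ {k A p} → IsAnti D A → rank p ≡ k → p ∈ τ k A → ¬ Comparable A p
      in←   : ∀ {k A p} → IsAnti D A → D p → rank p ≡ k → ¬ Comparable A p → p ∈ τ k A
      out→  : ∀ {k A p} → IsAnti D A → rank p ≢ k → p ∈ τ k A → p ∈ A
      out←  : ∀ {k A p} → IsAnti D A → rank p ≢ k → p ∈ A → p ∈ τ k A

-- The dihedral relation between rowmotion and rowvacuation

module Dihedral {n : ℕ} (P : RankedPoset n) (D : Fin n → Set)
                (down-closed : ∀ {p q} → D q → RankedPoset._≼_ P p q → D p)
                (τ : ℕ → Subset n → Subset n) (isT : RankedPoset.IsRankToggle P D τ)
                (T : ℕ) (rank<T : ∀ {p} → D p → RankedPoset.rank P p ℕ.< T) where

  open RankedPoset P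
  open IsRankToggle isT
  open Operators τ

  private
    Anti = IsAnti D

  up-anti : ∀ j k {A} → Anti A → Anti (up j k A)
  up-anti j zero    a = a
  up-anti j (suc k) a = up-anti (suc j) k (anti a)

  down-anti : ∀ j k {A} → Anti A → Anti (down j k A)
  down-anti j zero    a = a
  down-anti j (suc k) a = anti (down-anti (suc j) k a)

  vac-anti : ∀ j k {A} → Anti A → Anti (vac j k A)
  vac-anti j zero    a = a
  vac-anti j (suc k) a = vac-anti (suc j) k (up-anti j (suc k) a)

  τ-involutive : ∀ k {A} → Anti A → τ k (τ k A) ≡ A
  τ-involutive k {A} a = ⊆-antisym to from
    where
    to : ∀ {p} → p ∈ τ k (τ k A) → p ∈ A
    to {p} m with rank p ℕ.≟ k
    ... | no  ne = out→ a ne (out→ (anti a) ne m)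
    ... | yes e with Comparable? A p
    ...   | no  nc = contradiction (p , in← a (proj₁ (anti (anti a)) m) e nc , inj₁ ≼-refl) (in→ (anti a) e m)
    ...   | yes (q , q∈A , c) with rank q ℕ.≟ k
    ...     | no  ne = contradiction (q , out← a ne q∈A , c) (in→ (anti a) e m)
    ...     | yes e′ with c
    ...       | inj₁ q≼p = subst (_∈ A) (≼-rank≡ q≼p (trans e′ (sym e))) q∈A
    ...       | inj₂ p≼q = subst (_∈ A) (sym (≼-rank≡ p≼q (trans e (sym e′)))) q∈A
    from : ∀ {p} → p ∈ A → p ∈ τ k (τ k A)
    from {p} m with rank p ℕ.≟ k
    ... | no  ne = out← (anti a) ne (out← a ne m)
    ... | yes e  = in← (anti a) (proj₁ a m) e nc
      where
      nc : ¬ Comparable (τ k A) p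
      nc (q , q∈ , c) with rank q ℕ.≟ k
      nc (q , q∈ , c) | yes e′ = in→ a e′ q∈ (p , m , Sum⊎.swap c)
      nc (q , q∈ , inj₁ q≼p) | no ne = ne (trans (cong rank (proj₂ a (out→ a ne q∈) m q≼p)) e)
      nc (q , q∈ , inj₂ p≼q) | no ne = ne (trans (cong rank (sym (proj₂ a m (out→ a ne q∈) p≼q))) e)

  down-up : ∀ j k {A} → Anti A → down j k (up j k A) ≡ A
  down-up j zero    a = refl
  down-up j (suc k) a = trans (cong (τ j) (down-up (suc j) k (anti a))) (τ-involutive j a)

  up-down : ∀ j k {A} → Anti A → up j k (down j k A) ≡ A
  up-down j zero    a = refl
  up-down j (suc k) a =
    trans (cong (up (suc j) k) (τ-involutive j (down-anti (suc j) k a))) (up-down (suc j) k a)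

  up-low→ : ∀ j k {A p} → Anti A → rank p ℕ.< j → p ∈ up j k A → p ∈ A
  up-low→ j zero    a l m = m
  up-low→ j (suc k) a l m = out→ a (ℕₚ.<⇒≢ l) (up-low→ (suc j) k (anti a) (ℕₚ.m<n⇒m<1+n l) m)

  up-low← : ∀ j k {A p} → Anti A → rank p ℕ.< j → p ∈ A → p ∈ up j k A
  up-low← j zero    a l m = m
  up-low← j (suc k) a l m = up-low← (suc j) k (anti a) (ℕₚ.m<n⇒m<1+n l) (out← a (ℕₚ.<⇒≢ l) m)

  -- Recursive form of Row(A) = min{x : x ≰ y for all y ∈ A}: with `B` the outcome, minimality of p
  -- is tested only against the elements of `B`.
  Free : Subset n → Subset n → Fin n → Set
  Free A B p = (∀ {q} → q ∈ B → q ≼ p → p ≡ q) × (∀ {q} → q ∈ A → ¬ (p ≼ q))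

  up-high→ : ∀ j k {A p} → Anti A → j ℕ.≤ rank p → rank p ℕ.< j ℕ.+ k → p ∈ up j k A → Free A (up j k A) p
  up-high→ j zero    {A} {p} a l u m = ⊥-elim (ℕₚ.<⇒≱ (subst (rank p ℕ.<_) (ℕₚ.+-identityʳ j) u) l)
  up-high→ j (suc k) {A} {p} a l u m with rank p ℕ.≟ j
  ... | yes e = (λ q∈ q≼p → sym (proj₂ (up-anti j (suc k) a) q∈ m q≼p))
              , λ q∈ p≼q → in→ a e (up-low→ (suc j) k (anti a) (s≤s (ℕₚ.≤-reflexive e)) m) (_ , q∈ , inj₂ p≼q)
  ... | no ne = proj₁ rec , λ {q} q∈ p≼q → proj₂ rec (out← a (λ e → ne (ℕₚ.≤-antisym (ℕₚ.≤-trans (rank-mono-≤ p≼q) (ℕₚ.≤-reflexive e)) l)) q∈) p≼q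
    where rec = up-high→ (suc j) k (anti a) (ℕₚ.≤∧≢⇒< l (ne ∘ sym)) (subst (rank p ℕ.<_) (ℕₚ.+-suc j k) u) m

  up-high← : ∀ j k {A p} → Anti A → D p → j ℕ.≤ rank p → rank p ℕ.< j ℕ.+ k →
             (∀ {q} → q ∈ up j k A → q ≼ p → p ≡ q) → (∀ {q} → q ∈ A → ¬ (p ≼ q)) → p ∈ up j k A
  up-high← j zero    {A} {p} a d l u f g = ⊥-elim (ℕₚ.<⇒≱ (subst (rank p ℕ.<_) (ℕₚ.+-identityʳ j) u) l)
  up-high← j (suc k) {A} {p} a d l u f g with rank p ℕ.≟ j
  ... | yes e = up-low← (suc j) k (anti a) (s≤s (ℕₚ.≤-reflexive e)) (in← a d e nc)
    where
    nc : ¬ Comparable A p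
    nc (q , q∈ , inj₂ p≼q) = g q∈ p≼q
    nc (q , q∈ , inj₁ q≼p) with p ≟F q
    ... | yes refl = g q∈ ≼-refl
    ... | no  ne   = ne (f (up-low← j (suc k) a (subst (rank q ℕ.<_) e (rank-mono q≼p (ne ∘ sym))) q∈) q≼p)
  ... | no ne = up-high← (suc j) k (anti a) d j<p (subst (rank p ℕ.<_) (ℕₚ.+-suc j k) u) f
                 λ {q} q∈ p≼q → g (out→ a (λ e → ℕₚ.<⇒≱ j<p (ℕₚ.≤-trans (rank-mono-≤ p≼q) (ℕₚ.≤-reflexive e))) q∈) p≼q
    where
    j<p = ℕₚ.≤∧≢⇒< l (λ e → ne (sym e))

  -- If nothing of `up j k A` lies at or under p, then p itself passes the test of `up-high←`. The
  -- condition j + k = T ensures that every rank from j on is swept. So from rank j on, the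
  -- complement of the ideal of `A` lies in the filter generated by `up j k A`.
  not-below⇒above : ∀ j k → j ℕ.+ k ≡ T → ∀ {A p} → Anti A → D p → j ℕ.≤ rank p → ¬ Below A p → Above (up j k A) p
  not-below⇒above j k jk {A} {p} a d l nb with any? (λ q → (q ∈? up j k A) ×-dec (q ≼? p))
  ... | yes ab = ab
  ... | no  na = p , up-high← j k a d l (subst (rank p ℕ.<_) (sym jk) (rank<T d))
                       (λ q∈ q≼p → ⊥-elim (na (_ , q∈ , q≼p))) (λ q∈ p≼q → nb (_ , q∈ , p≼q)) , ≼-refl

  -- Elements of `up j k A` of rank at least j are not below anything in `A`; the witness under p
  -- must therefore be one of the untouched elements of `A` of rank less than j.
  above∧below⇒low : ∀ j k → j ℕ.+ k ≡ T → ∀ {A p} → Anti A → Above (up j k A) p → Below A p →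
                    ∃ λ q → q ∈ A × rank q ℕ.< j × q ≼ p
  above∧below⇒low j k jk {A} {p} a (q , q∈ , q≼p) (b , b∈ , p≼b) with rank q ℕ.<? j
  ... | yes l = q , up-low→ j k a l q∈ , l , q≼p
  ... | no  l = ⊥-elim (proj₂ (up-high→ j k a (ℕₚ.≮⇒≥ l) (subst (rank q ℕ.<_) (sym jk) (rank<T (proj₁ (up-anti j k a) q∈))) q∈)
                         b∈ (≼-trans q≼p p≼b))

  -- B and B′ are related as an antichain and the antichain of minimal elements obtained by
  -- toggling, at rank k, the order filter generated by it.
  record FilterToggle (k : ℕ) (B B′ : Subset n) : Set where
    field
      below→ : ∀ {p} → rank p ℕ.< k → p ∈ B′ → p ∈ B
      below← : ∀ {p} → rank p ℕ.< k → p ∈ B → p ∈ B′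
      at→    : ∀ {p} → rank p ≡ k → p ∈ B′ → ¬ Above B p × (∀ {q} → D q → rank q ≡ suc k → p ≼ q → Above B q)
      at←    : ∀ {p} → D p → rank p ≡ k → ¬ Above B p → (∀ {q} → D q → rank q ≡ suc k → p ≼ q → Above B q) → p ∈ B′
      next→  : ∀ {q} → rank q ≡ suc k → q ∈ B′ → Above B q × (∀ {p} → p ∈ B′ → p ≼ q → p ≡ q)
      next←  : ∀ {q} → D q → rank q ≡ suc k → Above B q → (∀ {p} → rank p ℕ.≤ k → p ∈ B′ → ¬ (p ≼ q)) → q ∈ B′

  module _ {k B B′} (ft : FilterToggle k B B′) where
    open FilterToggle ft

    private
      Strictly : Subset n → Fin n → Set
      Strictly A p = ∃ λ q → q ∈ A × q ≼ p × q ≢ p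

    -- Beyond rank k + 1 the filter does not notice the toggle at rank k: by `cover` the way from a
    -- generator of rank k up to p passes through rank k + 1, and there the old and the new filter
    -- agree.
    filter-transfer→ : ∀ {p} → D p → suc (suc k) ℕ.≤ rank p →
      (∀ {q} → suc (suc k) ℕ.≤ rank q → q ≼ p → q ≢ p → q ∈ B → q ∈ B′) → Strictly B p → Strictly B′ p
    filter-transfer→ {p} dp l h (q , q∈ , q≼p , q≢p) with ℕₚ.<-cmp (rank q) (suc k)
    ... | tri> _ _ g = q , h g q≼p q≢p q∈ , q≼p , q≢p
    ... | c = below-next c
      where
      at-next : ∀ {z} → Above B z → rank z ≡ suc k → z ≼ p → Strictly B′ p
      at-next {z} ab e z≼p with any? (λ y → (rank y ℕ.≤? k) ×-dec ((y ∈? B′) ×-dec (y ≼? z)))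
      ... | yes (y , ry , y∈ , y≼z) = y , y∈ , ≼-trans y≼z z≼p , λ { refl → ℕₚ.<⇒≱ l (ℕₚ.≤-trans ry (ℕₚ.n≤1+n k)) }
      ... | no  ny = z , next← (down-closed dp z≼p) e ab (λ r y∈ y≼z → ny (_ , r , y∈ , y≼z)) , z≼p
                       , λ { refl → ℕₚ.<⇒≱ l (ℕₚ.≤-reflexive e) }
      below-next : Tri (rank q ℕ.< suc k) (rank q ≡ suc k) (suc k ℕ.< rank q) → Strictly B′ p
      below-next (tri≈ _ e _) = at-next (q , q∈ , ≼-refl) e q≼p
      below-next (tri> _ _ g) = q , h g q≼p q≢p q∈ , q≼p , q≢p
      below-next (tri< g _ _) with rank q ℕ.<? k
      ... | yes r = q , below← r q∈ , q≼p , q≢p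
      ... | no  r with cover q≼p q≢p
      ...   | z , rz , q≼z , z≼p =
        at-next (q , q∈ , q≼z) (trans rz (cong suc (ℕₚ.≤-antisym (ℕ.s≤s⁻¹ g) (ℕₚ.≮⇒≥ r)))) z≼p

    filter-transfer← : ∀ {p} → D p → suc (suc k) ℕ.≤ rank p →
      (∀ {q} → suc (suc k) ℕ.≤ rank q → q ≼ p → q ≢ p → q ∈ B′ → q ∈ B) → Strictly B′ p → Strictly B p
    filter-transfer← {p} dp l h (q , q∈ , q≼p , q≢p) with ℕₚ.<-cmp (rank q) (suc k)
    ... | tri> _ _ g = q , h g q≼p q≢p q∈ , q≼p , q≢p
    ... | c = below-next c
      where
      at-next : ∀ {z} → Above B z → rank z ≡ suc k → z ≼ p → Strictly B p
      at-next (y , y∈ , y≼z) e z≼p = y , y∈ , ≼-trans y≼z z≼p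
                                   , λ { refl → ℕₚ.<⇒≱ l (ℕₚ.≤-trans (rank-mono-≤ y≼z) (ℕₚ.≤-reflexive e)) }
      below-next : Tri (rank q ℕ.< suc k) (rank q ≡ suc k) (suc k ℕ.< rank q) → Strictly B p
      below-next (tri≈ _ e _) = at-next (proj₁ (next→ e q∈)) e q≼p
      below-next (tri> _ _ g) = q , h g q≼p q≢p q∈ , q≼p , q≢p
      below-next (tri< g _ _) with rank q ℕ.<? k
      ... | yes r = q , below→ r q∈ , q≼p , q≢p
      ... | no  r with cover q≼p q≢p
      ...   | z , rz , q≼z , z≼p = at-next (proj₂ (at→ rank-q q∈) (down-closed dp z≼p) rz′ q≼z) rz′ z≼p
        where
        rank-q : rank q ≡ k
        rank-q = ℕₚ.≤-antisym (ℕ.s≤s⁻¹ g) (ℕₚ.≮⇒≥ r)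
        rz′ : rank z ≡ suc k
        rz′ = trans rz (cong suc rank-q)

  module _ (j k : ℕ) (jk : suc j ℕ.+ k ≡ T) where

    private
      U : Subset n → Subset n
      U = up (suc j) k

      rank<sj+k : ∀ {p} → D p → rank p ℕ.< suc j ℕ.+ k
      rank<sj+k {p} d = subst (rank p ℕ.<_) (sym jk) (rank<T d)

    -- An element p of rank j is incomparable to `A` exactly when it is outside the filter of `U A`,
    -- so that nothing of `A` is at or under it, while all elements of rank j + 1 above it are
    -- outside the ideal of `A`, hence inside that filter. This is the rule for adding p to a
    -- filter, or removing it, as a minimal element.
    up-filterToggle : ∀ {A} → Anti A → FilterToggle j (U A) (U (τ j A))
    up-filterToggle {A} a = record
      { below→ = λ l m → up-low← (suc j) k a (ℕₚ.m<n⇒m<1+n l) (out→ a (ℕₚ.<⇒≢ l) (up-low→ (suc j) k a₁ (ℕₚ.m<n⇒m<1+n l) m))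
      ; below← = λ l m → up-low← (suc j) k a₁ (ℕₚ.m<n⇒m<1+n l) (out← a (ℕₚ.<⇒≢ l) (up-low→ (suc j) k a (ℕₚ.m<n⇒m<1+n l) m))
      ; at→    = at→ ; at← = at← ; next→ = next→ ; next← = next← }
      where
      a₁ : Anti (τ j A)
      a₁ = anti a
      low≢ : ∀ {p q} → rank q ≡ suc j → q ≼ p → rank p ≢ j
      low≢ e q≼p e′ = ℕₚ.<⇒≱ (ℕₚ.≤-reflexive (sym e)) (ℕₚ.≤-trans (rank-mono-≤ q≼p) (ℕₚ.≤-reflexive e′))
      at→ : ∀ {p} → rank p ≡ j → p ∈ U (τ j A) →
            ¬ Above (U A) p × (∀ {q} → D q → rank q ≡ suc j → p ≼ q → Above (U A) q)
      at→ {p} e m = (λ { (q , q∈ , q≼p) → nc (q , up-low→ (suc j) k a (s≤s (ℕₚ.≤-trans (rank-mono-≤ q≼p) (ℕₚ.≤-reflexive e))) q∈ , inj₁ q≼p) })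
                  , λ dq rq p≼q → not-below⇒above (suc j) k jk a dq (ℕₚ.≤-reflexive (sym rq))
                                    λ { (b , b∈ , q≼b) → nc (b , b∈ , inj₂ (≼-trans p≼q q≼b)) }
        where
        nc : ¬ Comparable A p
        nc = in→ a e (up-low→ (suc j) k a₁ (s≤s (ℕₚ.≤-reflexive e)) m)
      at← : ∀ {p} → D p → rank p ≡ j → ¬ Above (U A) p →
            (∀ {q} → D q → rank q ≡ suc j → p ≼ q → Above (U A) q) → p ∈ U (τ j A)
      at← {p} d e na f = up-low← (suc j) k a₁ (s≤s (ℕₚ.≤-reflexive e)) (in← a d e nc)
        where
        nc : ¬ Comparable A p
        nc (q , q∈ , inj₁ q≼p) = na (q , up-low← (suc j) k a (s≤s (ℕₚ.≤-trans (rank-mono-≤ q≼p) (ℕₚ.≤-reflexive e))) q∈ , q≼p)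
        nc (q , q∈ , inj₂ p≼q) with p ≟F q
        ... | yes refl = na (p , up-low← (suc j) k a (s≤s (ℕₚ.≤-reflexive e)) q∈ , ≼-refl)
        ... | no  p≢q with cover p≼q p≢q
        ...   | z , rz , p≼z , z≼q with above∧below⇒low (suc j) k jk a (f (down-closed (proj₁ a q∈) z≼q) (trans rz (cong suc e)) p≼z) (q , q∈ , z≼q)
        ...     | x , x∈ , rx , x≼z = ℕₚ.<⇒≱ rx (subst (suc j ℕ.≤_) (cong rank (sym (proj₂ a x∈ q∈ (≼-trans x≼z z≼q))))
                                        (subst (ℕ._≤ rank q) (trans rz (cong suc e)) (rank-mono-≤ z≼q)))
      next→ : ∀ {q} → rank q ≡ suc j → q ∈ U (τ j A) →
              Above (U A) q × (∀ {p} → p ∈ U (τ j A) → p ≼ q → p ≡ q)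
      next→ {q} e m = not-below⇒above (suc j) k jk a (proj₁ a₂ m) (ℕₚ.≤-reflexive (sym e))
                        (λ { (b , b∈ , q≼b) → proj₂ (up-high→ (suc j) k a₁ (ℕₚ.≤-reflexive (sym e)) (rank<sj+k (proj₁ a₂ m)) m)
                                                (out← a (low≢ e q≼b) b∈) q≼b })
                    , λ p∈ p≼q → proj₂ a₂ p∈ m p≼q
        where
        a₂ = up-anti (suc j) k a₁
      next← : ∀ {q} → D q → rank q ≡ suc j → Above (U A) q →
              (∀ {p} → rank p ℕ.≤ j → p ∈ U (τ j A) → ¬ (p ≼ q)) → q ∈ U (τ j A)
      next← {q} d e ab f = up-high← (suc j) k a₁ d (ℕₚ.≤-reflexive (sym e)) (rank<sj+k d) min λ {b} b∈ q≼b →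
          nb (b , out→ a (low≢ e q≼b) b∈ , q≼b)
        where
        min : ∀ {p} → p ∈ U (τ j A) → p ≼ q → q ≡ p
        min {p} p∈ p≼q with p ≟F q
        ... | yes eq = sym eq
        ... | no  ne = ⊥-elim (f (ℕ.s≤s⁻¹ (subst (rank p ℕ.<_) e (rank-mono p≼q ne))) p∈ p≼q)
        nb : ¬ Below A q
        nb (b , b∈ , q≼b) with above∧below⇒low (suc j) k jk a ab (b , b∈ , q≼b)
        ... | x , x∈ , rx , x≼q = ℕₚ.<⇒≱ rx (subst (λ t → suc j ℕ.≤ rank t) (sym (proj₂ a x∈ b∈ (≼-trans x≼q q≼b)))
                                    (subst (ℕ._≤ rank b) e (rank-mono-≤ q≼b)))

    -- Membership at these ranks is minimality, decided by what lies strictly below. By induction on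
    -- the rank the lower generators agree, and then `filter-transfer→` and `filter-transfer←`
    -- apply.
    up-τ-high : ∀ {A} → Anti A → ∀ {p} → suc (suc j) ℕ.≤ rank p → Acc ℕ._<_ (rank p) →
                (p ∈ U A → p ∈ U (τ j A)) × (p ∈ U (τ j A) → p ∈ U A)
    up-τ-high {A} a {p} l (acc rs) = to , from
      where
      a₁ = anti a
      ft = up-filterToggle a
      j<p = ℕₚ.≤-trans (ℕₚ.n≤1+n _) l
      far : ∀ {q} → p ≼ q → rank q ≢ j
      far p≼q e = ℕₚ.<⇒≱ j<p (ℕₚ.≤-trans (rank-mono-≤ p≼q) (ℕₚ.≤-trans (ℕₚ.≤-reflexive e) ℕₚ.≤-refl))
      IH : ∀ {q} → suc (suc j) ℕ.≤ rank q → q ≼ p → q ≢ p → (q ∈ U A → q ∈ U (τ j A)) × (q ∈ U (τ j A) → q ∈ U A)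
      IH l′ q≼p q≢p = up-τ-high a l′ (rs (rank-mono q≼p q≢p))
      min : ∀ {B B′} → (∀ {q} → q ∈ B → q ≼ p → p ≡ q) →
            ((∃ λ q → q ∈ B′ × q ≼ p × q ≢ p) → (∃ λ q → q ∈ B × q ≼ p × q ≢ p)) →
            ∀ {q} → q ∈ B′ → q ≼ p → p ≡ q
      min f g {q} q∈ q≼p with q ≟F p
      ... | yes e = sym e
      ... | no ne with g (q , q∈ , q≼p , ne)
      ...   | x , x∈ , x≼p , x≢p = ⊥-elim (x≢p (sym (f x∈ x≼p)))
      to : p ∈ U A → p ∈ U (τ j A)
      to m = up-high← (suc j) k a₁ d j<p (rank<sj+k d)
               (min (proj₁ hi) (filter-transfer← ft d l (λ l′ q≼p q≢p → proj₂ (IH l′ q≼p q≢p))))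
               (λ q∈ p≼q → proj₂ hi (out→ a (far p≼q) q∈) p≼q)
        where
        d = proj₁ (up-anti (suc j) k a) m
        hi = up-high→ (suc j) k a j<p (rank<sj+k d) m
      from : p ∈ U (τ j A) → p ∈ U A
      from m = up-high← (suc j) k a d j<p (rank<sj+k d)
               (min (proj₁ hi) (filter-transfer→ ft d l (λ l′ q≼p q≢p → proj₁ (IH l′ q≼p q≢p))))
               (λ q∈ p≼q → proj₂ hi (out← a (far p≼q) q∈) p≼q)
        where
        d = proj₁ (up-anti (suc j) k a₁) m
        hi = up-high→ (suc j) k a₁ j<p (rank<sj+k d) m

    -- By up-filterToggle, this is the rank-j toggle of filters, written as a conjugate of an antichain toggle.
    filterToggle : Subset n → Subset n
    filterToggle B = U (τ j (down (suc j) k B))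

    filterToggle-anti : ∀ {B} → Anti B → Anti (filterToggle B)
    filterToggle-anti b = up-anti (suc j) k (anti (down-anti (suc j) k b))

    filterToggle-up : ∀ {A} → Anti A → filterToggle (U A) ≡ U (τ j A)
    filterToggle-up a = cong (λ X → U (τ j X)) (down-up (suc j) k a)

    filterToggle-spec : ∀ {B} → Anti B → FilterToggle j B (filterToggle B)
    filterToggle-spec {B} b = subst (λ X → FilterToggle j X (filterToggle B)) (up-down (suc j) k b)
                                (up-filterToggle (down-anti (suc j) k b))

    filterToggle-high : ∀ {B p} → Anti B → suc (suc j) ℕ.≤ rank p →
                        (p ∈ B → p ∈ filterToggle B) × (p ∈ filterToggle B → p ∈ B)
    filterToggle-high {B} {p} b l =
      subst (λ X → (p ∈ X → p ∈ filterToggle B) × (p ∈ filterToggle B → p ∈ X)) (up-down (suc j) k b)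
            (up-τ-high (down-anti (suc j) k b) l (<-wellFounded _))

  filterToggle-low : ∀ {j B B′ C C′} → FilterToggle j B B′ → FilterToggle j C C′ → Anti B′ →
    (∀ {p} → rank p ℕ.≤ suc j → p ∈ B → p ∈ C) → (∀ {p} → rank p ℕ.≤ suc j → p ∈ C → p ∈ B) →
    ∀ {p} → rank p ℕ.≤ j → p ∈ B′ → p ∈ C′
  filterToggle-low {j} {B} {B′} {C} {C′} fb fc b′ to from {p} l m with ℕₚ.<-cmp (rank p) j
  ... | tri< g _ _ = below← fc g (to (ℕₚ.m≤n⇒m≤1+n l) (below→ fb g m))
    where open FilterToggle
  ... | tri≈ _ e _ = at← fc (proj₁ b′ m) e
        (λ { (q , q∈ , q≼p) → proj₁ (at→ fb e m) (q , from (ℕₚ.≤-trans (rank-mono-≤ q≼p) (ℕₚ.m≤n⇒m≤1+n l)) q∈ , q≼p) })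
        λ dq rq p≼q → let (x , x∈ , x≼q) = proj₂ (at→ fb e m) dq rq p≼q
                      in x , to (ℕₚ.≤-trans (rank-mono-≤ x≼q) (ℕₚ.≤-reflexive rq)) x∈ , x≼q
    where open FilterToggle
  ... | tri> _ _ g = ⊥-elim (ℕₚ.<⇒≱ g l)

  -- The toggle at rank j reads only the generators of rank at most j + 1, so two filters that agree
  -- there still do so afterwards.
  filterToggle-local : ∀ {j B B′ C C′} → FilterToggle j B B′ → FilterToggle j C C′ → Anti B′ →
    (∀ {p} → rank p ℕ.≤ suc j → p ∈ B → p ∈ C) → (∀ {p} → rank p ℕ.≤ suc j → p ∈ C → p ∈ B) →
    (∀ {p} → rank p ℕ.≤ j → p ∈ C′ → p ∈ B′) →
    ∀ {p} → rank p ℕ.≤ suc j → p ∈ B′ → p ∈ C′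
  filterToggle-local {j} {B} {B′} {C} {C′} fb fc b′ to from low {p} l m with rank p ℕ.≤? j
  ... | yes r = filterToggle-low fb fc b′ to from r m
  ... | no  r = next← fc (proj₁ b′ m) rank-p
        (let (x , x∈ , x≼p) = proj₁ (next→ fb rank-p m) in x , to (ℕₚ.≤-trans (rank-mono-≤ x≼p) l) x∈ , x≼p)
        λ {q} r′ q∈ q≼p → ℕₚ.<⇒≱ (ℕₚ.≰⇒> r) (subst (λ t → rank t ℕ.≤ j) (proj₂ (next→ fb rank-p m) (low r′ q∈) q≼p) r′)
    where
    open FilterToggle
    rank-p : rank p ≡ suc j
    rank-p = ℕₚ.≤-antisym l (ℕₚ.≰⇒> r)

  module _ (j k : ℕ) (jk : suc j ℕ.+ k ≡ T) where

    -- The two operations do not see each other: the filter toggle keeps the generators of rank at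
    -- least j + 2 and the comparability of such elements with the generators, while `τ l` keeps the
    -- ranks up to j + 1, on which the filter toggle depends.
    τ-filterToggle : ∀ {l B} → suc (suc j) ℕ.≤ l → Anti B →
                     τ l (filterToggle j k jk B) ≡ filterToggle j k jk (τ l B)
    τ-filterToggle {l} {B} jl b = ⊆-antisym to from
      where
      c = anti b
      B′ = filterToggle j k jk B
      C′ = filterToggle j k jk (τ l B)
      fb : FilterToggle j B B′
      fb = filterToggle-spec j k jk b
      fc : FilterToggle j (τ l B) C′
      fc = filterToggle-spec j k jk c
      b′ : Anti B′
      b′ = filterToggle-anti j k jk b
      c′ : Anti C′
      c′ = filterToggle-anti j k jk c
      ne : ∀ {p} → rank p ℕ.≤ suc j → rank p ≢ l
      ne r e = ℕₚ.<⇒≱ jl (subst (ℕ._≤ suc j) e r)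
      bc : ∀ {p} → rank p ℕ.≤ suc j → p ∈ B → p ∈ τ l B
      bc r = out← b (ne r)
      cb : ∀ {p} → rank p ℕ.≤ suc j → p ∈ τ l B → p ∈ B
      cb r = out→ b (ne r)
      cmp→ : ∀ {p} → D p → suc (suc j) ℕ.≤ rank p → Comparable B p → Comparable B′ p
      cmp→ d r (q , q∈ , inj₂ p≼q) = q , proj₁ (filterToggle-high j k jk b (ℕₚ.≤-trans r (rank-mono-≤ p≼q))) q∈ , inj₂ p≼q
      cmp→ {p} d r (q , q∈ , inj₁ q≼p) with q ≟F p
      ... | yes refl = q , proj₁ (filterToggle-high j k jk b r) q∈ , inj₁ ≼-refl
      ... | no  q≢p with filter-transfer→ fb d r (λ r′ _ _ → proj₁ (filterToggle-high j k jk b r′)) (q , q∈ , q≼p , q≢p)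
      ...   | x , x∈ , x≼p , _ = x , x∈ , inj₁ x≼p
      cmp← : ∀ {p} → D p → suc (suc j) ℕ.≤ rank p → Comparable B′ p → Comparable B p
      cmp← d r (q , q∈ , inj₂ p≼q) = q , proj₂ (filterToggle-high j k jk b (ℕₚ.≤-trans r (rank-mono-≤ p≼q))) q∈ , inj₂ p≼q
      cmp← {p} d r (q , q∈ , inj₁ q≼p) with q ≟F p
      ... | yes refl = q , proj₂ (filterToggle-high j k jk b r) q∈ , inj₁ ≼-refl
      ... | no  q≢p with filter-transfer← fb d r (λ r′ _ _ → proj₂ (filterToggle-high j k jk b r′)) (q , q∈ , q≼p , q≢p)
      ...   | x , x∈ , x≼p , _ = x , x∈ , inj₁ x≼p
      to : ∀ {p} → p ∈ τ l B′ → p ∈ C′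
      to {p} m with suc (suc j) ℕ.≤? rank p
      ... | no r = filterToggle-local fb fc b′ bc cb (filterToggle-low fc fb c′ cb bc) r′ (out→ b′ (ne r′) m)
        where r′ = ℕ.s≤s⁻¹ (ℕₚ.≰⇒> r)
      ... | yes r with rank p ℕ.≟ l
      ...   | no  p≢l = proj₁ (filterToggle-high j k jk c r) (out← b p≢l (proj₂ (filterToggle-high j k jk b r) (out→ b′ p≢l m)))
      ...   | yes e = proj₁ (filterToggle-high j k jk c r) (in← b d e λ cm → in→ b′ e m (cmp→ d r cm))
        where d = proj₁ (anti b′) m
      from : ∀ {p} → p ∈ C′ → p ∈ τ l B′
      from {p} m with suc (suc j) ℕ.≤? rank p
      ... | no r = out← b′ (ne r′) (filterToggle-local fc fb c′ cb bc (filterToggle-low fb fc b′ bc cb) r′ m)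
        where r′ = ℕ.s≤s⁻¹ (ℕₚ.≰⇒> r)
      ... | yes r with rank p ℕ.≟ l
      ...   | no  p≢l = out← b′ p≢l (proj₁ (filterToggle-high j k jk b r) (out→ b p≢l (proj₂ (filterToggle-high j k jk c r) m)))
      ...   | yes e = in← b′ d e λ cm → in→ b e (proj₂ (filterToggle-high j k jk c r) m) (cmp← d r cm)
        where d = proj₁ c′ m

    up-filterToggle-comm : ∀ i m {B} → suc (suc j) ℕ.≤ i → Anti B →
                           up i m (filterToggle j k jk B) ≡ filterToggle j k jk (up i m B)
    up-filterToggle-comm i zero    r b = refl
    up-filterToggle-comm i (suc m) r b =
      trans (cong (up (suc i) m) (τ-filterToggle r b)) (up-filterToggle-comm (suc i) m (ℕₚ.m≤n⇒m≤1+n r) (anti b))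

    vac-filterToggle-comm : ∀ i m {B} → suc (suc j) ℕ.≤ i → Anti B →
                            vac i m (filterToggle j k jk B) ≡ filterToggle j k jk (vac i m B)
    vac-filterToggle-comm i zero    r b = refl
    vac-filterToggle-comm i (suc m) r b =
      trans (cong (vac (suc i) m) (up-filterToggle-comm i (suc m) r b))
            (vac-filterToggle-comm (suc i) m (ℕₚ.m≤n⇒m≤1+n r) (up-anti i (suc m) b))

  -- The dihedral relation Rvac ∘ Row = Row⁻¹ ∘ Rvac for the elements of rank ≥ j. By induction it
  -- amounts to τ j commuting with Row⁻¹ ∘ Rvac for the ranks > j, which is conjugate by up (suc j) k
  -- to the filter toggle commuting with the toggles of ranks ≥ j + 2.
  vac-up : ∀ j k → j ℕ.+ k ≡ T → ∀ {A} → Anti A → vac j k (up j k A) ≡ down j k (vac j k A)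
  vac-up j zero    jk a = refl
  vac-up j (suc k) jk {A} a = begin
    -- Both sides begin with X = U⁺ A, because `vac j (suc k)` does. What remains is V (U (τ_j X)) =
    -- τ_j U⁻¹ V X; the induction hypothesis turns the left side into U⁻¹ V (τ_j X), and `comm`
    -- moves τ_j outwards.
    V (U⁺ (U⁺ A)) ≡⟨ step (up-anti j (suc k) a) ⟩
    τ j (Uinv (V (U⁺ A))) ∎
    where
    open ≡-Reasoning
    jk′ : suc j ℕ.+ k ≡ T
    jk′ = trans (sym (ℕₚ.+-suc j k)) jk
    V Uinv U U⁺ : Subset n → Subset n
    V = vac (suc j) k
    U = up (suc j) k
    U⁺ = up j (suc k)
    Uinv = down (suc j) k
    comm : ∀ k {A} → suc j ℕ.+ k ≡ T → Anti A →
           down (suc j) k (vac (suc j) k (τ j A)) ≡ τ j (down (suc j) k (vac (suc j) k A))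
    comm zero jk a = refl
    comm (suc k) {A} jk a = begin
      dn (vv (uu (τ j A))) ≡⟨ cong (dn ∘ vv) (sym (filterToggle-up j (suc k) jk a)) ⟩
      dn (vv (filterToggle j (suc k) jk (uu A))) ≡⟨ cong dn (vac-filterToggle-comm j (suc k) jk (suc (suc j)) k ℕₚ.≤-refl (up-anti (suc j) (suc k) a)) ⟩
      dn (filterToggle j (suc k) jk (vv (uu A))) ≡⟨ down-up (suc j) (suc k) (anti (down-anti (suc j) (suc k) (vac-anti (suc j) (suc k) a))) ⟩
      τ j (dn (vv (uu A))) ∎
      where
      dn = down (suc j) (suc k)
      vv = vac (suc (suc j)) k
      uu = up (suc j) (suc k)
    step : ∀ {A} → Anti A → V (U⁺ A) ≡ τ j (Uinv (V A))
    step {A} a = trans (vac-up (suc j) k jk′ (anti a)) (comm k jk′ a)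

-- Inside a larger down-set E the toggles at rank 0 add the minimal elements outside D,
-- which then freeze everything outside D until they are removed again.
module Parabolic {n : ℕ} (P : RankedPoset n) {D E : Fin n → Set} (D? : ∀ p → Dec (D p))
                 (down-closed : ∀ {p q} → D q → RankedPoset._≼_ P p q → D p) (D⊆E : ∀ {p} → D p → E p)
                 (minimal : ∀ {p} → E p → ¬ D p → ∃ λ s → RankedPoset._≼_ P s p × RankedPoset.rank P s ≡ 0 × E s × ¬ D s)
                 {τ τ′ : ℕ → Subset n → Subset n}
                 (isT : RankedPoset.IsRankToggle P D τ) (isT′ : RankedPoset.IsRankToggle P E τ′) where

  open RankedPoset P
  private
    module τ = IsRankToggle isT
    module τ′ = IsRankToggle isT′
    module O = Operators τ
    module O′ = Operators τ′

  -- The state of the two parallel computations between the first and the last toggle at rank 0: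
  -- they agree inside `D`, and outside `D` the larger one consists of exactly the elements of rank
  -- 0.
  record Extends (A A′ : Subset n) : Set where
    field
      small-anti : IsAnti D A
      large-anti : IsAnti E A′
      inside→    : ∀ {p} → D p → p ∈ A′ → p ∈ A
      inside←    : ∀ {p} → p ∈ A → p ∈ A′
      outside→   : ∀ {p} → ¬ D p → p ∈ A′ → rank p ≡ 0
      outside←   : ∀ {p} → E p → ¬ D p → rank p ≡ 0 → p ∈ A′

    comparable : ∀ {p} → D p → Comparable A′ p → Comparable A p
    comparable {p} d (q , q∈ , c) with D? q
    ... | yes dq = q , inside→ dq q∈ , c
    comparable {p} d (q , q∈ , inj₁ q≼p) | no nq = contradiction (down-closed d q≼p) nq
    comparable {p} d (q , q∈ , inj₂ p≼q) | no nq = contradiction (subst D (≼-rank≡ p≼q rank≡) d) nq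
      where
      rq : rank q ≡ 0
      rq = outside→ nq q∈
      rank≡ : rank p ≡ rank q
      rank≡ = trans (ℕₚ.n≤0⇒n≡0 (subst (rank p ℕ.≤_) rq (rank-mono-≤ p≼q))) (sym rq)

  anti-⊆ : ∀ {A} → IsAnti D A → IsAnti E A
  anti-⊆ a = (λ m → D⊆E (proj₁ a m)) , proj₂ a

  extend : ∀ {A} → IsAnti D A → Extends (τ 0 A) (τ′ 0 A)
  extend {A} a = record
    { small-anti = τ.anti a ; large-anti = τ′.anti a′
    ; inside→ = in→ ; inside← = in←
    ; outside→ = λ np m → out→ np m
    ; outside← = λ ep np r → τ′.in← a′ ep r λ
        { (q , q∈ , inj₁ q≼p) → np (subst D (≼-rank≡ q≼p (trans (ℕₚ.n≤0⇒n≡0 (subst (rank q ℕ.≤_) r (rank-mono-≤ q≼p))) (sym r))) (proj₁ a q∈))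
        ; (q , q∈ , inj₂ p≼q) → np (down-closed (proj₁ a q∈) p≼q) } }
    where
    a′ = anti-⊆ a
    in→ : ∀ {p} → D p → p ∈ τ′ 0 A → p ∈ τ 0 A
    in→ {p} d m with rank p ℕ.≟ 0
    ... | yes e = τ.in← a d e (τ′.in→ a′ e m)
    ... | no ne = τ.out← a ne (τ′.out→ a′ ne m)
    in← : ∀ {p} → p ∈ τ 0 A → p ∈ τ′ 0 A
    in← {p} m with rank p ℕ.≟ 0
    ... | yes e = τ′.in← a′ (D⊆E (proj₁ (τ.anti a) m)) e (τ.in→ a e m)
    ... | no ne = τ′.out← a′ ne (τ.out→ a ne m)
    out→ : ∀ {p} → ¬ D p → p ∈ τ′ 0 A → rank p ≡ 0
    out→ {p} np m with rank p ℕ.≟ 0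
    ... | yes e = e
    ... | no ne = contradiction (proj₁ a (τ′.out→ a′ ne m)) np

  step : ∀ {k A A′} → k ≢ 0 → Extends A A′ → Extends (τ k A) (τ′ k A′)
  step {k} {A} {A′} k≢0 x = record
    { small-anti = τ.anti small-anti ; large-anti = τ′.anti large-anti
    ; inside→ = in→ ; inside← = in← ; outside→ = out→
    ; outside← = λ ep np r → τ′.out← large-anti (λ e → k≢0 (trans (sym e) r)) (outside← ep np r) }
    where
    open Extends x
    in→ : ∀ {p} → D p → p ∈ τ′ k A′ → p ∈ τ k A
    in→ {p} d m with rank p ℕ.≟ k
    ... | no ne = τ.out← small-anti ne (inside→ d (τ′.out→ large-anti ne m))
    ... | yes e = τ.in← small-anti d e λ { (q , q∈ , c) → τ′.in→ large-anti e m (q , inside← q∈ , c) }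
    in← : ∀ {p} → p ∈ τ k A → p ∈ τ′ k A′
    in← {p} m with rank p ℕ.≟ k
    ... | no ne = τ′.out← large-anti ne (inside← (τ.out→ small-anti ne m))
    ... | yes e = τ′.in← large-anti (D⊆E d) e λ c → τ.in→ small-anti e m (comparable d c)
      where d = proj₁ (τ.anti small-anti) m
    out→ : ∀ {p} → ¬ D p → p ∈ τ′ k A′ → rank p ≡ 0
    out→ {p} np m with rank p ℕ.≟ k
    ... | no ne = outside→ np (τ′.out→ large-anti ne m)
    -- An outside element of positive rank lies above an outside element of rank 0, which is present
    -- and blocks it.
    ... | yes e with minimal (proj₁ (τ′.anti large-anti) m) np
    ...   | s , s≼p , rs , es , ns = contradiction (s , outside← es ns rs , inj₁ s≼p) (τ′.in→ large-anti e m)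

  retract : ∀ {A A′} → Extends A A′ → τ′ 0 A′ ≡ τ 0 A
  retract {A} {A′} x = ⊆-antisym to from
    where
    open Extends x
    to : ∀ {p} → p ∈ τ′ 0 A′ → p ∈ τ 0 A
    to {p} m with rank p ℕ.≟ 0 | D? p
    ... | yes e | yes d = τ.in← small-anti d e λ { (q , q∈ , c) → τ′.in→ large-anti e m (q , inside← q∈ , c) }
    ... | yes e | no nd = contradiction (p , outside← (proj₁ (τ′.anti large-anti) m) nd e , inj₁ ≼-refl) (τ′.in→ large-anti e m)
    ... | no ne | yes d = τ.out← small-anti ne (inside→ d (τ′.out→ large-anti ne m))
    ... | no ne | no nd = contradiction (outside→ nd (τ′.out→ large-anti ne m)) ne
    from : ∀ {p} → p ∈ τ 0 A → p ∈ τ′ 0 A′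
    from {p} m with rank p ℕ.≟ 0
    ... | no ne = τ′.out← large-anti ne (inside← (τ.out→ small-anti ne m))
    ... | yes e = τ′.in← large-anti (D⊆E d) e λ c → τ.in→ small-anti e m (comparable d c)
      where d = proj₁ (τ.anti small-anti) m

  up-step : ∀ j k {A A′} → Extends A A′ → Extends (O.up (suc j) k A) (O′.up (suc j) k A′)
  up-step j zero    x = x
  up-step j (suc k) x = up-step (suc j) k (step (λ ()) x)

  down-step : ∀ j k {A A′} → Extends A A′ → Extends (O.down (suc j) k A) (O′.down (suc j) k A′)
  down-step j zero    x = x
  down-step j (suc k) x = step (λ ()) (down-step (suc j) k x)

  vac-step : ∀ j k {A A′} → Extends A A′ → Extends (O.vac (suc j) k A) (O′.vac (suc j) k A′)
  vac-step j zero    x = x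
  vac-step j (suc k) x = vac-step (suc j) k (up-step j (suc k) x)

  -- In Row⁻¹ Rvac the toggle at rank 0 occurs twice, as the very first and the very last step: the
  -- first `up` of `vac` starts with it and `down` ends with it. Everything in between has positive
  -- rank and preserves `Extends`. This is why Row⁻¹ Rvac, and not Rvac itself, is compatible with
  -- the inclusion.
  down-vac-parabolic : ∀ M {A} → IsAnti D A →
    O′.down 0 (suc M) (O′.vac 0 (suc M) A) ≡ O.down 0 (suc M) (O.vac 0 (suc M) A)
  down-vac-parabolic M a = retract (down-step 0 M (vac-step 0 M (up-step 0 M (extend a))))

-- Linear algebra over the root lattice

vec-ext : ∀ {A : Set} {n} {u v : Vec A n} → (∀ k → lookup u k ≡ lookup v k) → u ≡ v
vec-ext {u = u} {v} h = trans (sym (tabulate∘lookup u)) (trans (tabulate-cong h) (tabulate∘lookup v))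

∑ : ∀ {n} → (Fin n → ℤ) → ℤ
∑ f = sumℤ (tabulate f)

∑-cong : ∀ {n} {f g : Fin n → ℤ} → (∀ k → f k ≡ g k) → ∑ f ≡ ∑ g
∑-cong h = cong sumℤ (tabulate-cong h)

∑-zero : ∀ n → ∑ {n} (λ _ → 0ℤ) ≡ 0ℤ
∑-zero zero    = refl
∑-zero (suc n) = trans (+-identityˡ _) (∑-zero n)

private
  interchange : ∀ a b c d → (a + b) + (c + d) ≡ (a + c) + (b + d)
  interchange = solve-∀

∑-+ : ∀ {n} (f g : Fin n → ℤ) → ∑ (λ k → f k + g k) ≡ ∑ f + ∑ g
∑-+ {zero}  f g = refl
∑-+ {suc n} f g = trans (cong ((f zero + g zero) +_) (∑-+ (λ k → f (suc k)) (λ k → g (suc k))))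
                        (interchange (f zero) (g zero) (∑ (λ k → f (suc k))) (∑ (λ k → g (suc k))))

∑-*ˡ : ∀ {n} c (f : Fin n → ℤ) → ∑ (λ k → c * f k) ≡ c * ∑ f
∑-*ˡ {zero}  c f = sym (*-zeroʳ c)
∑-*ˡ {suc n} c f = trans (cong ((c * f zero) +_) (∑-*ˡ c (λ k → f (suc k)))) (sym (*-distribˡ-+ c (f zero) (∑ (λ k → f (suc k)))))

∑-lin : ∀ {n} a b (f g : Fin n → ℤ) → ∑ (λ k → a * f k + b * g k) ≡ a * ∑ f + b * ∑ g
∑-lin a b f g = trans (∑-+ (λ k → a * f k) (λ k → b * g k)) (cong₂ _+_ (∑-*ˡ a f) (∑-*ˡ b g))

∑-swap : ∀ {m n} (f : Fin m → Fin n → ℤ) → ∑ (λ i → ∑ (λ j → f i j)) ≡ ∑ (λ j → ∑ (λ i → f i j))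
∑-swap {zero}  {n} f = sym (∑-zero n)
∑-swap {suc m} f = trans (cong (∑ (f zero) +_) (∑-swap (λ i → f (suc i)))) (sym (∑-+ (f zero) (λ j → ∑ (λ i → f (suc i) j))))

δ : ∀ {r} → Fin r → Fin r → ℤ
δ i k = if ⌊ k ≟F i ⌋ then pos 1 else pos 0

δ-refl : ∀ {r} (i : Fin r) → δ i i ≡ 1ℤ
δ-refl i with i ≟F i
... | yes _ = refl
... | no ne = contradiction refl ne

δ-≢ : ∀ {r} {i k : Fin r} → i ≢ k → δ i k ≡ 0ℤ
δ-≢ {i = i} {k} ne with k ≟F i
... | yes e = contradiction (sym e) ne
... | no _  = refl

δ-sym : ∀ {r} (i k : Fin r) → δ i k ≡ δ k i
δ-sym i k with k ≟F i | i ≟F k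
... | yes _ | yes _ = refl
... | no _  | no _  = refl
... | yes e | no ne = contradiction (sym e) ne
... | no ne | yes e = contradiction (sym e) ne

δ-suc : ∀ {r} (i k : Fin r) → δ (suc i) (suc k) ≡ δ i k
δ-suc i k with k ≟F i
... | yes _ = refl
... | no _  = refl

∑-δ : ∀ {r} (f : Fin r → ℤ) i → ∑ (λ k → f k * δ i k) ≡ f i
∑-δ {suc r} f zero = trans (cong ((f zero * 1ℤ) +_) (trans (∑-cong (λ k → *-zeroʳ (f (suc k)))) (∑-zero r)))
                           (trans (+-identityʳ _) (*-identityʳ _))
∑-δ {suc r} f (suc i) = trans (cong₂ _+_ (*-zeroʳ (f zero)) (∑-cong (λ k → cong (f (suc k) *_) (δ-suc i k))))
                              (trans (+-identityˡ _) (∑-δ (λ k → f (suc k)) i))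

∑-nonneg : ∀ {n} (f : Fin n → ℤ) → (∀ k → 0ℤ ≤ f k) → 0ℤ ≤ ∑ f
∑-nonneg {zero}  f h = ≤-refl
∑-nonneg {suc n} f h = +-mono-≤ (h zero) (∑-nonneg (λ k → f (suc k)) (λ k → h (suc k)))

≤-∑ : ∀ {n} (f : Fin n → ℤ) → (∀ k → 0ℤ ≤ f k) → ∀ k → f k ≤ ∑ f
≤-∑ {suc n} f h zero = ≤-trans (≤-reflexive (sym (+-identityʳ _)))
                               (+-monoʳ-≤ (f zero) (∑-nonneg (λ k → f (suc k)) (λ k → h (suc k))))
≤-∑ {suc n} f h (suc k) = ≤-trans (≤-∑ (λ k → f (suc k)) (λ k → h (suc k)) k)
                                  (≤-trans (≤-reflexive (sym (+-identityˡ _))) (+-monoˡ-≤ _ (h zero)))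

∑-mono : ∀ {n} {f g : Fin n → ℤ} → (∀ k → f k ≤ g k) → ∑ f ≤ ∑ g
∑-mono {zero}  h = ≤-refl
∑-mono {suc n} h = +-mono-≤ (h zero) (∑-mono (λ k → h (suc k)))

∑-nonneg-zero : ∀ {n} (f : Fin n → ℤ) → (∀ k → 0ℤ ≤ f k) → ∑ f ≤ 0ℤ → ∀ k → f k ≡ 0ℤ
∑-nonneg-zero f h s k = ≤-antisym (≤-trans (≤-∑ f h k) s) (h k)

infixl 6 _⊕_
infixr 7 _⊙_

_⊕_ : ∀ {r} → Vec ℤ r → Vec ℤ r → Vec ℤ r
_⊕_ = Vec.zipWith _+_

_⊙_ : ∀ {r} → ℤ → Vec ℤ r → Vec ℤ r
a ⊙ v = Vec.map (a *_) v

lookup-⊕ : ∀ {r} (u v : Vec ℤ r) k → lookup (u ⊕ v) k ≡ lookup u k + lookup v k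
lookup-⊕ u v k = lookup-zipWith _+_ k u v

lookup-⊙ : ∀ {r} a (v : Vec ℤ r) k → lookup (a ⊙ v) k ≡ a * lookup v k
lookup-⊙ a v k = lookup-map k (a *_) v

lookup-e : ∀ {r} (i k : Fin r) → lookup (e i) k ≡ δ i k
lookup-e i k = lookup∘tabulate _ k

dot : ∀ {r} → (Fin r → ℤ) → Vec ℤ r → ℤ
dot f v = ∑ (λ k → f k * lookup v k)

dot-e : ∀ {r} (f : Fin r → ℤ) i → dot f (e i) ≡ f i
dot-e f i = trans (∑-cong (λ k → cong (f k *_) (lookup-e i k))) (∑-δ f i)

dot-δ : ∀ {r} (v : Vec ℤ r) i → dot (δ i) v ≡ lookup v i
dot-δ v i = trans (∑-cong (λ k → *-comm (δ i k) (lookup v k))) (∑-δ (lookup v) i)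

dot-⊕ : ∀ {r} (f : Fin r → ℤ) u v → dot f (u ⊕ v) ≡ dot f u + dot f v
dot-⊕ f u v = trans (∑-cong (λ k → trans (cong (f k *_) (lookup-⊕ u v k)) (*-distribˡ-+ (f k) (lookup u k) (lookup v k)))) (∑-+ (λ k → f k * lookup u k) (λ k → f k * lookup v k))

dot-⊙ : ∀ {r} (f : Fin r → ℤ) a v → dot f (a ⊙ v) ≡ a * dot f v
dot-⊙ f a v = trans (∑-cong (λ k → trans (cong (f k *_) (lookup-⊙ a v k)) (swap (f k) a (lookup v k)))) (∑-*ˡ a (λ k → f k * lookup v k))
  where
  swap : ∀ x a y → x * (a * y) ≡ a * (x * y)
  swap = solve-∀

dot-lin : ∀ {r} a b (f g : Fin r → ℤ) v → dot (λ k → a * f k + b * g k) v ≡ a * dot f v + b * dot g v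
dot-lin a b f g v = trans (∑-cong (λ k → expand a b (f k) (g k) (lookup v k))) (∑-lin a b (λ k → f k * lookup v k) (λ k → g k * lookup v k))
  where
  expand : ∀ a b x y z → (a * x + b * y) * z ≡ a * (x * z) + b * (y * z)
  expand = solve-∀

dot-cong : ∀ {r} {f g : Fin r → ℤ} → (∀ k → f k ≡ g k) → ∀ v → dot f v ≡ dot g v
dot-cong h v = ∑-cong (λ k → cong (_* lookup v k) (h k))

dot-ext : ∀ {r} {f g : Fin r → ℤ} → (∀ v → dot f v ≡ dot g v) → ∀ k → f k ≡ g k
dot-ext {f = f} {g} h k = trans (sym (dot-e f k)) (trans (h (e k)) (dot-e g k))

dot-∑ : ∀ {r m} (x : Fin m → ℤ) (f : Fin m → Fin r → ℤ) v →
        dot (λ k → ∑ (λ l → x l * f l k)) v ≡ ∑ (λ l → x l * dot (f l) v)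
dot-∑ x f v = begin
  ∑ (λ k → ∑ (λ l → x l * f l k) * lookup v k) ≡⟨ ∑-cong (λ k → trans (*-comm (∑ (λ l → x l * f l k)) (lookup v k)) (sym (∑-*ˡ (lookup v k) (λ l → x l * f l k)))) ⟩
  ∑ (λ k → ∑ (λ l → lookup v k * (x l * f l k))) ≡⟨ ∑-swap (λ k l → lookup v k * (x l * f l k)) ⟩
  ∑ (λ l → ∑ (λ k → lookup v k * (x l * f l k))) ≡⟨ ∑-cong (λ l → trans (∑-cong (λ k → rot (lookup v k) (x l) (f l k))) (∑-*ˡ (x l) (λ k → f l k * lookup v k))) ⟩
  ∑ (λ l → x l * dot (f l) v) ∎
  where
  open ≡-Reasoning
  rot : ∀ a b c → a * (b * c) ≡ b * (c * a)
  rot = solve-∀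

-- The action of words on lattice vectors and on functionals

module Action {r : ℕ} (C : Cartan r) where

  lookup-sref : ∀ i v k → lookup (sref C i v) k ≡ lookup v k - pairing C i v * δ i k
  lookup-sref i v k = trans (lookup∘tabulate _ k) help
    where
    help : (if ⌊ k ≟F i ⌋ then lookup v k - pairing C i v else lookup v k) ≡ lookup v k - pairing C i v * δ i k
    help with k ≟F i
    ... | yes _ = cong (λ t → lookup v k - t) (sym (*-identityʳ _))
    ... | no _  = sym (trans (cong (λ t → lookup v k - t) (*-zeroʳ (pairing C i v))) (+-identityʳ _))

  lookup-sref-≢ : ∀ {i k} v → i ≢ k → lookup (sref C i v) k ≡ lookup v k
  lookup-sref-≢ {i} {k} v ne = trans (lookup-sref i v k)
    (trans (cong (λ t → lookup v k - pairing C i v * t) (δ-≢ ne))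
           (trans (cong (λ t → lookup v k - t) (*-zeroʳ (pairing C i v))) (+-identityʳ _)))

  lookup-sref-≡ : ∀ i v → lookup (sref C i v) i ≡ lookup v i - pairing C i v
  lookup-sref-≡ i v = trans (lookup-sref i v i)
    (cong (λ t → lookup v i - t) (trans (cong (pairing C i v *_) (δ-refl i)) (*-identityʳ _)))

  infixl 7 _◁_ _◁*_

  -- The right action f ↦ f ∘ sᵢ. Through `lookup-act` each coordinate of `act C w v` becomes a
  -- functional of v, which yields linearity of the action without an induction on w.
  _◁_ : (Fin r → ℤ) → Fin r → (Fin r → ℤ)
  (f ◁ i) k = f k - f i * C i k

  _◁*_ : (Fin r → ℤ) → Word r → (Fin r → ℤ)
  f ◁* []      = f
  f ◁* (i ∷ w) = (f ◁ i) ◁* w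

  private
    rearrange : ∀ f v p d → f * (v - p * d) ≡ 1ℤ * (f * v) + (- p) * (f * d)
    rearrange = solve-∀
    rearrange′ : ∀ f c v x → (f - x * c) * v ≡ 1ℤ * (f * v) + (- x) * (c * v)
    rearrange′ = solve-∀
    swap : ∀ t p x → 1ℤ * t + (- p) * x ≡ 1ℤ * t + (- x) * p
    swap = solve-∀

  dot-sref : ∀ f i v → dot f (sref C i v) ≡ dot (f ◁ i) v
  dot-sref f i v = begin
    ∑ (λ k → f k * lookup (sref C i v) k) ≡⟨ ∑-cong (λ k → trans (cong (f k *_) (lookup-sref i v k)) (rearrange (f k) (lookup v k) (pairing C i v) (δ i k))) ⟩
    ∑ (λ k → 1ℤ * (f k * lookup v k) + (- pairing C i v) * (f k * δ i k)) ≡⟨ ∑-lin 1ℤ (- pairing C i v) (λ k → f k * lookup v k) (λ k → f k * δ i k) ⟩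
    1ℤ * dot f v + (- pairing C i v) * ∑ (λ k → f k * δ i k) ≡⟨ cong (λ t → 1ℤ * dot f v + (- pairing C i v) * t) (∑-δ f i) ⟩
    1ℤ * dot f v + (- pairing C i v) * f i ≡⟨ swap (dot f v) (pairing C i v) (f i) ⟩
    1ℤ * dot f v + (- f i) * pairing C i v ≡⟨ sym (∑-lin 1ℤ (- f i) (λ k → f k * lookup v k) (λ k → C i k * lookup v k)) ⟩
    ∑ (λ k → 1ℤ * (f k * lookup v k) + (- f i) * (C i k * lookup v k)) ≡⟨ ∑-cong (λ k → sym (rearrange′ (f k) (C i k) (lookup v k) (f i))) ⟩
    dot (f ◁ i) v ∎
    where open ≡-Reasoning

  dot-act : ∀ f w v → dot f (act C w v) ≡ dot (f ◁* w) v
  dot-act f []      v = refl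
  dot-act f (i ∷ w) v = trans (dot-sref f i (act C w v)) (dot-act (f ◁ i) w v)

  lookup-act : ∀ w v k → lookup (act C w v) k ≡ dot (δ k ◁* w) v
  lookup-act w v k = trans (sym (dot-δ (act C w v) k)) (dot-act (δ k) w v)

  act-⊕ : ∀ w u v → act C w (u ⊕ v) ≡ act C w u ⊕ act C w v
  act-⊕ w u v = vec-ext λ k → trans (lookup-act w (u ⊕ v) k) (trans (dot-⊕ (δ k ◁* w) u v)
    (sym (trans (lookup-⊕ (act C w u) (act C w v) k) (cong₂ _+_ (lookup-act w u k) (lookup-act w v k)))))

  act-⊙ : ∀ w a v → act C w (a ⊙ v) ≡ a ⊙ act C w v
  act-⊙ w a v = vec-ext λ k → trans (lookup-act w (a ⊙ v) k) (trans (dot-⊙ (δ k ◁* w) a v)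
    (sym (trans (lookup-⊙ a (act C w v) k) (cong (a *_) (lookup-act w v k)))))

  pairing-e : ∀ i j → pairing C i (e j) ≡ C i j
  pairing-e i j = dot-e (C i) j

  sref-⊕ : ∀ i v → sref C i v ≡ v ⊕ (- pairing C i v) ⊙ e i
  sref-⊕ i v = vec-ext λ k → trans (lookup-sref i v k) (sym (trans (lookup-⊕ v ((- pairing C i v) ⊙ e i) k)
    (trans (cong (lookup v k +_) (trans (lookup-⊙ (- pairing C i v) (e i) k) (cong ((- pairing C i v) *_) (lookup-e i k))))
           (neg (lookup v k) (pairing C i v) (δ i k)))))
    where
    neg : ∀ x p d → x + (- p) * d ≡ x - p * d
    neg = solve-∀

  sref-fix : ∀ i v → pairing C i v ≡ 0ℤ → sref C i v ≡ v
  sref-fix i v p = vec-ext λ k → trans (lookup-sref i v k)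
    (trans (cong (λ t → lookup v k - t * δ i k) p) (+-identityʳ _))

  infix 4 _≋_
  -- Equality on the whole lattice, which by linearity is the same as equality on simple roots.
  -- Being a record it keeps the two words visible to unification, unlike the bare family of
  -- equations.
  record _≋_ (u w : Word r) : Set where
    constructor mk
    field at : ∀ v → act C u v ≡ act C w v
  open _≋_ public

  ≈⇒≋ : ∀ {u w} → _≈W_ C u w → u ≋ w
  ≈⇒≋ {u} {w} h = mk λ v → vec-ext λ k →
    trans (lookup-act u v k) (trans (dot-cong (λ j → begin
      (δ k ◁* u) j ≡⟨ sym (dot-e (δ k ◁* u) j) ⟩
      dot (δ k ◁* u) (e j) ≡⟨ sym (lookup-act u (e j) k) ⟩
      lookup (act C u (e j)) k ≡⟨ cong (λ t → lookup t k) (h j) ⟩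
      lookup (act C w (e j)) k ≡⟨ lookup-act w (e j) k ⟩
      dot (δ k ◁* w) (e j) ≡⟨ dot-e (δ k ◁* w) j ⟩
      (δ k ◁* w) j ∎) v) (sym (lookup-act w v k)))
    where open ≡-Reasoning

  ≋⇒≈ : ∀ {u w} → u ≋ w → _≈W_ C u w
  ≋⇒≈ h j = at h (e j)

  ≋-refl : ∀ {u} → u ≋ u
  ≋-refl = mk λ v → refl

  ≋-sym : ∀ {u w} → u ≋ w → w ≋ u
  ≋-sym h = mk λ v → sym (at h v)

  ≋-trans : ∀ {u w x} → u ≋ w → w ≋ x → u ≋ x
  ≋-trans h g = mk λ v → trans (at h v) (at g v)

  ≡⇒≋ : ∀ {u w} → u ≡ w → u ≋ w
  ≡⇒≋ refl = ≋-refl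

  act-++ : ∀ u w v → act C (u ++ w) v ≡ act C u (act C w v)
  act-++ []      w v = refl
  act-++ (i ∷ u) w v = cong (sref C i) (act-++ u w v)

  ++-cong : ∀ {u u′ w w′} → u ≋ u′ → w ≋ w′ → u ++ w ≋ u′ ++ w′
  ++-cong {u} {u′} {w} {w′} h g = mk λ v →
    trans (act-++ u w v) (trans (at h _) (trans (cong (act C u′) (at g v)) (sym (act-++ u′ w′ v))))

  module _ (diag : ∀ i → C i i ≡ pos 2) where

    private
      twice : ∀ x p d → (x - p * d) - (- p) * d ≡ x
      twice = solve-∀

    pairing-sref : ∀ i v → pairing C i (sref C i v) ≡ - pairing C i v
    pairing-sref i v = begin
      dot (C i) (sref C i v) ≡⟨ cong (dot (C i)) (sref-⊕ i v) ⟩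
      dot (C i) (v ⊕ (- pairing C i v) ⊙ e i) ≡⟨ dot-⊕ (C i) v ((- pairing C i v) ⊙ e i) ⟩
      pairing C i v + dot (C i) ((- pairing C i v) ⊙ e i) ≡⟨ cong (pairing C i v +_) (trans (dot-⊙ (C i) (- pairing C i v) (e i)) (cong ((- pairing C i v) *_) (trans (dot-e (C i) i) (diag i)))) ⟩
      pairing C i v + (- pairing C i v) * (pos 2) ≡⟨ fin (pairing C i v) ⟩
      - pairing C i v ∎
      where
      open ≡-Reasoning
      fin : ∀ p → p + (- p) * (pos 2) ≡ - p
      fin = solve-∀

    sref-involutive : ∀ i v → sref C i (sref C i v) ≡ v
    sref-involutive i v = vec-ext λ k → begin
      lookup (sref C i (sref C i v)) k ≡⟨ lookup-sref i (sref C i v) k ⟩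
      lookup (sref C i v) k - pairing C i (sref C i v) * δ i k ≡⟨ cong₂ (λ a b → a - b * δ i k) (lookup-sref i v k) (pairing-sref i v) ⟩
      (lookup v k - pairing C i v * δ i k) - (- pairing C i v) * δ i k ≡⟨ twice (lookup v k) (pairing C i v) (δ i k) ⟩
      lookup v k ∎
      where open ≡-Reasoning

    sref-e : ∀ i → sref C i (e i) ≡ -1ℤ ⊙ e i
    sref-e i = vec-ext λ k → begin
      lookup (sref C i (e i)) k ≡⟨ lookup-sref i (e i) k ⟩
      lookup (e i) k - pairing C i (e i) * δ i k ≡⟨ cong₂ (λ a b → a - b * δ i k) (lookup-e i k) (trans (pairing-e i i) (diag i)) ⟩
      δ i k - (pos 2) * δ i k ≡⟨ fin (δ i k) ⟩
      -1ℤ * δ i k ≡⟨ sym (trans (lookup-⊙ -1ℤ (e i) k) (cong (-1ℤ *_) (lookup-e i k))) ⟩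
      lookup (-1ℤ ⊙ e i) k ∎
      where
      open ≡-Reasoning
      fin : ∀ d → d - (pos 2) * d ≡ -1ℤ * d
      fin = solve-∀

    act-reverse : ∀ w v → act C (reverse w) (act C w v) ≡ v
    act-reverse []      v = refl
    act-reverse (i ∷ w) v = begin
      act C (reverse (i ∷ w)) (sref C i (act C w v)) ≡⟨ cong (λ t → act C t (sref C i (act C w v))) (unfold-reverse i w) ⟩
      act C (reverse w ++ i ∷ []) (sref C i (act C w v)) ≡⟨ act-++ (reverse w) (i ∷ []) _ ⟩
      act C (reverse w) (sref C i (sref C i (act C w v))) ≡⟨ cong (act C (reverse w)) (sref-involutive i _) ⟩
      act C (reverse w) (act C w v) ≡⟨ act-reverse w v ⟩
      v ∎
      where open ≡-Reasoning

    act-reverse′ : ∀ w v → act C w (act C (reverse w) v) ≡ v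
    act-reverse′ w v = trans (cong (λ t → act C t (act C (reverse w) v)) (sym (reverse-involutive w)))
                             (act-reverse (reverse w) v)

    reverse-cong : ∀ {u w} → u ≋ w → reverse u ≋ reverse w
    reverse-cong {u} {w} h = mk λ v → begin
      act C (reverse u) v ≡⟨ cong (act C (reverse u)) (sym (act-reverse′ w v)) ⟩
      act C (reverse u) (act C w (act C (reverse w) v)) ≡⟨ cong (act C (reverse u)) (sym (at h _)) ⟩
      act C (reverse u) (act C u (act C (reverse w) v)) ≡⟨ act-reverse u _ ⟩
      act C (reverse w) v ∎
      where open ≡-Reasoning

-- Every root is positive or negative

0≤*⇒ : ∀ {a b} → 0ℤ ≤ a → 0ℤ ≤ b → 0ℤ ≤ a * b
0≤*⇒ {a} {b} p q = ≤-trans (≤-reflexive (sym (*-zeroʳ a))) (*-monoˡ-≤-nonNeg a {{nonNegative p}} q)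

0≤+⇒ : ∀ {a b} → 0ℤ ≤ a → 0ℤ ≤ b → 0ℤ ≤ a + b
0≤+⇒ = +-mono-≤

0≤neg : ∀ {a} → a ≤ 0ℤ → 0ℤ ≤ - a
0≤neg = neg-mono-≤

neg≤0 : ∀ {a} → 0ℤ ≤ a → - a ≤ 0ℤ
neg≤0 = neg-mono-≤

0≤neg⁻ : ∀ {a} → 0ℤ ≤ - a → a ≤ 0ℤ
0≤neg⁻ {a} h = subst (_≤ 0ℤ) (neg-involutive a) (neg-mono-≤ h)

0≤2*⇒ : ∀ {a} → 0ℤ ≤ pos 2 * a → 0ℤ ≤ a
0≤2*⇒ {a} h = *-cancelˡ-≤-pos 0ℤ a (pos 2) h

Pos Neg : ∀ {r} → Vec ℤ r → Set
Pos v = ∀ k → 0ℤ ≤ lookup v k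
Neg v = ∀ k → lookup v k ≤ 0ℤ

Pos-comb : ∀ {r} {a b} {u v : Vec ℤ r} → 0ℤ ≤ a → 0ℤ ≤ b → Pos u → Pos v → Pos (a ⊙ u ⊕ b ⊙ v)
Pos-comb {a = a} {b} {u} {v} ha hb hu hv k =
  subst (0ℤ ≤_) (sym (trans (lookup-⊕ (a ⊙ u) (b ⊙ v) k) (cong₂ _+_ (lookup-⊙ a u k) (lookup-⊙ b v k))))
        (0≤+⇒ (0≤*⇒ ha (hu k)) (0≤*⇒ hb (hv k)))

Neg-comb : ∀ {r} {a b} {u v : Vec ℤ r} → a ≤ 0ℤ → b ≤ 0ℤ → Pos u → Pos v → Neg (a ⊙ u ⊕ b ⊙ v)
Neg-comb {a = a} {b} {u} {v} ha hb hu hv k =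
  subst (_≤ 0ℤ) (sym (trans (lookup-⊕ (a ⊙ u) (b ⊙ v) k) (cong₂ _+_ (lookup-⊙ a u k) (lookup-⊙ b v k))))
        (0≤neg⁻ (subst (0ℤ ≤_) (expand a (lookup u k) b (lookup v k))
          (0≤+⇒ (0≤*⇒ (0≤neg ha) (hu k)) (0≤*⇒ (0≤neg hb) (hv k)))))
  where
  expand : ∀ a x b y → (- a) * x + (- b) * y ≡ - (a * x + b * y)
  expand = solve-∀

neg-lookup : ∀ {r} (v : Vec ℤ r) k → lookup (-1ℤ ⊙ v) k ≡ - lookup v k
neg-lookup v k = trans (lookup-⊙ -1ℤ v k) (-1*i≡-i (lookup v k))

Neg-neg : ∀ {r} {v : Vec ℤ r} → Pos v → Neg (-1ℤ ⊙ v)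
Neg-neg {v = v} h k = subst (_≤ 0ℤ) (sym (neg-lookup v k)) (neg≤0 (h k))

Pos-neg : ∀ {r} {v : Vec ℤ r} → Neg v → Pos (-1ℤ ⊙ v)
Pos-neg {v = v} h k = subst (0ℤ ≤_) (sym (neg-lookup v k)) (0≤neg (h k))

-- The dihedral group generated by two simple reflections whose Cartan integers are c and d.
-- A word x in the two letters acts by v ↦ v + (A₁ p + A₂ q) αᵢ + (B₁ p + B₂ q) αⱼ, where p and q
-- are the pairings of v with the two simple coroots; lin x = (A₁ , A₂ , B₁ , B₂).
module RankTwo (c d : ℤ) where

  Lin : Set
  Lin = ℤ × ℤ × ℤ × ℤ

  step : Bool → Lin → Lin
  step true  (a₁ , a₂ , b₁ , b₂) = (-1ℤ - a₁ - c * b₁) , (0ℤ - a₂ - c * b₂) , b₁ , b₂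
  step false (a₁ , a₂ , b₁ , b₂) = a₁ , a₂ , (0ℤ - b₁ - d * a₁) , (-1ℤ - b₂ - d * a₂)

  lin : List Bool → Lin
  lin []      = 0ℤ , 0ℤ , 0ℤ , 0ℤ
  lin (b ∷ x) = step b (lin x)

  -- The coefficients of the image of αᵢ in the basis αᵢ, αⱼ: for v = αᵢ one has p = 2 and q = d.
  val₁ val₂ : Lin → ℤ
  val₁ (a₁ , a₂ , b₁ , b₂) = 1ℤ + pos 2 * a₁ + d * a₂
  val₂ (a₁ , a₂ , b₁ , b₂) = pos 2 * b₁ + d * b₂

  alt : Bool → ℕ → List Bool
  alt s zero    = []
  alt s (suc n) = s ∷ alt (not s) n

  private
    cancel : ∀ k x y → k - (k - x - y) - y ≡ x
    cancel = solve-∀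

  step-involutive : ∀ s l → step s (step s l) ≡ l
  step-involutive true (a₁ , a₂ , b₁ , b₂) =
    cong₂ (λ x y → x , y , b₁ , b₂) (cancel -1ℤ a₁ (c * b₁)) (cancel 0ℤ a₂ (c * b₂))
  step-involutive false (a₁ , a₂ , b₁ , b₂) =
    cong₂ (λ x y → a₁ , a₂ , x , y) (cancel 0ℤ b₁ (d * a₁)) (cancel -1ℤ b₂ (d * a₂))

  Braid : ℕ → Set
  Braid m = ∀ s → lin (alt s m) ≡ lin (alt (not s) m)

  -- The alternative in the hypothesis serves both kinds of dihedral group: a finite one has a braid
  -- relation of length m + 1, and in an infinite one m merely bounds the length of the given word.
  normal-form : ∀ m x → length x ℕ.≤ m ⊎ Braid (suc m) →
                ∃ λ s → ∃ λ n → n ℕ.≤ suc m × n ℕ.≤ length x × lin x ≡ lin (alt s n)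
  normal-form m []      h = true , 0 , z≤n , z≤n , refl
  normal-form m (b ∷ x) h with normal-form m x (Sum⊎.map₁ ℕₚ.<⇒≤ h)
  ... | s , zero  , n≤m , n≤x , eq = b , 1 , s≤s z≤n , s≤s z≤n , cong (step b) eq
  ... | s , suc n , n≤m , n≤x , eq with s Bool.≟ b
  ...   | yes refl = not s , n , ℕₚ.<⇒≤ n≤m , ℕₚ.m≤n⇒m≤1+n (ℕₚ.<⇒≤ n≤x)
                   , trans (cong (step s) eq) (step-involutive s (lin (alt (not s) n)))
  ...   | no  s≢b with n ℕ.<? m | h
  ...     | yes n<m | _ = b , suc (suc n) , s≤s n<m , s≤s n≤x
                    , trans (cong (step b) eq) (cong (λ t → step b (lin (alt t (suc n)))) (¬-not s≢b))
  ...     | no  n≮m | inj₁ l = contradiction (ℕₚ.≤-trans n≤x (ℕₚ.<⇒≤ l)) (λ le → n≮m le)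
  ...     | no  n≮m | inj₂ br rewrite ℕₚ.≤-antisym (ℕ.s≤s⁻¹ n≤m) (ℕₚ.≮⇒≥ n≮m) =
    not b , m , ℕₚ.n≤1+n m , ℕₚ.m≤n⇒m≤1+n (ℕₚ.<⇒≤ n≤x)
    , trans (cong (step b) (trans eq (trans (br s) (cong (λ t → lin (alt t (suc m))) not-s))))
            (step-involutive b (lin (alt (not b) m)))
    where
    not-s : not s ≡ b
    not-s = trans (cong not (¬-not s≢b)) (not-involutive b)

  -- The letter `true` stands for sᵢ. A word making αᵢ negative must come with an alternating word
  -- for x sᵢ that is shorter than x. In this form the statement is decidable, so the finite types
  -- are settled by evaluation.
  Good : List Bool → Set
  Good x = (0ℤ ≤ val₁ (lin x) × 0ℤ ≤ val₂ (lin x))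
         ⊎ (val₁ (lin x) ≤ 0ℤ × val₂ (lin x) ≤ 0ℤ
            × ∃ λ s → Σ (Fin (length x)) λ n → lin (alt s (toℕ n)) ≡ lin (x ++ true ∷ []))

  _≟Lin_ : (l l′ : Lin) → Dec (l ≡ l′)
  _≟Lin_ = Productₚ.≡-dec ℤ._≟_ (Productₚ.≡-dec ℤ._≟_ (Productₚ.≡-dec ℤ._≟_ ℤ._≟_))

  private
    any-Bool? : ∀ {P : Bool → Set} → (∀ b → Dec (P b)) → Dec (∃ P)
    any-Bool? P? with P? true | P? false
    ... | yes p | _     = yes (true , p)
    ... | no _  | yes p = yes (false , p)
    ... | no p  | no q  = no λ { (true , x) → p x ; (false , x) → q x }

  Good? : ∀ x → Dec (Good x)
  Good? x = ((0ℤ ≤? val₁ (lin x)) ×-dec (0ℤ ≤? val₂ (lin x)))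
      ⊎-dec ((val₁ (lin x) ≤? 0ℤ) ×-dec ((val₂ (lin x) ≤? 0ℤ)
             ×-dec any-Bool? λ s → any? λ n → lin (alt s (toℕ n)) ≟Lin lin (x ++ true ∷ [])))

  AllGood : ℕ → Set
  AllGood m = ∀ s n → n ℕ.≤ m → Good (alt s n)

  length-alt : ∀ s n → length (alt s n) ≡ n
  length-alt s zero    = refl
  length-alt s (suc n) = cong suc (length-alt (not s) n)

  -- The intermediate `x₀` is there because `lin` recurses from the left: an equality of `lin x` and
  -- `lin x₀` does not by itself allow a letter to be appended on the right. That is done later for
  -- the acting words.
  Conclusion : List Bool → Set
  Conclusion x = (0ℤ ≤ val₁ (lin x) × 0ℤ ≤ val₂ (lin x))
               ⊎ (val₁ (lin x) ≤ 0ℤ × val₂ (lin x) ≤ 0ℤ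
                  × ∃ λ x₀ → ∃ λ x′ → lin x ≡ lin x₀ × length x′ ℕ.< length x × lin x′ ≡ lin (x₀ ++ true ∷ []))

  Checked : ℕ → Set
  Checked m = (∀ (n : Fin (suc (suc m))) → Good (alt true (toℕ n)))
            × (∀ (n : Fin (suc (suc m))) → Good (alt false (toℕ n))) × lin (alt true (suc m)) ≡ lin (alt false (suc m))

  Checked? : ∀ m → Dec (Checked m)
  Checked? m = all? (λ n → Good? (alt true (toℕ n))) ×-dec (all? (λ n → Good? (alt false (toℕ n)))
               ×-dec (lin (alt true (suc m)) ≟Lin lin (alt false (suc m))))

  module Infinite (c≤0 : c ≤ 0ℤ) (d≤0 : d ≤ 0ℤ) (4≤cd : 0ℤ ≤ c * d - pos 4) where

    -- In the use for `true`, the third condition says that aαᵢ + bαⱼ pairs nonnegatively with the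
    -- coroot of αᵢ. With the roles exchanged it is the condition for αⱼ.
    Bounded : ℤ → ℤ → ℤ → Set
    Bounded c a b = 0ℤ ≤ a × 0ℤ ≤ b × 0ℤ ≤ pos 2 * a + c * b

    -- The letter s has just been applied, so that the coefficient of its simple root dominates.
    Inv : Bool → ℤ → ℤ → Set
    Inv true  a b = Bounded c a b
    Inv false a b = Bounded d b a

    -- Here cd ≥ 4 decides: the new pairing is -2a - cb, and twice it equals -c(2b + da) + (cd -
    -- 4)a, a sum of nonnegative terms.
    bounded-step : ∀ c d {a b} → c ≤ 0ℤ → 0ℤ ≤ c * d - pos 4 → Bounded d b a → Bounded c (- a - c * b) b
    bounded-step c d {a} {b} c≤0 4≤cd (q , p , h) = subst (0ℤ ≤_) (small a b c) (0≤+⇒ g p) , q , g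
      where
      key : ∀ a b c d → - c * (pos 2 * b + d * a) + (c * d - pos 4) * a ≡ pos 2 * (pos 2 * (- a - c * b) + c * b)
      key = solve-∀
      small : ∀ a b c → pos 2 * (- a - c * b) + c * b + a ≡ - a - c * b
      small = solve-∀
      g : 0ℤ ≤ pos 2 * (- a - c * b) + c * b
      g = 0≤2*⇒ (subst (0ℤ ≤_) (key a b c d) (0≤+⇒ (0≤*⇒ (0≤neg c≤0) h) (0≤*⇒ 4≤cd p)))

    Inv-true : ∀ {a b} → Inv false a b → Inv true (- a - c * b) b
    Inv-true = bounded-step c d c≤0 4≤cd

    Inv-false : ∀ {a b} → Inv true a b → Inv false a (- b - d * a)
    Inv-false = bounded-step d c d≤0 (subst (λ t → 0ℤ ≤ t - pos 4) (*-comm c d) 4≤cd)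

    private
      val-true₁ : ∀ a₁ a₂ b₁ b₂ c d → 1ℤ + pos 2 * (-1ℤ - a₁ - c * b₁) + d * (0ℤ - a₂ - c * b₂)
                ≡ - (1ℤ + pos 2 * a₁ + d * a₂) - c * (pos 2 * b₁ + d * b₂)
      val-true₁ = solve-∀
      val-false₂ : ∀ a₁ a₂ b₁ b₂ c d → pos 2 * (0ℤ - b₁ - d * a₁) + d * (-1ℤ - b₂ - d * a₂)
                 ≡ - (pos 2 * b₁ + d * b₂) - d * (1ℤ + pos 2 * a₁ + d * a₂)
      val-false₂ = solve-∀
      neg-true : ∀ a b c → - (- a - c * b) ≡ - (- a) - c * (- b)
      neg-true = solve-∀

    -- The alternatives are those of words ending in the letter of αⱼ and in the letter of αᵢ. In
    -- the latter case multiplication by sᵢ cancels the last letter, leaving the shorter word.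
    Claim : Bool → ℕ → Set
    Claim s n = Inv s (val₁ l) (val₂ l)
              ⊎ (Inv s (- val₁ l) (- val₂ l) × lin (alt (not (not s)) n) ≡ lin (alt s (suc n) ++ true ∷ []))
      where l = lin (alt s (suc n))

    Inv-step : ∀ s l → Inv (not s) (val₁ l) (val₂ l) → Inv s (val₁ (step s l)) (val₂ (step s l))
    Inv-step true (a₁ , a₂ , b₁ , b₂) h =
      subst (λ t → Inv true t (val₂ (a₁ , a₂ , b₁ , b₂))) (sym (val-true₁ a₁ a₂ b₁ b₂ c d)) (Inv-true h)
    Inv-step false (a₁ , a₂ , b₁ , b₂) h =
      subst (λ t → Inv false (val₁ (a₁ , a₂ , b₁ , b₂)) t) (sym (val-false₂ a₁ a₂ b₁ b₂ c d)) (Inv-false h)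

    Inv-step-neg : ∀ s l → Inv (not s) (- val₁ l) (- val₂ l) → Inv s (- val₁ (step s l)) (- val₂ (step s l))
    Inv-step-neg true (a₁ , a₂ , b₁ , b₂) h =
      subst (λ t → Inv true t (- val₂ (a₁ , a₂ , b₁ , b₂)))
            (sym (trans (cong -_ (val-true₁ a₁ a₂ b₁ b₂ c d)) (neg-true (val₁ (a₁ , a₂ , b₁ , b₂)) (val₂ (a₁ , a₂ , b₁ , b₂)) c)))
            (Inv-true h)
    Inv-step-neg false (a₁ , a₂ , b₁ , b₂) h =
      subst (λ t → Inv false (- val₁ (a₁ , a₂ , b₁ , b₂)) t)
            (sym (trans (cong -_ (val-false₂ a₁ a₂ b₁ b₂ c d)) (neg-true (val₂ (a₁ , a₂ , b₁ , b₂)) (val₁ (a₁ , a₂ , b₁ , b₂)) d)))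
            (Inv-false h)

    claim : ∀ s n → Claim s n
    claim true zero = inj₂ ((start₁ , start₂ , start₃) , sym (step-involutive true (lin [])))
      where
      e₁ : ∀ c d → 1ℤ ≡ - (1ℤ + pos 2 * (-1ℤ - 0ℤ - c * 0ℤ) + d * (0ℤ - 0ℤ - c * 0ℤ))
      e₁ = solve-∀
      e₂ : ∀ d → 0ℤ ≡ - (pos 2 * 0ℤ + d * 0ℤ)
      e₂ = solve-∀
      e₃ : ∀ c d → pos 2 ≡ pos 2 * - (1ℤ + pos 2 * (-1ℤ - 0ℤ - c * 0ℤ) + d * (0ℤ - 0ℤ - c * 0ℤ)) + c * - (pos 2 * 0ℤ + d * 0ℤ)
      e₃ = solve-∀
      start₁ = subst (0ℤ ≤_) (e₁ c d) (ℤ.+≤+ z≤n)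
      start₂ = subst (0ℤ ≤_) (e₂ d) (ℤ.+≤+ z≤n)
      start₃ = subst (0ℤ ≤_) (e₃ c d) (ℤ.+≤+ z≤n)
    claim false zero = inj₁ (start₂ , start₁ , start₃)
      where
      e₁ : ∀ d → 1ℤ ≡ 1ℤ + pos 2 * 0ℤ + d * 0ℤ
      e₁ = solve-∀
      e₂ : ∀ d → - d ≡ pos 2 * (0ℤ - 0ℤ - d * 0ℤ) + d * (-1ℤ - 0ℤ - d * 0ℤ)
      e₂ = solve-∀
      e₃ : ∀ d → - d ≡ pos 2 * (pos 2 * (0ℤ - 0ℤ - d * 0ℤ) + d * (-1ℤ - 0ℤ - d * 0ℤ)) + d * (1ℤ + pos 2 * 0ℤ + d * 0ℤ)
      e₃ = solve-∀
      start₁ = subst (0ℤ ≤_) (e₁ d) (ℤ.+≤+ z≤n)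
      start₂ = subst (0ℤ ≤_) (e₂ d) (0≤neg d≤0)
      start₃ = subst (0ℤ ≤_) (e₃ d) (0≤neg d≤0)
    claim s (suc n) with claim (not s) n
    ... | inj₁ h = inj₁ (Inv-step s (lin (alt (not s) (suc n))) h)
    ... | inj₂ (h , eq) = inj₂ (Inv-step-neg s (lin (alt (not s) (suc n))) h
                               , trans (cong (λ t → lin (alt t (suc n))) (not-involutive s))
                                       (cong (step s) (trans (cong (λ t → lin (alt t n)) (sym (not-involutive (not s)))) eq)))

    Inv⇒nonneg : ∀ s {a b} → Inv s a b → 0ℤ ≤ a × 0ℤ ≤ b
    Inv⇒nonneg true  (p , q , _) = p , q
    Inv⇒nonneg false (p , q , _) = q , p

    good : ∀ s n → Good (alt s n)
    good s zero = inj₁ (subst (0ℤ ≤_) (e₁ d) (ℤ.+≤+ z≤n) , subst (0ℤ ≤_) (e₂ d) (ℤ.+≤+ z≤n))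
      where
      e₁ : ∀ d → 1ℤ ≡ 1ℤ + pos 2 * 0ℤ + d * 0ℤ
      e₁ = solve-∀
      e₂ : ∀ d → 0ℤ ≡ pos 2 * 0ℤ + d * 0ℤ
      e₂ = solve-∀
    good s (suc n) with claim s n
    ... | inj₁ h = inj₁ (Inv⇒nonneg s h)
    ... | inj₂ (h , eq) = inj₂ (0≤neg⁻ (proj₁ (Inv⇒nonneg s h)) , 0≤neg⁻ (proj₂ (Inv⇒nonneg s h))
                               , not (not s) , fromℕ< n<
                               , trans (cong (λ t → lin (alt (not (not s)) t)) (toℕ-fromℕ< n<)) eq)
      where
      n< : n ℕ.< length (alt s (suc n))
      n< = s≤s (ℕₚ.≤-reflexive (sym (length-alt (not s) n)))

  conclude : ∀ m x → length x ℕ.≤ m ⊎ Braid (suc m) → AllGood (suc m) → Conclusion x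
  conclude m x h good with normal-form m x h
  ... | s , n , n≤m , n≤x , eq with good s n n≤m
  ...   | inj₁ p = inj₁ (subst (λ l → 0ℤ ≤ val₁ l × 0ℤ ≤ val₂ l) (sym eq) p)
  ...   | inj₂ (p , q , s′ , k , eq′) =
    inj₂ (subst (λ l → val₁ l ≤ 0ℤ) (sym eq) p , subst (λ l → val₂ l ≤ 0ℤ) (sym eq) q , alt s n , alt s′ (toℕ k) , eq
         , subst (ℕ._< length x) (sym (length-alt s′ (toℕ k)))
                 (ℕₚ.<-≤-trans (toℕ<n k) (subst (ℕ._≤ length x) (sym (length-alt s n)) n≤x))
         , eq′)

  checked⇒good : ∀ m → Checked m → AllGood (suc m) × Braid (suc m)
  checked⇒good m (t , f , br) = good , λ { true → br ; false → sym br }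
    where
    good : AllGood (suc m)
    good true  n l = subst (λ k → Good (alt true k)) (toℕ-fromℕ< (s≤s l)) (t (fromℕ< (s≤s l)))
    good false n l = subst (λ k → Good (alt false k)) (toℕ-fromℕ< (s≤s l)) (f (fromℕ< (s≤s l)))

conclusion : ∀ c d → c ≤ 0ℤ → d ≤ 0ℤ → (c ≡ 0ℤ → d ≡ 0ℤ) → (d ≡ 0ℤ → c ≡ 0ℤ) → ∀ x → RankTwo.Conclusion c d x
conclusion c d c≤0 d≤0 cd dc x = cases c d c≤0 d≤0 cd dc
  where
  finite : ∀ c d m → RankTwo.Checked c d m → RankTwo.Conclusion c d x
  finite c d m ch = RankTwo.conclude c d m x (inj₂ (proj₂ g)) (proj₁ g)
    where g = RankTwo.checked⇒good c d m ch
  infinite : ∀ c d → c ≤ 0ℤ → d ≤ 0ℤ → 0ℤ ≤ c * d - pos 4 → RankTwo.Conclusion c d x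
  infinite c d p q h = RankTwo.conclude c d (length x) x (inj₁ ℕₚ.≤-refl) λ s n _ → RankTwo.Infinite.good c d p q h s n
  4≤ : ∀ {n} → 4 ℕ.≤ n → 0ℤ ≤ pos n - pos 4
  4≤ l = i≤j⇒0≤j-i (ℤ.+≤+ l)
  cases : ∀ c d → c ≤ 0ℤ → d ≤ 0ℤ → (c ≡ 0ℤ → d ≡ 0ℤ) → (d ≡ 0ℤ → c ≡ 0ℤ) → RankTwo.Conclusion c d x
  -- Types A₁ × A₁, A₂, B₂ and G₂ have braid relations of length 2, 3, 4 and 6, one more than the
  -- numeral passed to `finite`. All remaining pairs of Cartan integers have product at least 4.
  cases (pos zero) d p q cd dc with cd refl
  ... | refl = finite 0ℤ 0ℤ 1 (from-yes (RankTwo.Checked? 0ℤ 0ℤ 1))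
  cases (pos (suc _)) d (ℤ.+≤+ ()) q cd dc
  cases -[1+ _ ] (pos zero) p q cd dc = contradiction (dc refl) λ ()
  cases -[1+ _ ] (pos (suc _)) p (ℤ.+≤+ ()) cd dc
  cases -[1+ 0 ] -[1+ 0 ] p q _ _ = finite -[1+ 0 ] -[1+ 0 ] 2 (from-yes (RankTwo.Checked? -[1+ 0 ] -[1+ 0 ] 2))
  cases -[1+ 0 ] -[1+ 1 ] p q _ _ = finite -[1+ 0 ] -[1+ 1 ] 3 (from-yes (RankTwo.Checked? -[1+ 0 ] -[1+ 1 ] 3))
  cases -[1+ 0 ] -[1+ 2 ] p q _ _ = finite -[1+ 0 ] -[1+ 2 ] 5 (from-yes (RankTwo.Checked? -[1+ 0 ] -[1+ 2 ] 5))
  cases -[1+ 1 ] -[1+ 0 ] p q _ _ = finite -[1+ 1 ] -[1+ 0 ] 3 (from-yes (RankTwo.Checked? -[1+ 1 ] -[1+ 0 ] 3))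
  cases -[1+ 2 ] -[1+ 0 ] p q _ _ = finite -[1+ 2 ] -[1+ 0 ] 5 (from-yes (RankTwo.Checked? -[1+ 2 ] -[1+ 0 ] 5))
  cases -[1+ 0 ] -[1+ suc (suc (suc b)) ] p q _ _ =
    infinite -[1+ 0 ] -[1+ suc (suc (suc b)) ] p q (4≤ {1 ℕ.* (4 ℕ.+ b)} (ℕₚ.m≤m+n 4 (b ℕ.+ 0)))
  cases -[1+ suc (suc (suc a)) ] -[1+ 0 ] p q _ _ =
    infinite -[1+ suc (suc (suc a)) ] -[1+ 0 ] p q (4≤ (ℕₚ.*-mono-≤ {4} {4 ℕ.+ a} {1} {1} (ℕₚ.m≤m+n 4 a) ℕₚ.≤-refl))
  cases -[1+ suc a ] -[1+ suc b ] p q _ _ =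
    infinite -[1+ suc a ] -[1+ suc b ] p q (4≤ (ℕₚ.*-mono-≤ {2} {2 ℕ.+ a} {2} {2 ℕ.+ b} (ℕₚ.m≤m+n 2 a) (ℕₚ.m≤m+n 2 b)))

module Dichotomy {r : ℕ} (C : Cartan r) (cm : IsCartanMatrix C) where

  open Action C

  diag : ∀ i → C i i ≡ pos 2
  diag = proj₁ cm

  private
    offdiag : ∀ {i j} → i ≢ j → C i j ≤ 0ℤ
    offdiag = proj₁ (proj₂ cm) _ _

  act-neg : ∀ w i → act C (w ++ i ∷ []) (e i) ≡ -1ℤ ⊙ act C w (e i)
  act-neg w i = trans (act-++ w (i ∷ []) (e i)) (trans (cong (act C w) (sref-e diag i)) (act-⊙ w -1ℤ (e i)))

  ++-cancel : ∀ w i → (w ++ i ∷ []) ++ i ∷ [] ≋ w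
  ++-cancel w i = mk λ v → trans (act-++ (w ++ i ∷ []) (i ∷ []) v)
    (trans (act-++ w (i ∷ []) (sref C i v)) (cong (act C w) (sref-involutive diag i v)))

  module Pair (i j : Fin r) (i≢j : i ≢ j) where

    c d : ℤ
    c = C i j
    d = C j i

    open RankTwo c d

    letter : Bool → Fin r
    letter true  = i
    letter false = j

    word : List Bool → Word r
    word = map letter

    displaced : Lin → Vec ℤ r → Fin r → ℤ
    displaced (a₁ , a₂ , b₁ , b₂) v k =
      lookup v k + (a₁ * pairing C i v + a₂ * pairing C j v) * δ i k + (b₁ * pairing C i v + b₂ * pairing C j v) * δ j k

    private
      start : ∀ x p q y z → x ≡ x + (0ℤ * p + 0ℤ * q) * y + (0ℤ * p + 0ℤ * q) * z
      start = solve-∀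
      reflect-i : ∀ x a₁ a₂ b₁ b₂ p q y z c →
        (x + (a₁ * p + a₂ * q) * y + (b₁ * p + b₂ * q) * z) - (p + (a₁ * p + a₂ * q) * pos 2 + (b₁ * p + b₂ * q) * c) * y
        ≡ x + ((-1ℤ - a₁ - c * b₁) * p + (0ℤ - a₂ - c * b₂) * q) * y + (b₁ * p + b₂ * q) * z
      reflect-i = solve-∀
      reflect-j : ∀ x a₁ a₂ b₁ b₂ p q y z d →
        (x + (a₁ * p + a₂ * q) * y + (b₁ * p + b₂ * q) * z) - (q + (a₁ * p + a₂ * q) * d + (b₁ * p + b₂ * q) * pos 2) * z
        ≡ x + (a₁ * p + a₂ * q) * y + ((0ℤ - b₁ - d * a₁) * p + (-1ℤ - b₂ - d * a₂) * q) * z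
      reflect-j = solve-∀
      regroup : ∀ f v a y b z → f * (v + a * y + b * z) ≡ f * v + (a * (f * y) + b * (f * z))
      regroup = solve-∀

    dot-displaced : ∀ f v l (u : Vec ℤ r) → (∀ k → lookup u k ≡ displaced l v k) →
      let (a₁ , a₂ , b₁ , b₂) = l in
      dot f u ≡ dot f v + ((a₁ * pairing C i v + a₂ * pairing C j v) * f i + (b₁ * pairing C i v + b₂ * pairing C j v) * f j)
    dot-displaced f v (a₁ , a₂ , b₁ , b₂) u h =
      trans (∑-cong (λ k → trans (cong (f k *_) (h k)) (regroup (f k) (lookup v k) A (δ i k) B (δ j k))))
      (trans (∑-+ (λ k → f k * lookup v k) (λ k → A * (f k * δ i k) + B * (f k * δ j k)))
        (cong (λ t → dot f v + t)
          (trans (∑-lin A B (λ k → f k * δ i k) (λ k → f k * δ j k)) (cong₂ (λ s t → A * s + B * t) (∑-δ f i) (∑-δ f j)))))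
      where
      A B : ℤ
      A = a₁ * pairing C i v + a₂ * pairing C j v
      B = b₁ * pairing C i v + b₂ * pairing C j v

    private
      assoc+ : ∀ x y z → x + (y + z) ≡ x + y + z
      assoc+ = solve-∀

    act-lin : ∀ x v k → lookup (act C (word x) v) k ≡ displaced (lin x) v k
    act-lin []          v k = start (lookup v k) (pairing C i v) (pairing C j v) (δ i k) (δ j k)
    act-lin (true ∷ x)  v k with lin x | act-lin x v
    ... | (a₁ , a₂ , b₁ , b₂) | ih = trans (lookup-sref i (act C (word x) v) k)
      (trans (cong₂ (λ s t → s - t * δ i k) (ih k)
               (trans (dot-displaced (C i) v (a₁ , a₂ , b₁ , b₂) (act C (word x) v) ih)
                      (trans (cong (λ t → pairing C i v + (A * t + B * c)) (diag i)) (assoc+ (pairing C i v) (A * pos 2) (B * c)))))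
             (reflect-i (lookup v k) a₁ a₂ b₁ b₂ (pairing C i v) (pairing C j v) (δ i k) (δ j k) c))
      where
      A B : ℤ
      A = a₁ * pairing C i v + a₂ * pairing C j v
      B = b₁ * pairing C i v + b₂ * pairing C j v
    act-lin (false ∷ x) v k with lin x | act-lin x v
    ... | (a₁ , a₂ , b₁ , b₂) | ih = trans (lookup-sref j (act C (word x) v) k)
      (trans (cong₂ (λ s t → s - t * δ j k) (ih k)
               (trans (dot-displaced (C j) v (a₁ , a₂ , b₁ , b₂) (act C (word x) v) ih)
                      (trans (cong (λ t → pairing C j v + (A * d + B * t)) (diag j)) (assoc+ (pairing C j v) (A * d) (B * pos 2)))))
             (reflect-j (lookup v k) a₁ a₂ b₁ b₂ (pairing C i v) (pairing C j v) (δ i k) (δ j k) d))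
      where
      A B : ℤ
      A = a₁ * pairing C i v + a₂ * pairing C j v
      B = b₁ * pairing C i v + b₂ * pairing C j v

    lin⇒≋ : ∀ {x y} → lin x ≡ lin y → word x ≋ word y
    lin⇒≋ {x} {y} h = mk λ v → vec-ext λ k →
      trans (act-lin x v k) (trans (cong (λ l → displaced l v k) h) (sym (act-lin y v k)))

    act-e : ∀ x → act C (word x) (e i) ≡ val₁ (lin x) ⊙ e i ⊕ val₂ (lin x) ⊙ e j
    act-e x = vec-ext λ k → trans (act-lin x (e i) k) (trans (eval (lin x) k)
      (sym (trans (lookup-⊕ (val₁ (lin x) ⊙ e i) (val₂ (lin x) ⊙ e j) k)
                  (cong₂ _+_ (trans (lookup-⊙ (val₁ (lin x)) (e i) k) (cong (val₁ (lin x) *_) (lookup-e i k)))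
                             (trans (lookup-⊙ (val₂ (lin x)) (e j) k) (cong (val₂ (lin x) *_) (lookup-e j k)))))))
      where
      evaluate : ∀ a₁ a₂ b₁ b₂ d y z → y + (a₁ * pos 2 + a₂ * d) * y + (b₁ * pos 2 + b₂ * d) * z
               ≡ (1ℤ + pos 2 * a₁ + d * a₂) * y + (pos 2 * b₁ + d * b₂) * z
      evaluate = solve-∀
      eval : ∀ l k → displaced l (e i) k ≡ val₁ l * δ i k + val₂ l * δ j k
      eval (a₁ , a₂ , b₁ , b₂) k rewrite pairing-e i i | pairing-e j i | diag i | lookup-e i k =
        evaluate a₁ a₂ b₁ b₂ d (δ i k) (δ j k)

    rank-two : ∀ x → RankTwo.Conclusion c d x
    rank-two = conclusion c d (offdiag i≢j) (offdiag (λ e → i≢j (sym e))) (proj₂ (proj₂ cm) i j) (proj₂ (proj₂ cm) j i)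

  -- Words need not be reduced. In place of a drop in Coxeter length, the negative case supplies a
  -- word for w sᵢ shorter than the given w, and this shortening drives the descent.
  Dichotomous : Word r → Fin r → Set
  Dichotomous w i = Pos (act C w (e i))
                  ⊎ (Neg (act C w (e i)) × ∃ λ w′ → length w′ ℕ.< length w × w′ ≋ w ++ i ∷ [])

  -- Deodhar's argument: w factors as v x with x in a rank-two parabolic subgroup and
  -- v sending both of its simple roots to positive roots.
  dichotomous : ∀ N w → length w ℕ.≤ N → ∀ i → Dichotomous w i
  dichotomous N w l i with initLast w
  ... | [] = inj₁ λ k → subst (0ℤ ≤_) (sym (lookup-e i k)) (δ≥0 i k)
    where
    δ≥0 : ∀ i k → 0ℤ ≤ δ i k
    δ≥0 i k with k ≟F i
    ... | yes _ = ℤ.+≤+ z≤n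
    ... | no  _ = ≤-refl
  dichotomous zero .(u ∷ʳ j) l i | u ∷ʳ′ j = contradiction (subst (ℕ._≤ 0) (trans (length-++ u) (ℕₚ.+-comm (length u) 1)) l) λ ()
  dichotomous (suc N) .(u ∷ʳ j) l i | u ∷ʳ′ j with i ≟F j
  ... | yes refl = last (dichotomous N u |u|≤N i)
    where
    |w| : length (u ∷ʳ i) ≡ suc (length u)
    |w| = trans (length-++ u) (ℕₚ.+-comm (length u) 1)
    |u|≤N : length u ℕ.≤ N
    |u|≤N = ℕ.s≤s⁻¹ (subst (ℕ._≤ suc N) |w| l)
    last : Dichotomous u i → Dichotomous (u ∷ʳ i) i
    last (inj₁ p) = inj₂ (subst Neg (sym (act-neg u i)) (Neg-neg {v = act C u (e i)} p) , u , ℕₚ.≤-reflexive (sym |w|) , ≋-sym (++-cancel u i))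
    last (inj₂ (q , _)) = inj₁ (subst Pos (sym (act-neg u i)) (Pos-neg {v = act C u (e i)} q))
  ... | no i≢j = descend N u (false ∷ []) |u|≤N (ℕₚ.≤-reflexive (sym |w|)) (ℕₚ.≤-reflexive (sym (length-++ u))) ≋-refl
    where
    open Pair i j i≢j
    |w| : length (u ∷ʳ j) ≡ suc (length u)
    |w| = trans (length-++ u) (ℕₚ.+-comm (length u) 1)
    |u|≤N : length u ℕ.≤ N
    |u|≤N = ℕ.s≤s⁻¹ (subst (ℕ._≤ suc N) |w| l)
    W : ℕ
    W = length (u ∷ʳ j)
    shift : ∀ v v′ b x → v′ ≋ v ++ letter b ∷ [] → u ∷ʳ j ≋ v ++ word x → u ∷ʳ j ≋ v′ ++ word (b ∷ x)
    shift v v′ b x h g = ≋-trans g (≋-sym (≋-trans (++-cong h (≋-refl {word (b ∷ x)}))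
      (≋-trans (≡⇒≋ (++-assoc v (letter b ∷ []) (word (b ∷ x))))
               (++-cong (≋-refl {v}) (mk λ y → sref-involutive diag (letter b) (act C (word x) y))))))
    bound : ∀ {v v′ : Word r} {x : List Bool} b → length v′ ℕ.< length v → length v ℕ.+ length x ℕ.≤ W →
            length v′ ℕ.+ length (b ∷ x) ℕ.≤ W
    bound {v} {v′} {x} b s t = ℕₚ.≤-trans (ℕₚ.≤-reflexive (ℕₚ.+-suc (length v′) (length x)))
                                 (ℕₚ.≤-trans (ℕₚ.+-monoˡ-≤ (length x) s) t)
    -- While v makes αᵢ or αⱼ negative, a letter moves from v to x. The bound |v| < W keeps
    -- `dichotomous N` applicable to v, M counts down with |v|, and |v| + |x| ≤ W makes the word
    -- produced at the end shorter than the original.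
    descend : ∀ M v x → length v ℕ.≤ M → length v ℕ.< W → length v ℕ.+ length x ℕ.≤ W → u ∷ʳ j ≋ v ++ word x →
              Dichotomous (u ∷ʳ j) i
    go : ∀ M v x → length v ℕ.≤ M → length v ℕ.< W → length v ℕ.+ length x ℕ.≤ W → u ∷ʳ j ≋ v ++ word x →
         Dichotomous v i → Dichotomous v j → Dichotomous (u ∷ʳ j) i
    descend M v x lM lv lx g = go M v x lM lv lx g (dichotomous N v v≤N i) (dichotomous N v v≤N j)
      where
      v≤N : length v ℕ.≤ N
      v≤N = ℕ.s≤s⁻¹ (ℕₚ.≤-trans lv l)
    go zero    v x lM lv lx g (inj₂ (_ , v′ , s , _)) _ = contradiction (ℕₚ.≤-trans s lM) λ ()
    go (suc M) v x lM lv lx g (inj₂ (_ , v′ , s , h)) _ =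
      descend M v′ (true ∷ x) (ℕ.s≤s⁻¹ (ℕₚ.≤-trans s lM)) (ℕₚ.<-trans s lv) (bound {v} {v′} {x} true s lx) (shift v v′ true x h g)
    go zero    v x lM lv lx g (inj₁ _) (inj₂ (_ , v′ , s , _)) = contradiction (ℕₚ.≤-trans s lM) λ ()
    go (suc M) v x lM lv lx g (inj₁ _) (inj₂ (_ , v′ , s , h)) =
      descend M v′ (false ∷ x) (ℕ.s≤s⁻¹ (ℕₚ.≤-trans s lM)) (ℕₚ.<-trans s lv) (bound {v} {v′} {x} false s lx) (shift v v′ false x h g)
    go M v x lM lv lx g (inj₁ p) (inj₁ q) = finish (rank-two x)
      where
      image : act C (u ∷ʳ j) (e i) ≡ RankTwo.val₁ c d (RankTwo.lin c d x) ⊙ act C v (e i) ⊕ RankTwo.val₂ c d (RankTwo.lin c d x) ⊙ act C v (e j)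
      image = trans (at g (e i)) (trans (act-++ v (word x) (e i)) (trans (cong (act C v) (act-e x))
        (trans (act-⊕ v (val₁ (lin x) ⊙ e i) (val₂ (lin x) ⊙ e j))
               (cong₂ _⊕_ (act-⊙ v (val₁ (lin x)) (e i)) (act-⊙ v (val₂ (lin x)) (e j))))))
        where open RankTwo c d
      finish : RankTwo.Conclusion c d x → Dichotomous (u ∷ʳ j) i
      finish (inj₁ (a , b)) = inj₁ (subst Pos (sym image) (Pos-comb {u = act C v (e i)} {act C v (e j)} a b p q))
      finish (inj₂ (a , b , x₀ , x′ , eq , s , eq′)) =
        inj₂ (subst Neg (sym image) (Neg-comb {u = act C v (e i)} {act C v (e j)} a b p q) , v ++ word x′ , short , ≋-sym same)
        where
        short : length (v ++ word x′) ℕ.< W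
        short = ℕₚ.<-≤-trans (subst (ℕ._< length v ℕ.+ length x)
                  (sym (trans (length-++ v) (cong (length v ℕ.+_) (length-map letter x′)))) (ℕₚ.+-monoʳ-< (length v) s)) lx
        same : (u ∷ʳ j) ++ i ∷ [] ≋ v ++ word x′
        same = ≋-trans (++-cong g (≋-refl {i ∷ []}))
          (≋-trans (++-cong (++-cong (≋-refl {v}) (lin⇒≋ {x} {x₀} eq)) (≋-refl {i ∷ []}))
          (≋-trans (≡⇒≋ (trans (++-assoc v (word x₀) (i ∷ [])) (cong (v ++_) (sym (map-++ letter x₀ (true ∷ []))))))
                   (++-cong (≋-refl {v}) (≋-sym (lin⇒≋ {x′} {x₀ ++ true ∷ []} eq′)))))

  root-sign : ∀ {v} → IsRoot C v → Pos v ⊎ Neg v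
  root-sign (w , i , refl) with dichotomous (length w) w ℕₚ.≤-refl i
  ... | inj₁ p = inj₁ p
  ... | inj₂ (q , _) = inj₂ q

-- The invariant form

∑-permute : ∀ {n} (f : Fin n → ℤ) (π : Fin n → Fin n) → (∀ p → π (π p) ≡ p) → ∑ (λ p → f (π p)) ≡ ∑ f
∑-permute {n} f π inv = trans (∑≡sum (λ p → f (π p))) (trans (sym (Sum.sum-permute f (Perm.permutation π π inv inv))) (sym (∑≡sum f)))
  where
  ∑≡sum : ∀ {n} (f : Fin n → ℤ) → ∑ f ≡ Sum.sum f
  ∑≡sum {zero}  f = refl
  ∑≡sum {suc n} f = cong (λ t → f zero + t) (∑≡sum (λ k → f (suc k)))

0<⇒≢0 : ∀ {a} → 0ℤ < a → a ≢ 0ℤ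
0<⇒≢0 h refl = <-irrefl refl h

*-cancel-pos : ∀ {d a b} → 0ℤ < d → d * a ≡ d * b → a ≡ b
*-cancel-pos {d} {a} {b} h eq = *-cancelˡ-≡ d a b {{ℤ.≢-nonZero (0<⇒≢0 h)}} eq

*-zero-pos : ∀ {d a} → 0ℤ < d → d * a ≡ 0ℤ → a ≡ 0ℤ
*-zero-pos {d} h eq = *-cancel-pos h (trans eq (sym (*-zeroʳ d)))

square-nonneg : ∀ a → 0ℤ ≤ a * a
square-nonneg (pos n)    = subst (0ℤ ≤_) (pos-* n n) (ℤ.+≤+ z≤n)
square-nonneg -[1+ n ]   = ℤ.+≤+ z≤n

square-zero : ∀ a → a * a ≡ 0ℤ → a ≡ 0ℤ
square-zero a h = [ (λ x → x) , (λ x → x) ]′ (i*j≡0⇒i≡0∨j≡0 a h)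

0<*⇒ : ∀ {a b} → 0ℤ < a → 0ℤ < b → 0ℤ < a * b
0<*⇒ {a} {b} p q = ≤∧≢⇒< (0≤*⇒ (<⇒≤ p) (<⇒≤ q)) λ e → 0<⇒≢0 q (*-zero-pos p (sym e))

-- Clears the denominators `norm i`, so that the argument for `positive-pairing` stays over the
-- integers.
common-multiple : ∀ {r} (d : Fin r → ℤ) → (∀ i → 0ℤ < d i) →
                  ∃ λ Δ → 0ℤ < Δ × Σ (Fin r → ℤ) λ E → (∀ i → 0ℤ < E i) × (∀ i → E i * d i ≡ Δ)
common-multiple {zero}  d h = 1ℤ , ℤ.+<+ (s≤s z≤n) , (λ ()) , (λ ()) , λ ()
common-multiple {suc r} d h with common-multiple (λ i → d (suc i)) (λ i → h (suc i))
... | Δ , Δ>0 , E , E>0 , eq = d zero * Δ , 0<*⇒ (h zero) Δ>0 , E′ , E′>0 , eq′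
  where
  E′ : Fin (suc r) → ℤ
  E′ zero    = Δ
  E′ (suc i) = d zero * E i
  E′>0 : ∀ i → 0ℤ < E′ i
  E′>0 zero    = Δ>0
  E′>0 (suc i) = 0<*⇒ (h zero) (E>0 i)
  eq′ : ∀ i → E′ i * d i ≡ d zero * Δ
  eq′ zero    = *-comm Δ (d zero)
  eq′ (suc i) = trans (*-assoc (d zero) (E i) (d (suc i))) (cong (d zero *_) (eq i))

module Form {r : ℕ} (C : Cartan r) (cm : IsCartanMatrix C)
            {n : ℕ} (roots : Vec (Vec ℤ r) n) (enum : EnumeratesΦ⁺ C roots) where

  open Action C
  open Dichotomy C cm

  V : Set
  V = Vec ℤ r

  β : Fin n → V
  β = lookup roots

  β-root : ∀ p → IsRoot C (β p)
  β-root p = proj₁ (proj₁ enum p)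

  β-pos : ∀ p → Pos (β p)
  β-pos p = proj₂ (proj₁ enum p)

  β-injective : ∀ {p q} → β p ≡ β q → p ≡ q
  β-injective = proj₁ (proj₂ enum) _ _

  index : ∀ {v} → IsRoot C v → Pos v → ∃ λ p → β p ≡ v
  index h p = proj₂ (proj₂ enum) _ (h , p)

  neg-neg : ∀ (v : V) → -1ℤ ⊙ (-1ℤ ⊙ v) ≡ v
  neg-neg v = vec-ext λ k → trans (neg-lookup (-1ℤ ⊙ v) k) (trans (cong -_ (neg-lookup v k)) (neg-involutive (lookup v k)))

  root-neg : ∀ {v} → IsRoot C v → IsRoot C (-1ℤ ⊙ v)
  root-neg (w , i , refl) = w ++ i ∷ [] , i , act-neg w i

  root-act : ∀ {v} u → IsRoot C v → IsRoot C (act C u v)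
  root-act u (w , i , refl) = u ++ w , i , act-++ u w (e i)

  simple-root : ∀ i → IsRoot C (e i)
  simple-root i = [] , i , refl

  e-pos : ∀ i → Pos (e {r} i)
  e-pos i k with k ≟F i | lookup-e i k
  ... | yes _ | eq = subst (0ℤ ≤_) (sym eq) (ℤ.+≤+ z≤n)
  ... | no _  | eq = subst (0ℤ ≤_) (sym eq) ≤-refl

  root-nonzero : ∀ {v} → IsRoot C v → ¬ (∀ k → lookup v k ≡ 0ℤ)
  root-nonzero (w , i , refl) h = contradiction one λ ()
    where
    one : 1ℤ ≡ 0ℤ
    one = begin
      1ℤ ≡⟨ sym (trans (lookup-e i i) (δ-refl i)) ⟩
      lookup (e i) i ≡⟨ cong (λ t → lookup t i) (sym (act-reverse diag w (e i))) ⟩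
      lookup (act C (reverse w) (act C w (e i))) i ≡⟨ lookup-act (reverse w) (act C w (e i)) i ⟩
      dot (δ i ◁* reverse w) (act C w (e i)) ≡⟨ ∑-cong (λ k → trans (cong ((δ i ◁* reverse w) k *_) (h k)) (*-zeroʳ ((δ i ◁* reverse w) k))) ⟩
      ∑ {r} (λ _ → 0ℤ) ≡⟨ ∑-zero r ⟩
      0ℤ ∎
      where open ≡-Reasoning

  -- If aαᵢ = wαⱼ, applying w⁻¹ shows that a divides a coefficient of αⱼ equal to 1, so a = 1 by
  -- positivity.
  simple-multiple : ∀ {v i} → IsRoot C v → Pos v → (∀ k → k ≢ i → lookup v k ≡ 0ℤ) → v ≡ e i
  simple-multiple {v} {i} (w , j , eq) p h = vec-ext λ k → trans (cong (λ t → lookup t k) v≡) (trans (lookup-⊙ a (e i) k) (trans (cong (_* lookup (e i) k) a≡1) (*-identityˡ _)))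
    where
    a : ℤ
    a = lookup v i
    v≡ : v ≡ a ⊙ e i
    v≡ = vec-ext λ k → trans (case k) (sym (trans (lookup-⊙ a (e i) k) (cong (a *_) (lookup-e i k))))
      where
      case : ∀ k → lookup v k ≡ a * δ i k
      case k with k ≟F i
      ... | yes refl = sym (*-identityʳ a)
      ... | no  ne   = trans (h k ne) (sym (*-zeroʳ a))
    x : ℤ
    x = lookup (act C (reverse w) (e i)) j
    ax : a * x ≡ 1ℤ
    ax = begin
      a * x ≡⟨ sym (lookup-⊙ a (act C (reverse w) (e i)) j) ⟩
      lookup (a ⊙ act C (reverse w) (e i)) j ≡⟨ cong (λ t → lookup t j) (sym (act-⊙ (reverse w) a (e i))) ⟩
      lookup (act C (reverse w) (a ⊙ e i)) j ≡⟨ cong (λ t → lookup (act C (reverse w) t) j) (trans (sym v≡) (sym eq)) ⟩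
      lookup (act C (reverse w) (act C w (e j))) j ≡⟨ cong (λ t → lookup t j) (act-reverse diag w (e j)) ⟩
      lookup (e j) j ≡⟨ trans (lookup-e j j) (δ-refl j) ⟩
      1ℤ ∎
      where open ≡-Reasoning
    a≡1 : a ≡ 1ℤ
    a≡1 = trans (sym (0≤i⇒+∣i∣≡i (p i))) (cong pos (ℕₚ.m*n≡1⇒m≡1 ∣ a ∣ ∣ x ∣ (trans (sym (abs-* a x)) (cong ∣_∣ ax))))

  _~_ : Fin n → V → Set
  q ~ v = v ≡ β q ⊎ v ≡ -1ℤ ⊙ β q

  ~-index : ∀ {v} → IsRoot C v → ∃ λ q → q ~ v
  ~-index {v} h with root-sign h
  ... | inj₁ p = let (q , eq) = index h p in q , inj₁ (sym eq)
  ... | inj₂ m = let (q , eq) = index (root-neg h) (Pos-neg {v = v} m)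
                 in q , inj₂ (trans (sym (neg-neg v)) (cong (-1ℤ ⊙_) (sym eq)))

  not-opposite : ∀ {p q} → β p ≢ -1ℤ ⊙ β q
  not-opposite {p} {q} eq = root-nonzero (β-root p) λ k →
    ≤-antisym (subst (λ t → lookup t k ≤ 0ℤ) (sym eq) (Neg-neg {v = β q} (β-pos q) k)) (β-pos p k)

  ~-unique : ∀ {v p q} → p ~ v → q ~ v → p ≡ q
  ~-unique (inj₁ a) (inj₁ b) = β-injective (trans (sym a) b)
  ~-unique (inj₁ a) (inj₂ b) = ⊥-elim (not-opposite (trans (sym a) b))
  ~-unique (inj₂ a) (inj₁ b) = ⊥-elim (not-opposite (trans (sym b) a))
  ~-unique {v} {p} {q} (inj₂ a) (inj₂ b) = β-injective (trans (sym (neg-neg (β p))) (trans (cong (-1ℤ ⊙_) (trans (sym a) b)) (neg-neg (β q))))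

  private
    reflected : ∀ i p → ∃ λ q → q ~ sref C i (β p)
    reflected i p = ~-index (root-act (i ∷ []) (β-root p))

  -- The permutation of the positive roots induced by sᵢ up to sign. In D each root enters through
  -- two factors, so the signs cancel and D is invariant.
  π : Fin r → Fin n → Fin n
  π i p = proj₁ (reflected i p)

  π-involutive : ∀ i p → π i (π i p) ≡ p
  π-involutive i p = ~-unique (proj₂ (reflected i (π i p))) (back (proj₂ (reflected i p)))
    where
    back : ∀ {q} → q ~ sref C i (β p) → p ~ sref C i (β q)
    back (inj₁ eq) = inj₁ (trans (cong (sref C i) (sym eq)) (sref-involutive diag i (β p)))
    back {q} (inj₂ eq) = inj₂ (trans (cong (sref C i) (trans (sym (neg-neg (β q))) (cong (-1ℤ ⊙_) (sym eq))))
      (trans (act-⊙ (i ∷ []) -1ℤ (sref C i (β p))) (cong (-1ℤ ⊙_) (sref-involutive diag i (β p)))))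

  Functional : Set
  Functional = Fin r → ℤ

  D : Functional → Functional → ℤ
  D f g = ∑ (λ p → dot f (β p) * dot g (β p))

  D-cong : ∀ {f f′ g g′} → (∀ k → f k ≡ f′ k) → (∀ k → g k ≡ g′ k) → D f g ≡ D f′ g′
  D-cong h h′ = ∑-cong λ p → cong₂ _*_ (dot-cong h (β p)) (dot-cong h′ (β p))

  D-sym : ∀ f g → D f g ≡ D g f
  D-sym f g = ∑-cong λ p → *-comm (dot f (β p)) (dot g (β p))

  D-lin : ∀ a b f g h → D (λ k → a * f k + b * g k) h ≡ a * D f h + b * D g h
  D-lin a b f g h = trans
    (∑-cong λ p → trans (cong (_* dot h (β p)) (dot-lin a b f g (β p))) (distrib a b (dot f (β p)) (dot g (β p)) (dot h (β p))))
    (∑-lin a b (λ p → dot f (β p) * dot h (β p)) (λ p → dot g (β p) * dot h (β p)))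
    where
    distrib : ∀ a b x y z → (a * x + b * y) * z ≡ a * (x * z) + b * (y * z)
    distrib = solve-∀

  D-linʳ : ∀ a b f g h → D h (λ k → a * f k + b * g k) ≡ a * D h f + b * D h g
  D-linʳ a b f g h = trans (D-sym h (λ k → a * f k + b * g k)) (trans (D-lin a b f g h) (cong₂ (λ x y → a * x + b * y) (D-sym f h) (D-sym g h)))

  D-∑ : ∀ {m} (y : Fin m → ℤ) (f : Fin m → Functional) g → D (λ k → ∑ (λ l → y l * f l k)) g ≡ ∑ (λ l → y l * D (f l) g)
  D-∑ y f g = begin
    ∑ (λ p → dot (λ k → ∑ (λ l → y l * f l k)) (β p) * dot g (β p)) ≡⟨ ∑-cong (λ p → trans (cong (_* dot g (β p)) (dot-∑ y f (β p))) (trans (*-comm (∑ (λ l → y l * dot (f l) (β p))) (dot g (β p))) (sym (∑-*ˡ (dot g (β p)) (λ l → y l * dot (f l) (β p)))))) ⟩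
    ∑ (λ p → ∑ (λ l → dot g (β p) * (y l * dot (f l) (β p)))) ≡⟨ ∑-swap (λ p l → dot g (β p) * (y l * dot (f l) (β p))) ⟩
    ∑ (λ l → ∑ (λ p → dot g (β p) * (y l * dot (f l) (β p)))) ≡⟨ ∑-cong (λ l → trans (∑-cong (λ p → rot (dot g (β p)) (y l) (dot (f l) (β p)))) (∑-*ˡ (y l) (λ p → dot (f l) (β p) * dot g (β p)))) ⟩
    ∑ (λ l → y l * D (f l) g) ∎
    where
    open ≡-Reasoning
    rot : ∀ a b c → a * (b * c) ≡ b * (c * a)
    rot = solve-∀

  D-◁ : ∀ f g i → D (f ◁ i) (g ◁ i) ≡ D f g
  D-◁ f g i = trans (∑-cong term) (∑-permute (λ p → dot f (β p) * dot g (β p)) (π i) (π-involutive i))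
    where
    neg² : ∀ x y → (-1ℤ * x) * (-1ℤ * y) ≡ x * y
    neg² = solve-∀
    term : ∀ p → dot (f ◁ i) (β p) * dot (g ◁ i) (β p) ≡ dot f (β (π i p)) * dot g (β (π i p))
    term p with reflected i p
    ... | q , inj₁ eq = cong₂ _*_ (trans (sym (dot-sref f i (β p))) (cong (dot f) eq)) (trans (sym (dot-sref g i (β p))) (cong (dot g) eq))
    ... | q , inj₂ eq = trans (cong₂ _*_ (trans (sym (dot-sref f i (β p))) (trans (cong (dot f) eq) (dot-⊙ f -1ℤ (β q))))
                                          (trans (sym (dot-sref g i (β p))) (trans (cong (dot g) eq) (dot-⊙ g -1ℤ (β q)))))
                              (neg² (dot f (β q)) (dot g (β q)))

  D-◁* : ∀ w f g → D (f ◁* w) (g ◁* w) ≡ D f g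
  D-◁* []      f g = refl
  D-◁* (i ∷ w) f g = trans (D-◁* w (f ◁ i) (g ◁ i)) (D-◁ f g i)

  D-square≤ : ∀ f i → f i * f i ≤ D f f
  D-square≤ f i with index (simple-root i) (e-pos i)
  ... | p , eq = subst (λ t → t * t ≤ D f f) (trans (cong (dot f) eq) (dot-e f i))
                       (≤-∑ (λ p → dot f (β p) * dot f (β p)) (λ p → square-nonneg (dot f (β p))) p)

  D-definite : ∀ f → D f f ≤ 0ℤ → ∀ i → f i ≡ 0ℤ
  D-definite f h i = square-zero (f i) (≤-antisym (≤-trans (D-square≤ f i) h) (square-nonneg (f i)))

  D-radical : ∀ f → (∀ g → D f g ≡ 0ℤ) → ∀ i → f i ≡ 0ℤ
  D-radical f h = D-definite f (≤-reflexive (h f))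

  norm : Fin r → ℤ
  norm i = D (C i) (C i)

  norm>0 : ∀ i → 0ℤ < norm i
  norm>0 i = <-≤-trans (ℤ.+<+ (s≤s z≤n)) (subst (λ t → t * t ≤ norm i) (diag i) (D-square≤ (C i) i))

  -- Invariance of D under sᵢ, which sends Cᵢ to -Cᵢ and g to g - g(αᵢ) Cᵢ, gives g(αᵢ) D(Cᵢ,Cᵢ) -
  -- D(Cᵢ,g) = D(Cᵢ,g). Thus Cᵢ represents evaluation at αᵢ up to a positive factor.
  D-coroot : ∀ i g → pos 2 * D (C i) g ≡ g i * norm i
  D-coroot i g = solve-for (D (C i) g) (g i) (norm i) (begin
    -1ℤ * (1ℤ * D (C i) g + (- g i) * norm i) ≡⟨ cong (-1ℤ *_) (sym (D-linʳ 1ℤ (- g i) g (C i) (C i))) ⟩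
    -1ℤ * D (C i) (λ k → 1ℤ * g k + (- g i) * C i k) ≡⟨ zero-term (D (C i) (λ k → 1ℤ * g k + (- g i) * C i k)) ⟩
    -1ℤ * D (C i) (λ k → 1ℤ * g k + (- g i) * C i k) + 0ℤ * D (C i) (λ k → 1ℤ * g k + (- g i) * C i k)
                                                                        ≡⟨ sym (D-lin -1ℤ 0ℤ (C i) (C i) (λ k → 1ℤ * g k + (- g i) * C i k)) ⟩
    D (λ k → -1ℤ * C i k + 0ℤ * C i k) (λ k → 1ℤ * g k + (- g i) * C i k) ≡⟨ D-cong (λ k → sym (trans (cong (λ t → C i k - t * C i k) (diag i)) (reflect (C i k)))) (λ k → expand (g k) (g i) (C i k)) ⟩
    D (C i ◁ i) (g ◁ i) ≡⟨ D-◁ (C i) g i ⟩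
    D (C i) g ∎)
    where
    open ≡-Reasoning
    zero-term : ∀ x → -1ℤ * x ≡ -1ℤ * x + 0ℤ * x
    zero-term = solve-∀
    reflect : ∀ c → c - pos 2 * c ≡ -1ℤ * c + 0ℤ * c
    reflect = solve-∀
    expand : ∀ x y c → 1ℤ * x + (- y) * c ≡ x - y * c
    expand = solve-∀
    move : ∀ x y z → -1ℤ * (1ℤ * x + (- y) * z) - x ≡ - (pos 2 * x - y * z)
    move = solve-∀
    solve-for : ∀ x y z → -1ℤ * (1ℤ * x + (- y) * z) ≡ x → pos 2 * x ≡ y * z
    solve-for x y z h = i-j≡0⇒i≡j (pos 2 * x) (y * z)
      (trans (sym (neg-involutive (pos 2 * x - y * z))) (cong -_ (trans (sym (move x y z)) (i≡j⇒i-j≡0 h))))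

  -- Pair the vanishing combination with the coordinate functional `δ k` under D: by `D-coroot` only
  -- the term i = k survives. This is the nonsingularity of a Cartan matrix of finite type.
  coroots-independent : ∀ (y : Fin r → ℤ) → (∀ j → ∑ (λ i → y i * C i j) ≡ 0ℤ) → ∀ k → y k ≡ 0ℤ
  coroots-independent y h k = *-zero-pos (norm>0 k) (trans (*-comm (norm k) (y k)) (begin
    y k * norm k ≡⟨ sym (∑-δ (λ i → y i * norm i) k) ⟩
    ∑ (λ i → y i * norm i * δ k i) ≡⟨ ∑-cong (λ i → rearr (y i) (norm i) (δ k i)) ⟩
    ∑ (λ i → y i * (δ k i * norm i)) ≡⟨ ∑-cong (λ i → trans (cong (y i *_) (sym (D-coroot i (δ k)))) (rearr′ (y i) (D (C i) (δ k)))) ⟩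
    ∑ (λ i → pos 2 * (y i * D (C i) (δ k))) ≡⟨ ∑-*ˡ (pos 2) (λ i → y i * D (C i) (δ k)) ⟩
    pos 2 * ∑ (λ i → y i * D (C i) (δ k)) ≡⟨ cong (pos 2 *_) (sym (D-∑ y C (δ k))) ⟩
    pos 2 * D (λ j → ∑ (λ i → y i * C i j)) (δ k) ≡⟨ cong (pos 2 *_) (D-cong {g = δ k} h (λ _ → refl)) ⟩
    pos 2 * D (λ _ → 0ℤ) (δ k) ≡⟨ cong (pos 2 *_) (trans (∑-cong (λ p → cong (_* dot (δ k) (β p)) (trans (∑-cong {r} (λ j → *-zeroˡ (lookup (β p) j))) (∑-zero r)))) (trans (∑-cong {n} (λ p → *-zeroˡ (dot (δ k) (β p)))) (∑-zero n))) ⟩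
    0ℤ ∎))
    where
    open ≡-Reasoning
    rearr : ∀ a b c → a * b * c ≡ a * (c * b)
    rearr = solve-∀
    rearr′ : ∀ a b → a * (pos 2 * b) ≡ pos 2 * (a * b)
    rearr′ = solve-∀

  -- The functional g ↦ g(x) is, up to the factor Δ / 2, the D-product with f = Σ xᵢ Eᵢ Cᵢ, so that
  -- D(f,f) is a positive combination of the numbers xᵢ ⟨x, αᵢ^∨⟩.
  positive-pairing : ∀ (x : V) → Pos x → ¬ (∀ k → lookup x k ≡ 0ℤ) →
                     ∃ λ i → 0ℤ < lookup x i × 0ℤ < pairing C i x
  positive-pairing x px nz with any? (λ i → (0ℤ <? lookup x i) ×-dec (0ℤ <? pairing C i x))
  ... | yes p = p
  ... | no np with common-multiple norm norm>0
  ...   | Δ , Δ>0 , E , E>0 , eq = ⊥-elim (nz λ k → *-zero-pos Δ>0 (trans (cong (Δ *_) (sym (dot-δ x k))) (trans (sym (D-f (δ k))) (trans (cong (pos 2 *_) (D-f0 (δ k))) refl))))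
    where
    y : Fin r → ℤ
    y i = lookup x i * E i
    f : Functional
    f j = ∑ (λ i → y i * C i j)
    rearr : ∀ a b → a * (pos 2 * b) ≡ pos 2 * (a * b)
    rearr = solve-∀
    shuffle : ∀ a b c d → a * b * (c * d) ≡ (b * d) * (c * a)
    shuffle = solve-∀
    D-f : ∀ g → pos 2 * D f g ≡ Δ * dot g x
    D-f g = begin
      pos 2 * D f g ≡⟨ cong (pos 2 *_) (D-∑ y C g) ⟩
      pos 2 * ∑ (λ i → y i * D (C i) g) ≡⟨ sym (∑-*ˡ (pos 2) (λ i → y i * D (C i) g)) ⟩
      ∑ (λ i → pos 2 * (y i * D (C i) g)) ≡⟨ ∑-cong (λ i → trans (sym (rearr (y i) (D (C i) g))) (cong (y i *_) (D-coroot i g))) ⟩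
      ∑ (λ i → y i * (g i * norm i)) ≡⟨ ∑-cong (λ i → trans (shuffle (lookup x i) (E i) (g i) (norm i)) (cong (_* (g i * lookup x i)) (eq i))) ⟩
      ∑ (λ i → Δ * (g i * lookup x i)) ≡⟨ ∑-*ˡ Δ (λ i → g i * lookup x i) ⟩
      Δ * dot g x ∎
      where open ≡-Reasoning
    f-x : dot f x ≤ 0ℤ
    f-x = subst₂ _≤_ (sym (dot-∑ y C x)) (∑-zero r) (∑-mono {g = λ _ → 0ℤ} term)
      where
      term : ∀ i → y i * dot (C i) x ≤ 0ℤ
      term i with 0ℤ <? lookup x i
      ... | no h = ≤-reflexive (trans (cong (λ t → t * E i * dot (C i) x) (≤-antisym (≮⇒≥ h) (px i))) (trans (cong (_* dot (C i) x) (*-zeroˡ (E i))) (*-zeroˡ (dot (C i) x))))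
      ... | yes h = 0≤neg⁻ (subst (0ℤ ≤_) (sym (neg-distribʳ-* (y i) (dot (C i) x)))
                      (0≤*⇒ (<⇒≤ (0<*⇒ h (E>0 i))) (0≤neg (≮⇒≥ λ h′ → np (i , h , h′)))))
    D-ff : D f f ≤ 0ℤ
    D-ff = 0≤neg⁻ (0≤2*⇒ (subst (0ℤ ≤_) (trans (sym (neg-distribʳ-* Δ (dot f x))) (trans (cong -_ (sym (D-f f))) (neg-distribʳ-* (pos 2) (D f f))))
             (0≤*⇒ (<⇒≤ Δ>0) (0≤neg f-x))))
    D-f0 : ∀ g → D f g ≡ 0ℤ
    D-f0 g = trans (∑-cong λ p → trans (cong (_* dot g (β p)) (trans (∑-cong λ k → trans (cong (_* lookup (β p) k) (D-definite f D-ff k)) (*-zeroˡ (lookup (β p) k))) (∑-zero r))) (*-zeroˡ (dot g (β p)))) (∑-zero n)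

-- Reflections and the root poset

0<⇒1≤ : ∀ {a} → 0ℤ < a → 1ℤ ≤ a
0<⇒1≤ (ℤ.+<+ h) = ℤ.+≤+ h

+1-cancel-≤ : ∀ a b → a + 1ℤ ≤ b + 1ℤ → a ≤ b
+1-cancel-≤ a b h = subst₂ _≤_ (cancel a) (cancel b) (+-monoˡ-≤ -1ℤ h)
  where
  cancel : ∀ a → a + 1ℤ + -1ℤ ≡ a
  cancel = solve-∀

height-∑ : ∀ {r} (v : Vec ℤ r) → height v ≡ ∑ (lookup v)
height-∑ v = cong sumℤ (sym (tabulate∘lookup v))

height-e : ∀ {r} (i : Fin r) → height (e i) ≡ 1ℤ
height-e i = trans (height-∑ (e i)) (trans (∑-cong λ k → trans (lookup-e i k) (sym (*-identityˡ (δ i k)))) (∑-δ (λ _ → 1ℤ) i))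

height-⊕e : ∀ {r} (v : Vec ℤ r) i → height (v ⊕ e i) ≡ height v + 1ℤ
height-⊕e v i = trans (height-∑ (v ⊕ e i)) (trans (∑-cong λ k → lookup-⊕ v (e i) k)
  (trans (∑-+ (lookup v) (lookup (e i))) (cong₂ _+_ (sym (height-∑ v)) (trans (sym (height-∑ (e i))) (height-e i)))))

module Roots {r : ℕ} (C : Cartan r) (cm : IsCartanMatrix C)
             {n : ℕ} (roots : Vec (Vec ℤ r) n) (enum : EnumeratesΦ⁺ C roots) where

  open Action C
  open Dichotomy C cm
  open Form C cm roots enum

  coroot : Word r → Fin r → Functional
  coroot w i = C i ◁* reverse w

  reflection : Word r → Fin r → Word r
  reflection w i = w ++ i ∷ reverse w

  act-reflection : ∀ w i v → act C (reflection w i) v ≡ v ⊕ (- dot (coroot w i) v) ⊙ act C w (e i)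
  act-reflection w i v = begin
    act C (w ++ i ∷ reverse w) v ≡⟨ act-++ w (i ∷ reverse w) v ⟩
    act C w (sref C i u) ≡⟨ cong (act C w) (sref-⊕ i u) ⟩
    act C w (u ⊕ (- pairing C i u) ⊙ e i) ≡⟨ act-⊕ w u ((- pairing C i u) ⊙ e i) ⟩
    act C w u ⊕ act C w ((- pairing C i u) ⊙ e i) ≡⟨ cong₂ _⊕_ (act-reverse′ diag w v) (act-⊙ w (- pairing C i u) (e i)) ⟩
    v ⊕ (- pairing C i u) ⊙ act C w (e i) ≡⟨ cong (λ t → v ⊕ (- t) ⊙ act C w (e i)) (dot-act (C i) (reverse w) v) ⟩
    v ⊕ (- dot (coroot w i) v) ⊙ act C w (e i) ∎
    where
    open ≡-Reasoning
    u = act C (reverse w) v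

  coroot-root : ∀ w i → dot (coroot w i) (act C w (e i)) ≡ pos 2
  coroot-root w i = trans (sym (dot-act (C i) (reverse w) (act C w (e i))))
    (trans (cong (dot (C i)) (act-reverse diag w (e i))) (trans (dot-e (C i) i) (diag i)))

  D-coroot* : ∀ w i g → pos 2 * D (coroot w i) g ≡ dot g (act C w (e i)) * norm i
  D-coroot* w i g = begin
    pos 2 * D (coroot w i) g ≡⟨ cong (pos 2 *_) (sym (D-◁* w (coroot w i) g)) ⟩
    pos 2 * D (coroot w i ◁* w) (g ◁* w) ≡⟨ cong (pos 2 *_) (D-cong {coroot w i ◁* w} {C i} {g ◁* w} (dot-ext {f = coroot w i ◁* w} {C i} λ v → trans (sym (dot-act (coroot w i) w v)) (trans (sym (dot-act (C i) (reverse w) (act C w v))) (cong (dot (C i)) (act-reverse diag w v)))) (λ _ → refl)) ⟩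
    pos 2 * D (C i) (g ◁* w) ≡⟨ D-coroot i (g ◁* w) ⟩
    (g ◁* w) i * norm i ≡⟨ cong (_* norm i) (trans (sym (dot-e (g ◁* w) i)) (sym (dot-act g w (e i)))) ⟩
    dot g (act C w (e i)) * norm i ∎
    where open ≡-Reasoning

  D-proportional : ∀ a b f g → (∀ h → a * D f h ≡ b * D g h) → ∀ k → a * f k ≡ b * g k
  D-proportional a b f g eq k = i-j≡0⇒i≡j (a * f k) (b * g k)
    (trans (neg-out (a * f k) b (g k)) (D-radical (λ k → a * f k + (- b) * g k) (λ h →
      trans (D-lin a (- b) f g h) (trans (sym (neg-out (a * D f h) b (D g h))) (i≡j⇒i-j≡0 (eq h)))) k))
    where
    neg-out : ∀ x b y → x - b * y ≡ x + (- b) * y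
    neg-out = solve-∀

  -- By `D-coroot*` both functionals represent evaluation at the same root up to scale, so
  -- nondegeneracy of D makes them proportional. Both take the value 2 at that root, hence they
  -- coincide. It follows that a reflection depends on its root alone.
  coroot-unique : ∀ w i w′ i′ → act C w (e i) ≡ act C w′ (e i′) → ∀ k → coroot w i k ≡ coroot w′ i′ k
  coroot-unique w i w′ i′ eq k = *-cancel-pos (norm>0 i′) (trans (prop k) (cong (_* coroot w′ i′ k) same))
    where
    swap : ∀ a b c → a * (b * c) ≡ b * (a * c)
    swap = solve-∀
    prop : ∀ k → norm i′ * coroot w i k ≡ norm i * coroot w′ i′ k
    prop = D-proportional (norm i′) (norm i) (coroot w i) (coroot w′ i′) λ h →
      *-cancelˡ-≡ (pos 2) _ _ (begin
        pos 2 * (norm i′ * D (coroot w i) h) ≡⟨ swap (pos 2) (norm i′) (D (coroot w i) h) ⟩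
        norm i′ * (pos 2 * D (coroot w i) h) ≡⟨ cong (norm i′ *_) (D-coroot* w i h) ⟩
        norm i′ * (dot h (act C w (e i)) * norm i) ≡⟨ cong (λ t → norm i′ * (dot h t * norm i)) eq ⟩
        norm i′ * (dot h (act C w′ (e i′)) * norm i) ≡⟨ rot (norm i′) (dot h (act C w′ (e i′))) (norm i) ⟩
        norm i * (dot h (act C w′ (e i′)) * norm i′) ≡⟨ cong (norm i *_) (sym (D-coroot* w′ i′ h)) ⟩
        norm i * (pos 2 * D (coroot w′ i′) h) ≡⟨ swap (norm i) (pos 2) (D (coroot w′ i′) h) ⟩
        pos 2 * (norm i * D (coroot w′ i′) h) ∎)
      where
      open ≡-Reasoning
      rot : ∀ a b c → a * (b * c) ≡ c * (b * a)
      rot = solve-∀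
    eval : norm i′ * pos 2 ≡ norm i * pos 2
    eval = begin
      norm i′ * pos 2 ≡⟨ cong (norm i′ *_) (sym (coroot-root w i)) ⟩
      norm i′ * dot (coroot w i) (act C w (e i)) ≡⟨ pad (norm i′) (dot (coroot w i) (act C w (e i))) ⟩
      norm i′ * dot (coroot w i) (act C w (e i)) + 0ℤ * dot (coroot w i) (act C w (e i)) ≡⟨ sym (dot-lin (norm i′) 0ℤ (coroot w i) (coroot w i) (act C w (e i))) ⟩
      dot (λ k → norm i′ * coroot w i k + 0ℤ * coroot w i k) (act C w (e i)) ≡⟨ dot-cong (λ k → trans (sym (pad (norm i′) (coroot w i k))) (trans (prop k) (pad (norm i) (coroot w′ i′ k)))) (act C w (e i)) ⟩
      dot (λ k → norm i * coroot w′ i′ k + 0ℤ * coroot w′ i′ k) (act C w (e i)) ≡⟨ dot-lin (norm i) 0ℤ (coroot w′ i′) (coroot w′ i′) (act C w (e i)) ⟩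
      norm i * dot (coroot w′ i′) (act C w (e i)) + 0ℤ * dot (coroot w′ i′) (act C w (e i)) ≡⟨ sym (pad (norm i) (dot (coroot w′ i′) (act C w (e i)))) ⟩
      norm i * dot (coroot w′ i′) (act C w (e i)) ≡⟨ cong (λ t → norm i * dot (coroot w′ i′) t) eq ⟩
      norm i * dot (coroot w′ i′) (act C w′ (e i′)) ≡⟨ cong (norm i *_) (coroot-root w′ i′) ⟩
      norm i * pos 2 ∎
      where
      open ≡-Reasoning
      pad : ∀ a x → a * x ≡ a * x + 0ℤ * x
      pad = solve-∀
    same : norm i ≡ norm i′
    same = *-cancelʳ-≡ (norm i) (norm i′) (pos 2) (sym eval)

  reflection-unique : ∀ w i w′ i′ → act C w (e i) ≡ act C w′ (e i′) → reflection w i ≋ reflection w′ i′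
  reflection-unique w i w′ i′ eq = mk λ v → trans (act-reflection w i v)
    (trans (cong₂ (λ a b → v ⊕ (- a) ⊙ b) (dot-cong (coroot-unique w i w′ i′ eq) v) eq) (sym (act-reflection w′ i′ v)))

  -- One of the two mutual pairings is -1, since otherwise the sum of the two coroots has D-norm ≤ 0.
  root-string : ∀ {v i} → IsRoot C v → pairing C i v < 0ℤ →
    IsRoot C (v ⊕ e i) ⊎ (∃ λ a → ∃ λ b → 0ℤ < a × 0ℤ < b × ∀ k → a * lookup v k ≡ - (b * δ i k))
  root-string {v} {i} (w , j , refl) p<0 = cases (p ℤ.≟ -1ℤ) (f i ℤ.≟ -1ℤ)
    where
    p : ℤ
    p = pairing C i v
    f : Functional
    f = coroot w j
    product : f i * norm i ≡ p * norm j
    product = trans (sym (D-coroot i f)) (trans (cong (pos 2 *_) (D-sym (C i) f)) (D-coroot* w j (C i)))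
    fi<0 : f i < 0ℤ
    fi<0 with f i <? 0ℤ
    ... | yes h = h
    ... | no h = contradiction (≤-<-trans (0≤*⇒ (≮⇒≥ h) (<⇒≤ (norm>0 i))) (subst (_< 0ℤ) (sym product) pn<0)) (<-irrefl refl)
      where
      pn<0 : p * norm j < 0ℤ
      pn<0 = subst (p * norm j <_) (*-zeroˡ (norm j)) (*-monoʳ-<-pos (norm j) {{ℤ.positive (norm>0 j)}} p<0)
    ≤-2 : ∀ {x} → x < 0ℤ → x ≢ -1ℤ → pos 2 + x ≤ 0ℤ
    ≤-2 {pos _} (ℤ.+<+ ()) _
    ≤-2 { -[1+ 0 ]} _ h = contradiction refl h
    ≤-2 { -[1+ 1 ]} _ h = ≤-refl
    ≤-2 { -[1+ suc (suc n) ]} _ h = ℤ.-≤+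
    cases : Dec (p ≡ -1ℤ) → Dec (f i ≡ -1ℤ) → _
    cases (yes h) _ = inj₁ (subst (IsRoot C) (trans (sref-⊕ i v) (cong (λ t → v ⊕ t) (vec-ext λ k → trans (lookup-⊙ (- p) (e i) k) (trans (cong (λ t → - t * lookup (e i) k) h) (*-identityˡ _)))))
                                     (root-act (i ∷ []) (w , j , refl)))
    cases (no _) (yes h) = inj₁ (subst (IsRoot C) (trans (act-reflection w j (e i)) (vec-ext λ k →
      trans (lookup-⊕ (e i) ((- dot f (e i)) ⊙ v) k) (trans (cong (λ t → lookup (e i) k + t) (trans (lookup-⊙ (- dot f (e i)) v k) (trans (cong (λ t → - t * lookup v k) (trans (dot-e f i) h)) (*-identityˡ _))))
        (trans (+-comm (lookup (e i) k) (lookup v k)) (sym (lookup-⊕ v (e i) k))))))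
      (root-act (reflection w j) (simple-root i)))
    -- Both pairings are at most -2, and 2 D(g,g) = (2 + p) norm j + (2 + f i) norm i for g = f +
    -- Cᵢ. So g vanishes, and v is a negative rational multiple of αᵢ. The case v = -αᵢ shows that
    -- this alternative does occur.
    cases (no h) (no h′) = inj₂ (norm j , norm i , norm>0 j , norm>0 i , λ k → begin
        norm j * lookup v k ≡⟨ *-comm (norm j) (lookup v k) ⟩
        lookup v k * norm j ≡⟨ cong (_* norm j) (sym (dot-δ v k)) ⟩
        dot (δ k) v * norm j ≡⟨ sym (D-coroot* w j (δ k)) ⟩
        pos 2 * D f (δ k) ≡⟨ cong (pos 2 *_) (opposite (δ k)) ⟩
        pos 2 * (- D (C i) (δ k)) ≡⟨ sym (neg-distribʳ-* (pos 2) (D (C i) (δ k))) ⟩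
        - (pos 2 * D (C i) (δ k)) ≡⟨ cong -_ (trans (D-coroot i (δ k)) (trans (*-comm (δ k i) (norm i)) (cong (norm i *_) (δ-sym k i)))) ⟩
        - (norm i * δ i k) ∎)
      where
      open ≡-Reasoning
      g : Functional
      g k = 1ℤ * f k + 1ℤ * C i k
      expand : ∀ dff dfc dcc → pos 2 * (1ℤ * (1ℤ * dff + 1ℤ * dfc) + 1ℤ * (1ℤ * dfc + 1ℤ * dcc)) ≡ (pos 2 * dff + pos 2 * dfc) + (pos 2 * dfc + pos 2 * dcc)
      expand = solve-∀
      collect : ∀ p nj fi ni → (pos 2 * nj + p * nj) + (fi * ni + pos 2 * ni) ≡ (pos 2 + p) * nj + (pos 2 + fi) * ni
      collect = solve-∀
      Dgg : pos 2 * D g g ≡ (pos 2 + p) * norm j + (pos 2 + f i) * norm i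
      Dgg = begin
        pos 2 * D g g ≡⟨ cong (pos 2 *_) (trans (D-lin 1ℤ 1ℤ f (C i) g) (cong₂ (λ x y → 1ℤ * x + 1ℤ * y) (D-linʳ 1ℤ 1ℤ f (C i) f) (trans (D-linʳ 1ℤ 1ℤ f (C i) (C i)) (cong (λ t → 1ℤ * t + 1ℤ * D (C i) (C i)) (D-sym (C i) f))))) ⟩
        pos 2 * (1ℤ * (1ℤ * D f f + 1ℤ * D f (C i)) + 1ℤ * (1ℤ * D f (C i) + 1ℤ * D (C i) (C i))) ≡⟨ expand (D f f) (D f (C i)) (D (C i) (C i)) ⟩
        (pos 2 * D f f + pos 2 * D f (C i)) + (pos 2 * D f (C i) + pos 2 * norm i)
          ≡⟨ cong₂ (λ x y → x + (y + pos 2 * norm i)) (cong₂ _+_ (trans (D-coroot* w j f) (cong (_* norm j) (coroot-root w j))) (D-coroot* w j (C i))) (trans (D-coroot* w j (C i)) (sym product)) ⟩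
        (pos 2 * norm j + p * norm j) + (f i * norm i + pos 2 * norm i) ≡⟨ collect p (norm j) (f i) (norm i) ⟩
        (pos 2 + p) * norm j + (pos 2 + f i) * norm i ∎
      nonpos : ∀ {a b} → a ≤ 0ℤ → 0ℤ < b → a * b ≤ 0ℤ
      nonpos {a} {b} ha hb = 0≤neg⁻ (subst (0ℤ ≤_) (sym (neg-distribˡ-* a b)) (0≤*⇒ (0≤neg ha) (<⇒≤ hb)))
      Dgg≤0 : D g g ≤ 0ℤ
      Dgg≤0 = *-cancelˡ-≤-pos (D g g) 0ℤ (pos 2) (subst (_≤ pos 2 * 0ℤ) (sym Dgg) (+-mono-≤ (nonpos (≤-2 p<0 h) (norm>0 j)) (nonpos (≤-2 fi<0 h′) (norm>0 i))))
      opposite : ∀ x → D f x ≡ - D (C i) x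
      opposite x = trans (D-cong {g = x} (λ k → neg-of (f k) (C i k) (D-definite g Dgg≤0 k)) (λ _ → refl))
        (trans (D-lin -1ℤ 0ℤ (C i) (C i) x) (neg-one (D (C i) x)))
        where
        neg-of : ∀ a b → 1ℤ * a + 1ℤ * b ≡ 0ℤ → a ≡ -1ℤ * b + 0ℤ * b
        neg-of a b h = trans (split a b) (trans (cong (_+ (-1ℤ * b + 0ℤ * b)) h) (+-identityˡ _))
          where
          split : ∀ a b → a ≡ (1ℤ * a + 1ℤ * b) + (-1ℤ * b + 0ℤ * b)
          split = solve-∀
        neg-one : ∀ x → -1ℤ * x + 0ℤ * x ≡ - x
        neg-one = solve-∀

  infix 4 _≤v_
  _≤v_ : V → V → Set
  u ≤v v = ∀ k → lookup u k ≤ lookup v k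

  height-nonneg : ∀ (v : V) → Pos v → 0ℤ ≤ height v
  height-nonneg v p = subst (0ℤ ≤_) (sym (height-∑ v)) (∑-nonneg (lookup v) p)

  lookup-⊕e : ∀ (v : V) i k → lookup (v ⊕ e i) k ≡ lookup v k + δ i k
  lookup-⊕e v i k = trans (lookup-⊕ v (e i) k) (cong (λ t → lookup v k + t) (lookup-e i k))

  δ-bound : ∀ {i} {f : Fin r → ℤ} → (∀ k → 0ℤ ≤ f k) → 0ℤ < f i → ∀ k → δ i k ≤ f k
  δ-bound {i} h h′ k with k ≟F i
  ... | yes refl = 0<⇒1≤ h′
  ... | no _     = h k

  -- The difference v - u has an index i at which both its coefficient and its pairing with the
  -- coroot of αᵢ are positive. Either u pairs negatively with that coroot, and u + αᵢ is a root
  -- below v; or v pairs positively, and v - αᵢ is a root above u, so that the height of the upper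
  -- end drops. `N` bounds that height.
  cover-root : ∀ N {u v} → IsRoot C u → Pos u → IsRoot C v → u ≤v v → u ≢ v → height v ≤ pos N →
               ∃ λ z → IsRoot C z × Pos z × height z ≡ height u + 1ℤ × u ≤v z × z ≤v v
  cover-root N {u} {v} ru pu rv u≤v u≢v hN = choose (positive-pairing x px x≢0)
    where
    x : V
    x = v ⊕ -1ℤ ⊙ u
    x-k : ∀ k → lookup x k ≡ lookup v k - lookup u k
    x-k k = trans (lookup-⊕ v (-1ℤ ⊙ u) k) (cong (λ t → lookup v k + t) (neg-lookup u k))
    px : Pos x
    px k = subst (0ℤ ≤_) (sym (x-k k)) (i≤j⇒0≤j-i (u≤v k))
    x≢0 : ¬ (∀ k → lookup x k ≡ 0ℤ)
    x≢0 h = u≢v (vec-ext λ k → sym (i-j≡0⇒i≡j (lookup v k) (lookup u k) (trans (sym (x-k k)) (h k))))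
    pv : Pos v
    pv k = ≤-trans (pu k) (u≤v k)
    pairing-x : ∀ i → pairing C i x ≡ pairing C i v - pairing C i u
    pairing-x i = trans (dot-⊕ (C i) v (-1ℤ ⊙ u)) (cong (λ t → pairing C i v + t) (trans (dot-⊙ (C i) -1ℤ u) (-1*i≡-i (pairing C i u))))
    add-back : ∀ a b → a + (b - a) ≡ b
    add-back = solve-∀
    choose : (∃ λ i → 0ℤ < lookup x i × 0ℤ < pairing C i x) → _
    choose (i , xi>0 , pi>0) with pairing C i u <? 0ℤ
    ... | yes pu<0 = raise (root-string ru pu<0)
      where
      raise : _ ⊎ _ → _
      raise (inj₁ rz) = u ⊕ e i , rz , (λ k → ≤-trans (pu k) (below k)) , height-⊕e u i , below , above
        where
        below : u ≤v u ⊕ e i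
        below k = subst (lookup u k ≤_) (sym (lookup-⊕ u (e i) k))
                    (subst (_≤ lookup u k + lookup (e i) k) (+-identityʳ (lookup u k)) (+-monoʳ-≤ (lookup u k) (e-pos i k)))
        above : u ⊕ e i ≤v v
        above k = subst₂ _≤_ (sym (lookup-⊕e u i k)) (add-back (lookup u k) (lookup v k))
                    (+-monoʳ-≤ (lookup u k) (δ-bound {i} {λ k → lookup v k - lookup u k} (λ k → i≤j⇒0≤j-i (u≤v k)) (subst (0ℤ <_) (x-k i) xi>0) k))
      -- Excluded: the positive root u would be a negative multiple of αᵢ up to scale.
      raise (inj₂ (a , b , a>0 , b>0 , eq)) = contradiction
        (0<⇒≢0 b>0 (≤-antisym (0≤neg⁻ (subst (0ℤ ≤_) (trans (eq i) (cong -_ (trans (cong (b *_) (δ-refl i)) (*-identityʳ b)))) (0≤*⇒ (<⇒≤ a>0) (pu i)))) (<⇒≤ b>0)))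
        λ z → z
    ... | no pu≮0 = lower N hN (root-string (root-neg rv) neg-p)
      where
      neg-p : pairing C i (-1ℤ ⊙ v) < 0ℤ
      neg-p = subst (_< 0ℤ) (sym (trans (dot-⊙ (C i) -1ℤ v) (-1*i≡-i (pairing C i v)))) (neg-mono-< pv>0)
        where
        pv>0 : 0ℤ < pairing C i v
        pv>0 = <-≤-trans (subst (0ℤ <_) (pairing-x i) pi>0)
                 (subst (pairing C i v - pairing C i u ≤_) (+-identityʳ (pairing C i v)) (+-monoʳ-≤ (pairing C i v) (neg≤0 (≮⇒≥ pu≮0))))
      lower : ∀ N → height v ≤ pos N → _ ⊎ _ → _
      lower N hN (inj₁ rz) = next (≡-dec ℤ._≟_ u v′)
        where
        v′ : V
        v′ = -1ℤ ⊙ (-1ℤ ⊙ v ⊕ e i)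
        v′-k : ∀ k → lookup v′ k ≡ lookup v k - δ i k
        v′-k k = trans (neg-lookup (-1ℤ ⊙ v ⊕ e i) k) (trans (cong -_ (trans (lookup-⊕e (-1ℤ ⊙ v) i k) (cong (_+ δ i k) (neg-lookup v k)))) (neg-swap (lookup v k) (δ i k)))
          where
          neg-swap : ∀ a b → - (- a + b) ≡ a - b
          neg-swap = solve-∀
        v≡ : v ≡ v′ ⊕ e i
        v≡ = vec-ext λ k → sym (trans (lookup-⊕e v′ i k) (trans (cong (_+ δ i k) (v′-k k)) (sub-add (lookup v k) (δ i k))))
          where
          sub-add : ∀ a b → a - b + b ≡ a
          sub-add = solve-∀
        v′≤v : v′ ≤v v
        v′≤v k = subst (_≤ lookup v k) (sym (v′-k k)) (subst (lookup v k - δ i k ≤_) (+-identityʳ (lookup v k)) (+-monoʳ-≤ (lookup v k) (neg≤0 (subst (0ℤ ≤_) (lookup-e i k) (e-pos i k)))))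
        u≤v′ : u ≤v v′
        u≤v′ k = subst₂ _≤_ (swap (lookup u k) (lookup v k)) (sym (v′-k k))
                   (+-monoʳ-≤ (lookup v k) (neg-mono-≤ (δ-bound {i} {λ k → lookup v k - lookup u k} (λ k → i≤j⇒0≤j-i (u≤v k)) (subst (0ℤ <_) (x-k i) xi>0) k)))
          where
          swap : ∀ a b → b - (b - a) ≡ a
          swap = solve-∀
        pv′ : Pos v′
        pv′ k = ≤-trans (pu k) (u≤v′ k)
        hv : height v ≡ height v′ + 1ℤ
        hv = trans (cong height v≡) (height-⊕e v′ i)
        next : Dec (u ≡ v′) → _
        next (yes eq) = v , rv , pv , trans hv (cong (λ t → height t + 1ℤ) (sym eq)) , u≤v , (λ k → ≤-refl)
        next (no  ne) = descend N hN
          where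
          descend : ∀ N → height v ≤ pos N → _
          descend zero    hN = contradiction (subst (0ℤ <_) (trans (+-comm 1ℤ (height v′)) (sym hv)) (<-≤-trans (ℤ.+<+ (s≤s z≤n)) (+-monoʳ-≤ 1ℤ (height-nonneg v′ pv′)))) (≤⇒≯ hN)
          descend (suc N) hN with cover-root N ru pu (root-neg rz) u≤v′ ne (+1-cancel-≤ (height v′) (pos N) (subst₂ _≤_ hv (+-comm 1ℤ (pos N)) hN))
          ... | z , rz′ , pz , hz , u≤z , z≤v′ = z , rz′ , pz , hz , u≤z , λ k → ≤-trans (z≤v′ k) (v′≤v k)
      -- Excluded: v would be αᵢ, and since u has a smaller coefficient at i it would be zero.
      lower N hN (inj₂ (a , b , a>0 , b>0 , eq)) = ⊥-elim (root-nonzero ru u-zero)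
        where
        v-zero : ∀ k → k ≢ i → lookup v k ≡ 0ℤ
        v-zero k ne = neg-injective (trans (sym (neg-lookup v k)) (*-zero-pos a>0 (trans (eq k) (cong -_ (trans (cong (b *_) (δ-≢ (λ e → ne (sym e)))) (*-zeroʳ b))))))
        v≡e : v ≡ e i
        v≡e = simple-multiple rv pv v-zero
        u-zero : ∀ k → lookup u k ≡ 0ℤ
        u-zero k = ≤-antisym (u≤0 k) (pu k)
          where
          u≤0 : ∀ k → lookup u k ≤ 0ℤ
          u≤0 k with k ≟F i
          ... | no ne = subst (lookup u k ≤_) (v-zero k ne) (u≤v k)
          ... | yes refl = 0≤neg⁻ (subst (0ℤ ≤_) (trans (cong (λ t → t - lookup u k - 1ℤ) (trans (cong (λ t → lookup t k) v≡e) (trans (lookup-e k k) (δ-refl k)))) (one-sub (lookup u k)))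
                             (i≤j⇒0≤j-i (0<⇒1≤ (subst (0ℤ <_) (x-k k) xi>0))))
            where
            one-sub : ∀ a → 1ℤ - a - 1ℤ ≡ - a
            one-sub = solve-∀

  height-sref : ∀ i v → height (sref C i v) ≡ height v - pairing C i v
  height-sref i v = trans (height-∑ (sref C i v)) (trans (∑-cong λ k → trans (lookup-sref i v k) (expand (lookup v k) (pairing C i v) (δ i k)))
    (trans (∑-lin 1ℤ (- pairing C i v) (lookup v) (λ k → 1ℤ * δ i k)) (trans (cong₂ (λ a b → 1ℤ * a + (- pairing C i v) * b) (sym (height-∑ v)) (∑-δ (λ _ → 1ℤ) i))
      (contract (height v) (pairing C i v)))))
    where
    expand : ∀ x p d → x - p * d ≡ 1ℤ * x + (- p) * (1ℤ * d)
    expand = solve-∀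
    contract : ∀ h p → 1ℤ * h + (- p) * 1ℤ ≡ h - p
    contract = solve-∀

  -- Choose i with positive coefficient and positive pairing; then i ∈ K, and sᵢ lowers the height
  -- while keeping the support in K. The descent stops when sᵢ v is negative, which forces v = αᵢ.
  parabolic-root : ∀ N (K : Subset r) {v} → IsRoot C v → Pos v → (∀ {k} → k ∉ K → lookup v k ≡ 0ℤ) → height v ≤ pos N →
                   ∃ λ w → ∃ λ i → WordIn C K w × i ∈ K × act C w (e i) ≡ v
  parabolic-root N K {v} rv pv sv hN with positive-pairing v pv (root-nonzero rv)
  ... | i , vi>0 , pi>0 with root-sign (root-act (i ∷ []) rv) | i ∈? K
  ...   | _      | no i∉K = contradiction (sv i∉K) (0<⇒≢0 vi>0)
  ...   | inj₂ m | yes i∈K = [] , i , [] , i∈K , sym (simple-multiple rv pv λ k ne →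
            ≤-antisym (subst (_≤ 0ℤ) (lookup-sref-≢ v (λ e → ne (sym e))) (m k)) (pv k))
  ...   | inj₁ p | yes i∈K = descend N hN
    where
    v′ : V
    v′ = sref C i v
    hv′ : height v′ + 1ℤ ≤ height v
    hv′ = subst (_≤ height v) (cong (_+ 1ℤ) (sym (height-sref i v)))
            (subst (height v - pairing C i v + 1ℤ ≤_) (cancel (height v) (pairing C i v)) (+-monoʳ-≤ (height v - pairing C i v) (0<⇒1≤ pi>0)))
      where
      cancel : ∀ a b → a - b + b ≡ a
      cancel = solve-∀
    descend : ∀ N → height v ≤ pos N → _
    descend zero    hN = contradiction (<-≤-trans (ℤ.+<+ (s≤s z≤n)) (≤-trans (+-monoˡ-≤ 1ℤ (height-nonneg v′ p)) hv′)) (≤⇒≯ hN)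
    descend (suc N) hN with parabolic-root N K (root-act (i ∷ []) rv) p (λ {k} k∉K → trans (lookup-sref-≢ v (λ { refl → k∉K i∈K })) (sv k∉K))
                              (+1-cancel-≤ (height v′) (pos N) (≤-trans hv′ (≤-trans hN (≤-reflexive (+-comm 1ℤ (pos N))))))
    ... | w , j , wK , jK , eq = i ∷ w , j , i∈K ∷ wK , jK , trans (cong (sref C i) eq) (sref-involutive diag i v)

-- Reflection factorizations

∉⇒All≢ : ∀ {A : Set} {x : A} xs → x ∉ˡ xs → All (x ≢_) xs
∉⇒All≢ []       h = []
∉⇒All≢ (y ∷ xs) h = (λ e → h (here e)) ∷ ∉⇒All≢ xs (λ m → h (there m))

All≢⇒∉ : ∀ {A : Set} {x : A} {xs} → All (x ≢_) xs → x ∉ˡ xs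
All≢⇒∉ (ne ∷ h) (here e)  = ne e
All≢⇒∉ (ne ∷ h) (there m) = All≢⇒∉ h m

-- Elimination without fractions. If the first column vanishes, the first unit vector is a solution.
-- Otherwise a pivot `a` eliminates the first unknown from the other rows, and the solution of the
-- smaller system is scaled by `a` so that the first unknown is an integer.
nonzero-solution : ∀ m (M : Fin m → Fin (suc m) → ℤ) →
                   ∃ λ (x : Fin (suc m) → ℤ) → (∃ λ l → x l ≢ 0ℤ) × ∀ j → ∑ (λ l → M j l * x l) ≡ 0ℤ
nonzero-solution zero    M = (λ _ → 1ℤ) , (zero , λ ()) , λ ()
nonzero-solution (suc m) M with any? (λ j → ¬? (M j zero ℤ.≟ 0ℤ))
... | no np = x , (zero , λ ()) , λ j → trans (cong₂ _+_ (trans (cong (_* 1ℤ) (col j)) (*-zeroˡ 1ℤ)) (trans (∑-cong {suc m} (λ l → *-zeroʳ (M j (suc l)))) (∑-zero (suc m)))) refl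
  where
  x : Fin (suc (suc m)) → ℤ
  x zero    = 1ℤ
  x (suc _) = 0ℤ
  col : ∀ j → M j zero ≡ 0ℤ
  col j with M j zero ℤ.≟ 0ℤ
  ... | yes e = e
  ... | no ne = ⊥-elim (np (j , ne))
... | yes (j , a≢0) = x , (suc l₀ , λ e → [ a≢0 , x′≢0 ]′ (i*j≡0⇒i≡0∨j≡0 a e)) , rows
  where
  a : ℤ
  a = M j zero
  M′ : Fin m → Fin (suc m) → ℤ
  M′ i l = a * M (punchIn j i) (suc l) + (- M (punchIn j i) zero) * M j (suc l)
  sol = nonzero-solution m M′
  x′ : Fin (suc m) → ℤ
  x′ = proj₁ sol
  l₀ = proj₁ (proj₁ (proj₂ sol))
  x′≢0 = proj₂ (proj₁ (proj₂ sol))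
  S : Fin (suc m) → ℤ
  S k = ∑ (λ l → M k (suc l) * x′ l)
  x : Fin (suc (suc m)) → ℤ
  x zero    = - S j
  x (suc l) = a * x′ l
  row : ∀ k → ∑ (λ l → M k l * x l) ≡ M k zero * - S j + a * S k
  row k = cong (λ t → M k zero * - S j + t) (trans (∑-cong λ l → swap (M k (suc l)) a (x′ l)) (∑-*ˡ a (λ l → M k (suc l) * x′ l)))
    where
    swap : ∀ b a c → b * (a * c) ≡ a * (b * c)
    swap = solve-∀
  elim : ∀ i → a * S (punchIn j i) + (- M (punchIn j i) zero) * S j ≡ 0ℤ
  elim i = trans (sym (∑-lin a (- M (punchIn j i) zero) (λ l → M (punchIn j i) (suc l) * x′ l) (λ l → M j (suc l) * x′ l)))
    (trans (∑-cong λ l → distrib a (M (punchIn j i) (suc l)) (- M (punchIn j i) zero) (M j (suc l)) (x′ l)) (proj₂ (proj₂ sol) i))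
    where
    distrib : ∀ a b c d x → a * (b * x) + c * (d * x) ≡ (a * b + c * d) * x
    distrib = solve-∀
  rows : ∀ k → ∑ (λ l → M k l * x l) ≡ 0ℤ
  rows k with j ≟F k
  ... | yes refl = trans (row j) (cancel a (S j))
    where
    cancel : ∀ a s → a * - s + a * s ≡ 0ℤ
    cancel = solve-∀
  ... | no j≢k = trans (row k) (trans (rearr (M k zero) (S j) (a * S k))
      (subst (λ t → a * S t + (- M t zero) * S j ≡ 0ℤ) (punchIn-punchOut j≢k) (elim (punchOut j≢k))))
    where
    rearr : ∀ b s t → b * - s + t ≡ t + (- b) * s
    rearr = solve-∀

-- A solver for identities in free groups, applied to words

module GroupSolver {r : ℕ} (C : Cartan r) (cm : IsCartanMatrix C) where

  open Action C
  open Dichotomy C cm using (diag)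

  infixr 5 _·_

  data Expr (n : ℕ) : Set where
    var : Fin n → Expr n
    _·_ : Expr n → Expr n → Expr n
    inv : Expr n → Expr n
    one : Expr n

  Normal : ℕ → Set
  Normal n = List (Fin n × Bool)

  push : ∀ {n} → Fin n → Bool → Normal n → Normal n
  push x s [] = (x , s) ∷ []
  push x s ((y , t) ∷ l) with x ≟F y | s Bool.≟ not t
  ... | yes _ | yes _ = l
  ... | _     | _     = (x , s) ∷ (y , t) ∷ l

  normalise : ∀ {n} → Expr n → Bool → Normal n → Normal n
  normalise (var x) s     l = push x s l
  normalise (e · f) true  l = normalise e true (normalise f true l)
  normalise (e · f) false l = normalise f false (normalise e false l)
  normalise (inv e) s     l = normalise e (not s) l
  normalise one     s     l = l

  module _ {n : ℕ} (ρ : Fin n → Word r) where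

    ⟦_⟧ : Expr n → Word r
    ⟦ var x ⟧ = ρ x
    ⟦ e · f ⟧ = ⟦ e ⟧ ++ ⟦ f ⟧
    ⟦ inv e ⟧ = reverse ⟦ e ⟧
    ⟦ one ⟧   = []

    signed : Bool → Word r → Word r
    signed true  w = w
    signed false w = reverse w

    ⟦_⟧ⁿ : Normal n → Word r
    ⟦ [] ⟧ⁿ = []
    ⟦ (x , s) ∷ l ⟧ⁿ = signed s (ρ x) ++ ⟦ l ⟧ⁿ

    private
      cancel-signed : ∀ t w v → act C (signed (not t) w) (act C (signed t w) v) ≡ v
      cancel-signed true  w v = act-reverse diag w v
      cancel-signed false w v = act-reverse′ diag w v

    push-sound : ∀ x s l v → act C ⟦ push x s l ⟧ⁿ v ≡ act C (signed s (ρ x)) (act C ⟦ l ⟧ⁿ v)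
    push-sound x s [] v = act-++ (signed s (ρ x)) [] v
    push-sound x s ((y , t) ∷ l) v with x ≟F y | s Bool.≟ not t
    ... | yes refl | yes refl = sym (trans (cong (act C (signed s (ρ x))) (act-++ (signed t (ρ x)) ⟦ l ⟧ⁿ v)) (cancel-signed t (ρ x) (act C ⟦ l ⟧ⁿ v)))
    ... | yes _    | no _     = act-++ (signed s (ρ x)) (signed t (ρ y) ++ ⟦ l ⟧ⁿ) v
    ... | no _     | yes _    = act-++ (signed s (ρ x)) (signed t (ρ y) ++ ⟦ l ⟧ⁿ) v
    ... | no _     | no _     = act-++ (signed s (ρ x)) (signed t (ρ y) ++ ⟦ l ⟧ⁿ) v

    normalise-sound : ∀ e s l v → act C ⟦ normalise e s l ⟧ⁿ v ≡ act C (signed s ⟦ e ⟧) (act C ⟦ l ⟧ⁿ v)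
    normalise-sound (var x) s l v = push-sound x s l v
    normalise-sound (e · f) true l v = trans (normalise-sound e true (normalise f true l) v)
      (trans (cong (act C ⟦ e ⟧) (normalise-sound f true l v)) (sym (act-++ ⟦ e ⟧ ⟦ f ⟧ (act C ⟦ l ⟧ⁿ v))))
    normalise-sound (e · f) false l v = trans (normalise-sound f false (normalise e false l) v)
      (trans (cong (act C (reverse ⟦ f ⟧)) (normalise-sound e false l v))
      (trans (sym (act-++ (reverse ⟦ f ⟧) (reverse ⟦ e ⟧) (act C ⟦ l ⟧ⁿ v))) (cong (λ t → act C t (act C ⟦ l ⟧ⁿ v)) (sym (reverse-++ ⟦ e ⟧ ⟦ f ⟧)))))
    normalise-sound (inv e) true  l v = normalise-sound e false l v
    normalise-sound (inv e) false l v = trans (normalise-sound e true l v)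
      (cong (λ t → act C t (act C ⟦ l ⟧ⁿ v)) (sym (reverse-involutive ⟦ e ⟧)))
    normalise-sound one true  l v = refl
    normalise-sound one false l v = refl

    solve : ∀ e f → normalise e true [] ≡ normalise f true [] → ⟦ e ⟧ ≋ ⟦ f ⟧
    solve e f h = mk λ v → trans (sym (normalise-sound e true [] v))
      (trans (cong (λ t → act C ⟦ t ⟧ⁿ v) h) (normalise-sound f true [] v))

-- Fixed vectors, fixed functionals and the roots of a factorization

module Factorizations {r : ℕ} (C : Cartan r) (cm : IsCartanMatrix C)
                      {n : ℕ} (roots : Vec (Vec ℤ r) n) (enum : EnumeratesΦ⁺ C roots) where

  open Action C
  open Dichotomy C cm
  open Form C cm roots enum
  open Roots C cm roots enum

  act-∉ : ∀ {k} w v → All (k ≢_) w → lookup (act C w v) k ≡ lookup v k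
  act-∉ []      v []       = refl
  act-∉ (i ∷ w) v (ne ∷ h) = trans (lookup-sref-≢ (act C w v) (λ e → ne (sym e))) (act-∉ w v h)

  -- Letters are distinct, so only the leading sᵢ can change coordinate i. As x is fixed that change
  -- is zero; then sᵢ acts trivially and the rest of the word fixes x as well.
  fixed-vector : ∀ w → Unique w → ∀ x → act C w x ≡ x → ∀ {i} → i ∈ˡ w → pairing C i x ≡ 0ℤ
  fixed-vector (i ∷ w) (i∉w ∷ u) x eq = λ
    { (here refl) → trans (cong (pairing C i) (sym y≡x)) pairing-y
    ; (there m)   → fixed-vector w u x y≡x m }
    where
    y = act C w x
    pairing-y : pairing C i y ≡ 0ℤ
    pairing-y = neg-injective (+-cancelˡ (lookup y i) (- pairing C i y) 0ℤ (trans (sym (lookup-sref-≡ i y))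
      (trans (cong (λ t → lookup t i) eq) (trans (sym (act-∉ w x i∉w)) (sym (+-identityʳ (lookup y i)))))))
      where
      +-cancelˡ : ∀ a b c → a + b ≡ a + c → b ≡ c
      +-cancelˡ a b c h = trans (split a b) (trans (cong (λ t → - a + t) h) (sym (split a c)))
        where
        split : ∀ a b → b ≡ - a + (a + b)
        split = solve-∀
    y≡x : y ≡ x
    y≡x = trans (sym (sref-fix i y pairing-y)) eq

  ◁*-cong : ∀ w {f g : Functional} → (∀ k → f k ≡ g k) → ∀ k → (f ◁* w) k ≡ (g ◁* w) k
  ◁*-cong []      h = h
  ◁*-cong (i ∷ w) h = ◁*-cong w λ k → cong₂ (λ a b → a - b * C i k) (h k) (h i)

  ◁*-displacement : ∀ w f → ∃ λ (y : Functional) → (∀ {k} → All (k ≢_) w → y k ≡ 0ℤ) ×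
                    ∀ j → (f ◁* w) j ≡ f j - ∑ (λ l → y l * C l j)
  ◁*-displacement [] f = (λ _ → 0ℤ) , (λ _ → refl) , λ j → sym (trans (cong (λ t → f j - t) (trans (∑-cong {r} (λ l → *-zeroˡ (C l j))) (∑-zero r))) (+-identityʳ (f j)))
  ◁*-displacement (i ∷ w) f with ◁*-displacement w (f ◁ i)
  ... | y , y0 , eq = (λ l → 1ℤ * y l + f i * δ i l)
      , (λ { {k} (ne ∷ h) → trans (cong₂ (λ a b → 1ℤ * a + f i * b) (y0 h) (δ-≢ (λ e → ne (sym e)))) (trans (+-identityˡ (f i * 0ℤ)) (*-zeroʳ (f i))) })
      , λ j → trans (eq j) (trans (regroup (f j) (f i * C i j) (∑ (λ l → y l * C l j)))
          (cong (λ t → f j - t) (sym (trans (∑-cong λ l → expand (y l) (f i) (δ i l) (C l j)) (trans (∑-lin 1ℤ (f i) (λ l → y l * C l j) (λ l → C l j * δ i l)) (cong (λ t → 1ℤ * ∑ (λ l → y l * C l j) + f i * t) (∑-δ (λ l → C l j) i)))))))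
    where
    regroup : ∀ a b s → a - b - s ≡ a - (1ℤ * s + b)
    regroup = solve-∀
    expand : ∀ y a d c → (1ℤ * y + a * d) * c ≡ 1ℤ * (y * c) + a * (c * d)
    expand = solve-∀

  -- The difference f ∘ w - f is a combination of the coroots of the letters. The leading letter i
  -- occurs once, so Cᵢ has coefficient f(αᵢ) up to sign, which vanishes by `coroots-independent`.
  -- Then f ∘ sᵢ = f, and the rest of the word fixes f.
  fixed-functional : ∀ w → Unique w → ∀ f → (∀ k → (f ◁* w) k ≡ f k) → ∀ {i} → i ∈ˡ w → f i ≡ 0ℤ
  fixed-functional (i ∷ w) (i∉w ∷ u) f eq with ◁*-displacement w (f ◁ i)
  ... | y , y0 , disp = λ { (here refl) → fi ; (there m) → fixed-functional w u f fixed m }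
    where
    regroup : ∀ a b s → a - (a - b - s) ≡ 1ℤ * s + b * 1ℤ
    regroup = solve-∀
    expand : ∀ y a d c → (1ℤ * y + a * d) * c ≡ 1ℤ * (y * c) + a * (c * d)
    expand = solve-∀
    zero-comb : ∀ j → ∑ (λ l → (1ℤ * y l + f i * δ i l) * C l j) ≡ 0ℤ
    zero-comb j = begin
      ∑ (λ l → (1ℤ * y l + f i * δ i l) * C l j) ≡⟨ ∑-cong (λ l → expand (y l) (f i) (δ i l) (C l j)) ⟩
      ∑ (λ l → 1ℤ * (y l * C l j) + f i * (C l j * δ i l)) ≡⟨ ∑-lin 1ℤ (f i) (λ l → y l * C l j) (λ l → C l j * δ i l) ⟩
      1ℤ * s + f i * ∑ (λ l → C l j * δ i l) ≡⟨ cong (λ t → 1ℤ * s + f i * t) (∑-δ (λ l → C l j) i) ⟩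
      1ℤ * s + f i * C i j ≡⟨ cong (λ t → 1ℤ * s + t) (sym (*-identityʳ (f i * C i j))) ⟩
      1ℤ * s + f i * C i j * 1ℤ ≡⟨ sym (regroup (f j) (f i * C i j) s) ⟩
      f j - (f j - f i * C i j - s) ≡⟨ cong (λ t → f j - t) (trans (sym (disp j)) (eq j)) ⟩
      f j - f j ≡⟨ +-inverseʳ (f j) ⟩
      0ℤ ∎
      where
      open ≡-Reasoning
      s = ∑ (λ l → y l * C l j)
    fi : f i ≡ 0ℤ
    fi = begin
      f i ≡⟨ sym (+-identityˡ (f i)) ⟩
      0ℤ + f i ≡⟨ cong₂ _+_ (sym (trans (*-identityˡ (y i)) (y0 i∉w))) (sym (trans (cong (f i *_) (δ-refl i)) (*-identityʳ (f i)))) ⟩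
      1ℤ * y i + f i * δ i i ≡⟨ coroots-independent (λ l → 1ℤ * y l + f i * δ i l) zero-comb i ⟩
      0ℤ ∎
      where open ≡-Reasoning
    fixed : ∀ k → (f ◁* w) k ≡ f k
    fixed k = trans (◁*-cong w (λ k → sym (trans (cong (λ t → f k - t * C i k) fi) (trans (cong (λ t → f k - t) (*-zeroˡ (C i k))) (+-identityʳ (f k))))) k) (eq k)

  reflection-root : ∀ J t → IsReflection C J t → V
  reflection-root J t (w , i , _) = act C w (e i)

  factor-root : ∀ {J ts} → All (IsReflection C J) ts → Fin (length ts) → V
  factor-root {J} {t ∷ ts} (h ∷ hs) zero    = reflection-root J t h
  factor-root {J} {t ∷ ts} (h ∷ hs) (suc j) = factor-root hs j

  Fixes : Functional → Word r → Set
  Fixes f w = ∀ v → dot f (act C w v) ≡ dot f v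

  fixes-reflection : ∀ J t f (h : IsReflection C J t) → dot f (reflection-root J t h) ≡ 0ℤ → Fixes f t
  fixes-reflection J t f (w , i , _ , _ , eq) z v = begin
    dot f (act C t v) ≡⟨ cong (dot f) (trans (at (≈⇒≋ {t} {reflection w i} eq) v) (act-reflection w i v)) ⟩
    dot f (v ⊕ (- dot (coroot w i) v) ⊙ act C w (e i)) ≡⟨ dot-⊕ f v ((- dot (coroot w i) v) ⊙ act C w (e i)) ⟩
    dot f v + dot f ((- dot (coroot w i) v) ⊙ act C w (e i)) ≡⟨ cong (λ t → dot f v + t) (trans (dot-⊙ f (- dot (coroot w i) v) (act C w (e i))) (trans (cong ((- dot (coroot w i) v) *_) z) (*-zeroʳ (- dot (coroot w i) v)))) ⟩
    dot f v + 0ℤ ≡⟨ +-identityʳ (dot f v) ⟩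
    dot f v ∎
    where open ≡-Reasoning

  fixes-concat : ∀ {J ts} f (h : All (IsReflection C J) ts) → (∀ j → dot f (factor-root h j) ≡ 0ℤ) → Fixes f (concat ts)
  fixes-concat f [] z v = refl
  fixes-concat {J} {t ∷ ts} f (h ∷ hs) z v = trans (cong (dot f) (act-++ t (concat ts) v))
    (trans (fixes-reflection J t f h (z zero) (act C (concat ts) v)) (fixes-concat f hs (λ j → z (suc j)) v))

  -- The functionals killing all roots of the factorization are fixed by the product, hence kill every
  -- simple root of w; counting dimensions, a k-th coordinate function with k ∉ w must kill the roots.
  factor-root-support : ∀ {J ts} w → Unique w → (h : All (IsReflection C J) ts) → length ts ℕ.≤ length w →
    concat ts ≋ w → ∀ {k} → All (k ≢_) w → ∀ j → lookup (factor-root h j) k ≡ 0ℤ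
  factor-root-support {J} {ts} w u h len eq {k} k∉w j =
    [ (λ e → contradiction e x₀≢0) , (λ e → e) ]′ (i*j≡0⇒i≡0∨j≡0 (x zero) (trans (sym (f-dot j)) (f-root j)))
    where
    m = length ts
    -- The coordinate k together with the first m letters of w: m + 1 distinct coordinates against
    -- the m roots of the factorization, so a nonzero combination f of them kills all these roots.
    -- As f vanishes on the letters of w, only the coefficient at k is left.
    S : Fin (suc m) → Fin r
    S zero    = k
    S (suc l) = List.lookup w (inject≤ l len)
    S-suc≢k : ∀ l → S (suc l) ≢ k
    S-suc≢k l e = All.lookup k∉w (∈-lookup (inject≤ l len)) (sym e)
    lookup-injective : ∀ {w} → Unique w → ∀ {a b} → List.lookup {A = Fin r} w a ≡ List.lookup w b → a ≡ b
    lookup-injective (ne ∷ u) {zero} {zero} e = refl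
    lookup-injective {i ∷ w} (ne ∷ u) {zero} {suc b} e = contradiction e (All.lookup ne (∈-lookup b))
    lookup-injective {i ∷ w} (ne ∷ u) {suc a} {zero} e = contradiction (sym e) (All.lookup ne (∈-lookup a))
    lookup-injective (ne ∷ u) {suc a} {suc b} e = cong suc (lookup-injective u e)
    S-injective : ∀ {a b} → S a ≡ S b → a ≡ b
    S-injective {zero}  {zero}  e = refl
    S-injective {zero}  {suc b} e = contradiction (sym e) (S-suc≢k b)
    S-injective {suc a} {zero}  e = contradiction e (S-suc≢k a)
    S-injective {suc a} {suc b} e = cong suc (inject≤-injective len len a b (lookup-injective u e))
    sol = nonzero-solution m (λ j l → lookup (factor-root h j) (S l))
    x : Fin (suc m) → ℤ
    x = proj₁ sol
    f : Functional
    f i = ∑ (λ l → x l * δ (S l) i)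
    f-root : ∀ j → dot f (factor-root h j) ≡ 0ℤ
    f-root j = trans (dot-∑ x (λ l → δ (S l)) (factor-root h j))
      (trans (∑-cong λ l → trans (cong (x l *_) (dot-δ (factor-root h j) (S l))) (*-comm (x l) (lookup (factor-root h j) (S l)))) (proj₂ (proj₂ sol) j))
    f-S : ∀ l → f (S l) ≡ x l
    f-S l = trans (∑-cong λ a → cong (x a *_) (δ-S a)) (∑-δ x l)
      where
      δ-S : ∀ a → δ (S a) (S l) ≡ δ l a
      δ-S a with a ≟F l
      ... | yes refl = δ-refl (S a)
      ... | no ne    = δ-≢ λ e → ne (S-injective e)
    f-w : ∀ {i} → i ∈ˡ w → f i ≡ 0ℤ
    f-w = fixed-functional w u f (dot-ext {f = f ◁* w} {f} λ v → trans (sym (dot-act f w v)) (trans (cong (dot f) (sym (at eq v))) (fixes-concat f h f-root v)))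
    x-suc : ∀ l → x (suc l) ≡ 0ℤ
    x-suc l = trans (sym (f-S (suc l))) (f-w (∈-lookup (inject≤ l len)))
    x₀≢0 : x zero ≢ 0ℤ
    x₀≢0 e = proj₂ (proj₁ (proj₂ sol)) (all-zero (proj₁ (proj₁ (proj₂ sol))))
      where
      all-zero : ∀ l → x l ≡ 0ℤ
      all-zero zero    = e
      all-zero (suc l) = x-suc l
    f-dot : ∀ j → dot f (factor-root h j) ≡ x zero * lookup (factor-root h j) k
    f-dot j = trans (dot-∑ x (λ l → δ (S l)) v)
      (trans (cong₂ _+_ (cong (x zero *_) (dot-δ v k)) (trans (∑-cong {m} λ l → trans (cong (_* dot (δ (S (suc l))) v) (x-suc l)) (*-zeroˡ (dot (δ (S (suc l))) v))) (∑-zero m))) (+-identityʳ (x zero * lookup v k)))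
      where v = factor-root h j

-- The bipartite Coxeter element

∈-cX⁺ : ∀ {r} {X : Subset r} {i} → i ∈ X → i ∈ˡ cX X
∈-cX⁺ {r} {X} {i} h = ∈-filter⁺ (T? ∘ lookup X) (∈-allFin i) (Equivalence.from T-≡ ([]=⇒lookup h))

∈-cX⁻ : ∀ {r} {X : Subset r} {i} → i ∈ˡ cX X → i ∈ X
∈-cX⁻ {r} {X} {i} h = lookup⇒[]= i X (Equivalence.to T-≡ (proj₂ (∈-filter⁻ (T? ∘ lookup X) {xs = allFin r} h)))

cX-unique : ∀ {r} (X : Subset r) → Unique (cX X)
cX-unique {r} X = Uniqueₚ.filter⁺ (T? ∘ lookup X) (Uniqueₚ.allFin⁺ r)

module Coxeter {r : ℕ} (C : Cartan r) (cm : IsCartanMatrix C)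
               {n : ℕ} (roots : Vec (Vec ℤ r) n) (enum : EnumeratesΦ⁺ C roots) where

  open Action C
  open Dichotomy C cm
  open Form C cm roots enum
  open Roots C cm roots enum
  open Factorizations C cm roots enum
  open GroupSolver C cm

  -- As w sᵢ sends αᵢ to -wαᵢ, this says that opposite roots have the same reflection. The solver
  -- knows only free cancellation; sᵢ² = 1 becomes available because `reverse (i ∷ [])` computes to
  -- `i ∷ []`, so a letter may be entered as its own inverse.
  inverse-root : ∀ w i → reflection (w ++ i ∷ []) i ≋ reflection w i
  inverse-root w i = ≋-trans (≡⇒≋ (cong (λ t → (w ++ i ∷ []) ++ i ∷ t) (reverse-++ w (i ∷ []))))
    (solve ρ ((var zero · var (suc zero)) · (var (suc zero) · (inv (var (suc zero)) · inv (var zero))))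
             (var zero · (var (suc zero) · inv (var zero))) refl)
    where
    ρ : Fin 2 → Word r
    ρ zero       = w
    ρ (suc zero) = i ∷ []

  act-support : ∀ {J : Subset r} w v → WordIn C J w → (∀ {k} → k ∉ J → lookup v k ≡ 0ℤ) → ∀ {k} → k ∉ J → lookup (act C w v) k ≡ 0ℤ
  act-support w v wJ h k∉J = trans (act-∉ w v (All.map (λ { i∈J refl → k∉J i∈J }) wJ)) (h k∉J)

  e-support : ∀ {J : Subset r} {i} → i ∈ J → ∀ {k} → k ∉ J → lookup (e i) k ≡ 0ℤ
  e-support {i = i} i∈J {k} k∉J = trans (lookup-e i k) (δ-≢ λ { refl → k∉J i∈J })

  height-bound : ∀ v → Pos v → height v ≤ pos ∣ height v ∣
  height-bound v p = ≤-reflexive (sym (0≤i⇒+∣i∣≡i (height-nonneg v p)))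

  -- Up to sign the root of t is positive and supported in K, so it is conjugate under W_K to a
  -- simple root of K. The root determines the reflection, so the conjugating word may be replaced
  -- by one in K.
  restrict-reflection : ∀ {J} K t (h : IsReflection C J t) → (∀ {k} → k ∉ K → lookup (reflection-root J t h) k ≡ 0ℤ) →
                        IsReflection C K t
  restrict-reflection K t (w , i , _ , _ , eq) supp with root-sign (w , i , refl)
  ... | inj₁ p with parabolic-root _ K (w , i , refl) p supp (height-bound (act C w (e i)) p)
  ...   | w′ , i′ , wK , iK , eq′ = w′ , i′ , wK , iK ,
    ≋⇒≈ {t} {reflection w′ i′} (≋-trans (≈⇒≋ {t} {reflection w i} eq) (reflection-unique w i w′ i′ (sym eq′)))
  restrict-reflection K t (w , i , _ , _ , eq) supp | inj₂ m
    with parabolic-root _ K (w ++ i ∷ [] , i , refl) p′ (λ k∉K → trans (cong (λ v → lookup v _) (act-neg w i)) (trans (neg-lookup (act C w (e i)) _) (cong -_ (supp k∉K)))) (height-bound (act C (w ++ i ∷ []) (e i)) p′)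
    where
    p′ : Pos (act C (w ++ i ∷ []) (e i))
    p′ = subst Pos (sym (act-neg w i)) (Pos-neg {v = act C w (e i)} m)
  ... | w′ , i′ , wK , iK , eq′ = w′ , i′ , wK , iK ,
    ≋⇒≈ {t} {reflection w′ i′} (≋-trans (≈⇒≋ {t} {reflection w i} eq) (≋-trans (≋-sym (inverse-root w i)) (reflection-unique (w ++ i ∷ []) i w′ i′ (sym eq′))))

  restrict-all : ∀ {J} K ts (h : All (IsReflection C J) ts) → (∀ {k} → k ∉ K → ∀ j → lookup (factor-root h j) k ≡ 0ℤ) →
                 All (IsReflection C K) ts
  restrict-all K []       []       supp = []
  restrict-all K (t ∷ ts) (h ∷ hs) supp = restrict-reflection K t h (λ k∉K → supp k∉K zero) ∷ restrict-all K ts hs (λ k∉K j → supp k∉K (suc j))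

  restrict-factorization : ∀ {J} K w → Unique w → (∀ {k} → k ∈ˡ w → k ∈ K) → ∀ ts → All (IsReflection C J) ts →
                           length ts ℕ.≤ length w → concat ts ≋ w → All (IsReflection C K) ts
  restrict-factorization K w u w⊆K ts h len eq =
    restrict-all K ts h λ k∉K → factor-root-support w u h len eq (∉⇒All≢ w λ m → k∉K (w⊆K m))

  IsReflection-⊆ : ∀ {K J} → K ⊆ J → ∀ {t} → IsReflection C K t → IsReflection C J t
  IsReflection-⊆ K⊆J (w , i , wK , iK , eq) = w , i , All.map K⊆J wK , K⊆J iK , eq

  simple-reflection : ∀ {J i} → i ∈ J → IsReflection C J (i ∷ [])
  simple-reflection iJ = [] , _ , [] , iJ , λ j → refl

  conj : Word r → Word r → Word r
  conj g w = g ++ w ++ reverse g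

  conj-reflection : ∀ {J g t} → WordIn C J g → IsReflection C J t → IsReflection C J (conj g t)
  conj-reflection {J} {g} {t} gJ (w , i , wJ , iJ , eq) = g ++ w , i , Allₚ.++⁺ gJ wJ , iJ ,
    ≋⇒≈ {conj g t} {reflection (g ++ w) i} (≋-trans (++-cong (≋-refl {g}) (++-cong (≈⇒≋ {t} {reflection w i} eq) (≋-refl {reverse g})))
      (solve ρ (var zero · (var (suc zero) · (var (suc (suc zero)) · inv (var (suc zero)))) · inv (var zero))
               ((var zero · var (suc zero)) · (var (suc (suc zero)) · inv (var zero · var (suc zero)))) refl))
    where
    ρ : Fin 3 → Word r
    ρ zero             = g
    ρ (suc zero)       = w
    ρ (suc (suc zero)) = i ∷ []

  conj-concat : ∀ g ts → concat (map (conj g) ts) ≋ conj g (concat ts)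
  conj-concat g [] = mk λ v → sym (trans (act-++ g (reverse g) v) (act-reverse′ diag g v))
  conj-concat g (t ∷ ts) = ≋-trans (++-cong (≋-refl {conj g t}) (conj-concat g ts))
    (solve ρ ((var zero · (var (suc zero) · inv (var zero))) · (var zero · (var (suc (suc zero)) · inv (var zero))))
             (var zero · ((var (suc zero) · var (suc (suc zero))) · inv (var zero))) refl)
    where
    ρ : Fin 3 → Word r
    ρ zero             = g
    ρ (suc zero)       = t
    ρ (suc (suc zero)) = concat ts

  conj-all : ∀ {J g ts} → WordIn C J g → All (IsReflection C J) ts → All (IsReflection C J) (map (conj g) ts)
  conj-all gJ [] = []
  conj-all {J} {g} {t ∷ ts} gJ (h ∷ hs) = conj-reflection {J} {g} {t} gJ h ∷ conj-all gJ hs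

  word-reflections : ∀ {J} w → WordIn C J w → All (IsReflection C J) (map (λ i → i ∷ []) w)
  word-reflections []      []       = []
  word-reflections (i ∷ w) (h ∷ hs) = simple-reflection h ∷ word-reflections w hs

  concat-letters : ∀ (w : Word r) → concat (map (λ i → i ∷ []) w) ≡ w
  concat-letters []      = refl
  concat-letters (i ∷ w) = cong (i ∷_) (concat-letters w)

  Minimal : Subset r → Word r → ℕ → Set
  Minimal J c k = ∀ m → m ℕ.< k → ¬ ReflFact C J c m

  -- Cutting a shortest factorization of c into two pieces puts the first below c: a shorter
  -- factorization of either piece would shorten that of c.
  NC-intro : ∀ K c z ts ts′ → All (IsReflection C K) ts → All (IsReflection C K) ts′ →
             concat ts ≋ z → concat ts′ ≋ reverse z ++ c → Minimal K c (length ts ℕ.+ length ts′) → NC C K c z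
  NC-intro K c z ts ts′ h h′ eq eq′ min =
      (0 , length ts , (([] , refl , [] , λ j → refl) , λ m ()) , lenZ , lenZ)
    , (length ts , length ts′ , lenZ , lenZc , lenC)
    where
    product : ∀ us us′ → concat us ≋ z → concat us′ ≋ reverse z ++ c → concat (us ++ us′) ≋ c
    product us us′ p q = ≋-trans (≡⇒≋ (sym (concat-++ us us′))) (≋-trans (++-cong p q)
      (mk λ v → trans (act-++ z (reverse z ++ c) v) (trans (cong (act C z) (act-++ (reverse z) c v)) (act-reverse′ diag z (act C c v)))))
    lenZ : AbsLength C K z (length ts)
    lenZ = (ts , refl , h , ≋⇒≈ {concat ts} {z} eq) , λ { m m< (us , refl , g , p) →
      min (length us ℕ.+ length ts′) (ℕₚ.+-monoˡ-< (length ts′) m<)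
          (us ++ ts′ , length-++ us , Allₚ.++⁺ g h′ , ≋⇒≈ {concat (us ++ ts′)} {c} (product us ts′ (≈⇒≋ {concat us} {z} p) eq′)) }
    lenZc : AbsLength C K (reverse z ++ c) (length ts′)
    lenZc = (ts′ , refl , h′ , ≋⇒≈ {concat ts′} {reverse z ++ c} eq′) , λ { m m< (us , refl , g , p) →
      min (length ts ℕ.+ length us) (ℕₚ.+-monoʳ-< (length ts) m<)
          (ts ++ us , length-++ ts , Allₚ.++⁺ h g , ≋⇒≈ {concat (ts ++ us)} {c} (product ts us eq (≈⇒≋ {concat us} {reverse z ++ c} p))) }
    lenC : AbsLength C K c (length ts ℕ.+ length ts′)
    lenC = (ts ++ ts′ , length-++ ts , Allₚ.++⁺ h h′ , ≋⇒≈ {concat (ts ++ ts′)} {c} (product ts ts′ eq eq′)) , min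

  Commuting : Subset r → Set
  Commuting S = ∀ {i j} → i ∈ S → j ∈ S → i ≢ j → C i j ≡ 0ℤ

  pairing-commuting : ∀ {S} → Commuting S → ∀ w → WordIn C S w → ∀ {k} → k ∈ S → All (k ≢_) w → ∀ v →
                      pairing C k (act C w v) ≡ pairing C k v
  pairing-commuting cS [] [] kS [] v = refl
  pairing-commuting cS (i ∷ w) (iS ∷ wS) {k} kS (k≢i ∷ k∉w) v = begin
    pairing C k (sref C i u) ≡⟨ dot-sref (C k) i u ⟩
    dot (C k ◁ i) u ≡⟨ dot-cong (λ j → trans (cong (λ t → C k j - t * C i j) (cS kS iS k≢i)) (trans (cong (λ t → C k j - t) (*-zeroˡ (C i j))) (+-identityʳ (C k j)))) u ⟩
    pairing C k u ≡⟨ pairing-commuting cS w wS kS k∉w v ⟩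
    pairing C k v ∎
    where
    open ≡-Reasoning
    u = act C w v

  act-commuting : ∀ {S} → Commuting S → ∀ w → WordIn C S w → Unique w → ∀ v {k} → k ∈ˡ w →
                  lookup (act C w v) k ≡ lookup v k - pairing C k v
  act-commuting cS (i ∷ w) (iS ∷ wS) (i∉w ∷ u) v (here refl) = trans (lookup-sref-≡ i (act C w v))
    (cong₂ _-_ (act-∉ w v i∉w) (pairing-commuting cS w wS iS i∉w v))
  act-commuting cS (i ∷ w) (iS ∷ wS) (i∉w ∷ u) v {k} (there m) = trans (lookup-sref-≢ (act C w v) (All.lookup i∉w m))
    (act-commuting cS w wS u v m)

  commuting-≋ : ∀ {S} → Commuting S → ∀ w w′ → WordIn C S w → WordIn C S w′ → Unique w → Unique w′ →
                (∀ {k} → k ∈ˡ w → k ∈ˡ w′) → (∀ {k} → k ∈ˡ w′ → k ∈ˡ w) → w ≋ w′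
  commuting-≋ {S} cS w w′ wS wS′ u u′ to from = mk λ v → vec-ext λ k → same v k
    where
    open import Data.List.Membership.DecPropositional (_≟F_ {r}) using () renaming (_∈?_ to _∈ˡ?_)
    same : ∀ v k → lookup (act C w v) k ≡ lookup (act C w′ v) k
    same v k with k ∈ˡ? w
    ... | yes m = trans (act-commuting cS w wS u v m) (sym (act-commuting cS w′ wS′ u′ v (to m)))
    ... | no  m = trans (act-∉ w v (∉⇒All≢ w m)) (sym (act-∉ w′ v (∉⇒All≢ w′ λ m′ → m (from m′))))

  fix-simple : ∀ {S} → Commuting S → ∀ w → WordIn C S w → ∀ {i} → i ∈ S → All (i ≢_) w → act C w (e i) ≡ e i
  fix-simple cS [] [] iS [] = refl
  fix-simple cS (j ∷ w) (jS ∷ wS) {i} iS (i≢j ∷ i∉w) = trans (cong (sref C j) (fix-simple cS w wS iS i∉w))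
    (sref-fix j (e i) (trans (pairing-e j i) (cS jS iS λ e → i≢j (sym e))))

  -- Some letter i of w makes the sign turn. Since sᵢ changes coordinate i alone, a positive root
  -- that it makes negative is supported on i, hence equal to αᵢ.
  turning : ∀ w {γ} → IsRoot C γ → Pos γ → Neg (act C w γ) → ∃ λ u → ∃ λ i → ∃ λ v → w ≡ u ++ i ∷ v × act C v γ ≡ e i
  turning [] rγ p m = ⊥-elim (root-nonzero rγ λ k → ≤-antisym (m k) (p k))
  turning (i ∷ w) {γ} rγ p m with root-sign (root-act w rγ)
  ... | inj₂ m′ = let (u , j , v , eq , h) = turning w rγ p m′ in i ∷ u , j , v , cong (i ∷_) eq , h
  ... | inj₁ p′ = [] , i , w , refl , simple-multiple (root-act w rγ) p′ λ k ne →
    ≤-antisym (subst (_≤ 0ℤ) (lookup-sref-≢ (act C w γ) (λ e → ne (sym e))) (m k)) (p′ k)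

  iterate : Word r → ℕ → V → V
  iterate c zero    v = v
  iterate c (suc k) v = act C c (iterate c k v)

  orbit-sum : Word r → ℕ → V → V
  orbit-sum c zero    v = 0ℤ ⊙ v
  orbit-sum c (suc m) v = iterate c m v ⊕ orbit-sum c m v

  orbit-sum-shift : ∀ c m v k → lookup (act C c (orbit-sum c m v)) k + lookup v k ≡ lookup (orbit-sum c m v) k + lookup (iterate c m v) k
  orbit-sum-shift c zero v k = cong (_+ lookup v k) (trans (cong (λ t → lookup t k) (act-⊙ c 0ℤ v)) (trans (lookup-⊙ 0ℤ (act C c v) k) (sym (lookup-⊙ 0ℤ v k))))
  orbit-sum-shift c (suc m) v k = trans (cong (_+ lookup v k) (trans (cong (λ t → lookup t k) (act-⊕ c (iterate c m v) (orbit-sum c m v))) (lookup-⊕ (iterate c (suc m) v) (act C c (orbit-sum c m v)) k)))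
    (trans (left (lookup (iterate c (suc m) v) k) (lookup (act C c (orbit-sum c m v)) k) (lookup v k))
    (trans (cong (λ t → lookup (iterate c (suc m) v) k + t) (orbit-sum-shift c m v k))
    (trans (right (lookup (iterate c (suc m) v) k) (lookup (orbit-sum c m v) k) (lookup (iterate c m v) k))
      (cong (_+ lookup (iterate c (suc m) v) k) (sym (lookup-⊕ (iterate c m v) (orbit-sum c m v) k))))))
    where
    left : ∀ a b c → a + b + c ≡ a + (b + c)
    left = solve-∀
    right : ∀ a b c → a + (b + c) ≡ c + b + a
    right = solve-∀

  orbit-sum-pos : ∀ c m v → (∀ k → k ℕ.< m → Pos (iterate c k v)) → Pos (orbit-sum c m v)
  orbit-sum-pos c zero    v h k = subst (0ℤ ≤_) (sym (lookup-⊙ 0ℤ v k)) (≤-reflexive (sym (*-zeroˡ (lookup v k))))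
  orbit-sum-pos c (suc m) v h k = subst (0ℤ ≤_) (sym (lookup-⊕ (iterate c m v) (orbit-sum c m v) k))
    (0≤+⇒ (h m ℕₚ.≤-refl k) (orbit-sum-pos c m v (λ k k<m → h k (ℕₚ.m≤n⇒m≤1+n k<m)) k))

  iterate-root : ∀ c m {v} → IsRoot C v → IsRoot C (iterate c m v)
  iterate-root c zero    rv = rv
  iterate-root c (suc m) rv = root-act c (iterate-root c m rv)

  orbit-sum-root : ∀ c m v → IsRoot C v → (∀ k → k ℕ.< suc m → Pos (iterate c k v)) → ¬ (∀ k → lookup (orbit-sum c (suc m) v) k ≡ 0ℤ)
  orbit-sum-root c m v rv h z = root-nonzero (iterate-root c m rv) λ k → ≤-antisym
      (subst (lookup (iterate c m v) k ≤_) (z k) (subst (lookup (iterate c m v) k ≤_) (sym (lookup-⊕ (iterate c m v) (orbit-sum c m v) k))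
        (subst (_≤ lookup (iterate c m v) k + lookup (orbit-sum c m v) k) (+-identityʳ (lookup (iterate c m v) k))
          (+-monoʳ-≤ (lookup (iterate c m v) k) (orbit-sum-pos c m v (λ k k<m → h k (ℕₚ.m≤n⇒m≤1+n k<m)) k)))))
      (h m ℕₚ.≤-refl k)

  iterate-+ : ∀ c a b v → iterate c (a ℕ.+ b) v ≡ iterate c a (iterate c b v)
  iterate-+ c zero    b v = refl
  iterate-+ c (suc a) b v = cong (act C c) (iterate-+ c a b v)

  iterate-support : ∀ {J : Subset r} c m v → WordIn C J c → (∀ {k} → k ∉ J → lookup v k ≡ 0ℤ) → ∀ {k} → k ∉ J → lookup (iterate c m v) k ≡ 0ℤ
  iterate-support c zero    v cJ h = h
  iterate-support c (suc m) v cJ h = act-support c (iterate c m v) cJ (iterate-support c m v cJ h)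

  -- A nonzero nonnegative x would pair positively with the coroot of some αᵢ in its support,
  -- whereas `fixed-vector` makes that pairing zero.
  fixed-positive-zero : ∀ {J : Subset r} c → Unique c → (∀ {i} → i ∈ J → i ∈ˡ c) → ∀ x → Pos x → (∀ {k} → k ∉ J → lookup x k ≡ 0ℤ) →
                        act C c x ≡ x → ∀ k → lookup x k ≡ 0ℤ
  fixed-positive-zero {J} c u J⊆c x px sx fx k with lookup x k ℤ.≟ 0ℤ
  ... | yes e = e
  ... | no ne with positive-pairing x px (λ z → ne (z k))
  ...   | i , xi>0 , pi>0 with i ∈? J
  ...     | no i∉J  = contradiction (sx i∉J) (0<⇒≢0 xi>0)
  ...     | yes i∈J = contradiction (fixed-vector c u x fx (J⊆c i∈J)) (0<⇒≢0 pi>0)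

  -- If the n + 1 iterates with exponents 0 to n were all positive, two of them would coincide, as
  -- there are only n positive roots. The sum over the period between them would be nonnegative,
  -- nonzero and fixed by c.
  orbit-turns : ∀ {J : Subset r} c → Unique c → WordIn C J c → (∀ {i} → i ∈ J → i ∈ˡ c) → ∀ {v} → IsRoot C v → Pos v →
                (∀ {k} → k ∉ J → lookup v k ≡ 0ℤ) → ∃ λ k → Pos (iterate c k v) × Neg (act C c (iterate c k v))
  orbit-turns {J} c u cJ J⊆c {v} rv pv sv with search n
    where
    search : ∀ N → (∃ λ k → Pos (iterate c k v) × Neg (act C c (iterate c k v))) ⊎ (∀ k → k ℕ.≤ N → Pos (iterate c k v))
    search zero = inj₂ λ { zero z≤n → pv }
    search (suc N) with search N
    ... | inj₁ t = inj₁ t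
    ... | inj₂ all with root-sign (iterate-root c (suc N) rv)
    ...   | inj₂ m = inj₁ (N , all N ℕₚ.≤-refl , m)
    ...   | inj₁ p = inj₂ λ k k≤ → case (ℕₚ.m≤n⇒m<n∨m≡n k≤)
      where
      case : ∀ {k} → k ℕ.< suc N ⊎ k ≡ suc N → Pos (iterate c k v)
      case (inj₁ l)    = all _ (ℕ.s≤s⁻¹ l)
      case (inj₂ refl) = p
  ... | inj₁ t = t
  ... | inj₂ all = ⊥-elim (contra (pigeonhole (ℕₚ.n<1+n n) (λ k → proj₁ (idx k))))
    where
    idx : ∀ (k : Fin (suc n)) → ∃ λ p → β p ≡ iterate c (toℕ k) v
    idx k = index (iterate-root c (toℕ k) rv) (all (toℕ k) (ℕ.s≤s⁻¹ (toℕ<n k)))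
    contra : ¬ (∃ λ i → ∃ λ j → i Data.Fin.< j × proj₁ (idx i) ≡ proj₁ (idx j))
    contra (i , j , i<j , eq) with ℕₚ.m≤n⇒∃[o]m+o≡n i<j
    ... | m , i+m = orbit-sum-root c m u₀ ru pos-u (fixed-positive-zero c u J⊆c x px sx fx)
      where
      j≡ : suc m ℕ.+ toℕ i ≡ toℕ j
      j≡ = trans (cong suc (ℕₚ.+-comm m (toℕ i))) i+m
      u₀ : V
      u₀ = iterate c (toℕ i) v
      ru : IsRoot C u₀
      ru = iterate-root c (toℕ i) rv
      periodic : iterate c (suc m) u₀ ≡ u₀
      periodic = trans (sym (iterate-+ c (suc m) (toℕ i) v)) (trans (cong (λ t → iterate c t v) j≡)
        (trans (sym (proj₂ (idx j))) (trans (cong β (sym eq)) (proj₂ (idx i)))))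
      pos-u : ∀ k → k ℕ.< suc m → Pos (iterate c k u₀)
      pos-u k k< = subst Pos (iterate-+ c k (toℕ i) v) (all (k ℕ.+ toℕ i)
        (ℕₚ.≤-trans (ℕₚ.<⇒≤ (ℕₚ.+-monoˡ-< (toℕ i) k<)) (subst (ℕ._≤ n) (sym j≡) (ℕ.s≤s⁻¹ (toℕ<n j)))))
      x : V
      x = orbit-sum c (suc m) u₀
      px : Pos x
      px = orbit-sum-pos c (suc m) u₀ pos-u
      sum-support : ∀ m {k} → k ∉ J → lookup (orbit-sum c m u₀) k ≡ 0ℤ
      sum-support zero    {k} k∉J = trans (lookup-⊙ 0ℤ u₀ k) (*-zeroˡ (lookup u₀ k))
      sum-support (suc m) {k} k∉J = trans (lookup-⊕ (iterate c m u₀) (orbit-sum c m u₀) k)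
        (cong₂ _+_ (iterate-support c m u₀ cJ (iterate-support c (toℕ i) v cJ sv) k∉J) (sum-support m k∉J))
      sx : ∀ {k} → k ∉ J → lookup x k ≡ 0ℤ
      sx = sum-support (suc m)
      fx : act C c x ≡ x
      fx = vec-ext λ k → +-cancelʳ (lookup (act C c x) k) (lookup x k) (lookup u₀ k)
        (trans (orbit-sum-shift c (suc m) u₀ k) (cong (λ t → lookup x k + lookup t k) periodic))
        where
        +-cancelʳ : ∀ a b c → a + c ≡ b + c → a ≡ b
        +-cancelʳ a b c h = trans (split a c) (trans (cong (_+ - c) h) (sym (split b c)))
          where
          split : ∀ a c → a ≡ a + c + - c
          split = solve-∀

-- Toggles of the root poset

T-all⁻ : ∀ {n} (p : Fin n → Bool) → T (all p (allFin n)) → ∀ k → T (p k)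
T-all⁻ {n} p h k = All.lookup (Allₚ.all⁺ p (allFin n) h) (∈-allFin k)

T-all⁺ : ∀ {n} (p : Fin n → Bool) → (∀ k → T (p k)) → T (all p (allFin n))
T-all⁺ {n} p h = Allₚ.all⁻ p (All.universal h (allFin n))

∈⇒T : ∀ {n} {A : Subset n} {p} → p ∈ A → T (lookup A p)
∈⇒T h = Equivalence.from T-≡ ([]=⇒lookup h)

T⇒∈ : ∀ {n} {A : Subset n} {p} → T (lookup A p) → p ∈ A
T⇒∈ {A = A} {p} h = lookup⇒[]= p A (Equivalence.to T-≡ h)

T-not : ∀ {b} → T (not b) → ¬ T b
T-not {false} _ ()

not-T : ∀ {b} → ¬ T b → T (not b)
not-T {false} h = tt
not-T {true}  h = h tt

T-implies⁻ : ∀ {b c} → T (not b ∨ c) → T b → T c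
T-implies⁻ {true} h _ = h

T-implies⁺ : ∀ {b c} → (T b → T c) → T (not b ∨ c)
T-implies⁺ {true}  h = h tt
T-implies⁺ {false} h = tt

leqᵇ-sound : ∀ {r} (u v : Vec ℤ r) → T (leqᵇ u v) → ∀ k → lookup u k ≤ lookup v k
leqᵇ-sound u v h k = ≤ᵇ⇒≤ (T-all⁻ (λ k → lookup u k ≤ᵇ lookup v k) h k)

leqᵇ-complete : ∀ {r} (u v : Vec ℤ r) → (∀ k → lookup u k ≤ lookup v k) → T (leqᵇ u v)
leqᵇ-complete u v h = T-all⁺ (λ k → lookup u k ≤ᵇ lookup v k) λ k → ≤⇒≤ᵇ (h k)

module RootPoset {r : ℕ} (C : Cartan r) (cm : IsCartanMatrix C)
                 {n : ℕ} (roots : Vec (Vec ℤ r) n) (enum : EnumeratesΦ⁺ C roots) where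

  open Action C
  open Dichotomy C cm
  open Form C cm roots enum
  open Roots C cm roots enum

  height>0 : ∀ p → 0ℤ < height (β p)
  height>0 p with 0ℤ <? height (β p)
  ... | yes h = h
  ... | no  h = ⊥-elim (root-nonzero (β-root p) (∑-nonneg-zero (lookup (β p)) (β-pos p) (subst (_≤ 0ℤ) (height-∑ (β p)) (≮⇒≥ h))))

  height-mono : ∀ p q → β p ≤v β q → p ≢ q → height (β p) < height (β q)
  height-mono p q le ne with height (β p) <? height (β q)
  ... | yes h = h
  ... | no  h = ⊥-elim (ne (β-injective (vec-ext λ k → sym (i-j≡0⇒i≡j (lookup (β q) k) (lookup (β p) k)
        (trans (unexpand (lookup (β q) k) (lookup (β p) k)) (∑-nonneg-zero f (λ k → subst (0ℤ ≤_) (unexpand (lookup (β q) k) (lookup (β p) k)) (i≤j⇒0≤j-i (le k))) sum≤0 k))))))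
    where
    f : Fin r → ℤ
    f k = 1ℤ * lookup (β q) k + -1ℤ * lookup (β p) k
    unexpand : ∀ a b → a - b ≡ 1ℤ * a + -1ℤ * b
    unexpand = solve-∀
    sum≤0 : ∑ f ≤ 0ℤ
    sum≤0 = subst (_≤ 0ℤ) (sym (trans (∑-lin 1ℤ -1ℤ (lookup (β q)) (lookup (β p))) (trans (cong₂ (λ a b → 1ℤ * a + -1ℤ * b) (sym (height-∑ (β q))) (sym (height-∑ (β p))))
              (sym (unexpand (height (β q)) (height (β p))))))) (i≤j⇒i-j≤0 (≮⇒≥ h))

  ∣∣-mono-< : ∀ {a b} → 0ℤ < a → a < b → ∣ a ∣ ∸ 1 ℕ.< ∣ b ∣ ∸ 1
  ∣∣-mono-< (ℤ.+<+ h) (ℤ.+<+ h′) = ℕₚ.∸-monoˡ-< h′ h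

  rk-suc : ∀ {a b} → 0ℤ < a → b ≡ a + 1ℤ → ∣ b ∣ ∸ 1 ≡ suc (∣ a ∣ ∸ 1)
  rk-suc {pos (suc a)} (ℤ.+<+ h) refl = ℕₚ.+-comm a 1

  rootPoset : RankedPoset n
  rootPoset = record
    { _≼_     = λ p q → β p ≤v β q
    ; _≼?_    = λ p q → all? λ k → lookup (β p) k ≤? lookup (β q) k
    ; ≼-refl  = λ k → ≤-refl
    ; ≼-trans = λ h g k → ≤-trans (h k) (g k)
    ; rank    = rk roots
    ; rank-mono = λ {p} {q} le ne → ∣∣-mono-< (height>0 p) (height-mono p q le ne)
    ; cover   = λ {p} {q} → cov p q }
    where
    cov : ∀ p q → β p ≤v β q → p ≢ q → ∃ λ z → rk roots z ≡ suc (rk roots p) × β p ≤v β z × β z ≤v β q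
    cov p q le ne with cover-root ∣ height (β q) ∣ (β-root p) (β-pos p) (β-root q) le (λ e → ne (β-injective e)) (≤-reflexive (sym (0≤i⇒+∣i∣≡i (<⇒≤ (height>0 q)))))
    ... | z , rz , pz , hz , below , above with index rz pz
    ...   | s , refl = s , rk-suc (height>0 p) hz , below , above

  open RankedPoset rootPoset

  Within : Subset r → Fin n → Set
  Within J p = ∀ {k} → k ∉ J → lookup (β p) k ≡ 0ℤ

  inΦJ⁻ : ∀ {J p} → T (inΦJ roots J p) → Within J p
  inΦJ⁻ {J} {p} h {k} k∉J = [ (λ t → contradiction (T⇒∈ t) k∉J) , toWitness {a? = lookup (β p) k ℤ.≟ pos 0} ]′
    (Equivalence.to (T-∨ {lookup J k}) (T-all⁻ (λ k → lookup J k ∨ ⌊ lookup (root roots p) k ℤ.≟ pos 0 ⌋) h k))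

  inΦJ⁺ : ∀ {J p} → Within J p → T (inΦJ roots J p)
  inΦJ⁺ {J} {p} h = T-all⁺ (λ k → lookup J k ∨ ⌊ lookup (root roots p) k ℤ.≟ pos 0 ⌋) λ k → help k (k ∈? J)
    where
    help : ∀ k → Dec (k ∈ J) → T (lookup J k ∨ ⌊ lookup (root roots p) k ℤ.≟ pos 0 ⌋)
    help k (yes m) = Equivalence.from T-∨ (inj₁ (∈⇒T m))
    help k (no m)  = Equivalence.from (T-∨ {lookup J k}) (inj₂ (fromWitness {a? = lookup (β p) k ℤ.≟ pos 0} (h m)))

  Within? : ∀ J p → Dec (Within J p)
  Within? J p = map′ inΦJ⁻ inΦJ⁺ (T? (inΦJ roots J p))

  Within-down : ∀ {J p q} → Within J q → p ≼ q → Within J p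
  Within-down {J} {p} {q} h le {k} k∉J = ≤-antisym (subst (lookup (β p) k ≤_) (h k∉J) (le k)) (β-pos p k)

  Within-⊆ : ∀ {K J p} → K ⊆ J → Within K p → Within J p
  Within-⊆ K⊆J h k∉J = h λ m → k∉J (K⊆J m)

  Anti : Subset r → Subset n → Set
  Anti J = IsAnti (Within J)

  private
    pair : Subset n → Fin n → Fin n → Bool
    pair A p q = not (lookup A p ∧ lookup A q ∧ not ⌊ p ≟F q ⌋) ∨ not (leqᵇ (root roots p) (root roots q))

  antichain⁻ : ∀ {A} → T (isAntichainᵇ roots A) → ∀ {p q} → p ∈ A → q ∈ A → p ≼ q → p ≡ q
  antichain⁻ {A} h {p} {q} p∈ q∈ le with p ≟F q | T-all⁻ (pair A p) (T-all⁻ (λ p → all (pair A p) (allFin n)) h p) q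
  ... | yes e | _ = e
  ... | no ne | t = contradiction (leqᵇ-complete (β p) (β q) le)
    (T-not (T-implies⁻ {lookup A p ∧ lookup A q ∧ true} t (Equivalence.from T-∧ (∈⇒T p∈ , Equivalence.from T-∧ (∈⇒T q∈ , tt)))))

  antichain⁺ : ∀ {A} → (∀ {p q} → p ∈ A → q ∈ A → p ≼ q → p ≡ q) → T (isAntichainᵇ roots A)
  antichain⁺ {A} h = T-all⁺ (λ p → all (pair A p) (allFin n)) λ p → T-all⁺ (pair A p) λ q → help p q
    where
    help : ∀ p q → T (pair A p q)
    help p q with p ≟F q
    ... | yes e = T-implies⁺ {lookup A p ∧ lookup A q ∧ false} λ t → ⊥-elim (proj₂ (Equivalence.to (T-∧ {lookup A q}) (proj₂ (Equivalence.to (T-∧ {lookup A p}) t))))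
    ... | no ne = T-implies⁺ {lookup A p ∧ lookup A q ∧ true} λ t → not-T λ t′ →
      ne (h (T⇒∈ (proj₁ (Equivalence.to (T-∧ {lookup A p}) t))) (T⇒∈ (proj₁ (Equivalence.to (T-∧ {lookup A q}) (proj₂ (Equivalence.to (T-∧ {lookup A p}) t))))) (leqᵇ-sound (β p) (β q) t′))

  anti⁻ : ∀ {J A} → IsAntichainIn roots J A → Anti J A
  anti⁻ {J} {A} h = (λ {p} m → inΦJ⁻ (T-implies⁻ {lookup A p} (T-all⁻ (λ p → not (lookup A p) ∨ inΦJ roots J p) (proj₁ (Equivalence.to T-∧ h)) p) (∈⇒T m)))
                  , antichain⁻ (proj₂ (Equivalence.to (T-∧ {all (λ p → not (lookup A p) ∨ inΦJ roots J p) (allFin n)}) h))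

  anti⁺ : ∀ {J A} → Anti J A → IsAntichainIn roots J A
  anti⁺ {J} {A} (d , a) = Equivalence.from T-∧ (T-all⁺ (λ p → not (lookup A p) ∨ inΦJ roots J p) (λ p → T-implies⁺ {lookup A p} λ t → inΦJ⁺ (d (T⇒∈ t))) , antichain⁺ a)

  record Toggled (J : Subset r) (p : Fin n) (A B : Subset n) : Set where
    field
      still   : Anti J B
      others→ : ∀ {q} → q ≢ p → q ∈ B → q ∈ A
      others← : ∀ {q} → q ≢ p → q ∈ A → q ∈ B
      this→   : p ∈ B → ¬ Comparable A p
      this←   : ¬ Comparable A p → p ∈ B

  toggled : ∀ {J p A} → Within J p → Anti J A → Toggled J p A (toggle roots p A)
  toggled {J} {p} {A} d a with lookup A p in eqA
  ... | true = record
    { still   = (λ m → proj₁ a (back m)) , λ m m′ → proj₂ a (back m) (back m′)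
    ; others→ = λ _ → back
    ; others← = λ {q} q≢p m → lookup⇒[]= q _ (trans (lookup∘update′ q≢p A false) ([]=⇒lookup m))
    ; this→   = λ m → contradiction (trans (sym ([]=⇒lookup m)) (lookup∘update p A false)) λ ()
    ; this←   = λ nc → contradiction (p , lookup⇒[]= p A eqA , inj₁ ≼-refl) nc }
    where
    back : ∀ {q} → q ∈ A [ p ]≔ false → q ∈ A
    back {q} m with q ≟F p
    ... | yes refl = contradiction (trans (sym ([]=⇒lookup m)) (lookup∘update p A false)) λ ()
    ... | no  q≢p  = lookup⇒[]= q A (trans (sym (lookup∘update′ q≢p A false)) ([]=⇒lookup m))
  ... | false with isAntichainᵇ roots (A ∪ ⁅ p ⁆) in eqU
  ...   | true = record
    { still   = (λ m → [ proj₁ a , (λ m′ → subst (Within J) (sym (x∈⁅y⁆⇒x≡y p m′)) d) ]′ (x∈p∪q⁻ A ⁅ p ⁆ m)) , U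
    ; others→ = λ q≢p m → [ (λ x → x) , (λ m′ → contradiction (x∈⁅y⁆⇒x≡y p m′) q≢p) ]′ (x∈p∪q⁻ A ⁅ p ⁆ m)
    ; others← = λ _ m → x∈p∪q⁺ (inj₁ m)
    ; this→   = λ { _ (q , q∈ , c) → contradiction (trans (sym ([]=⇒lookup (subst (_∈ A) (same q∈ c) q∈))) eqA) λ () }
    ; this←   = λ _ → x∈p∪q⁺ (inj₂ (x∈⁅x⁆ p)) }
    where
    U : ∀ {q q′} → q ∈ A ∪ ⁅ p ⁆ → q′ ∈ A ∪ ⁅ p ⁆ → q ≼ q′ → q ≡ q′
    U = antichain⁻ (Equivalence.from T-≡ eqU)
    same : ∀ {q} → q ∈ A → q ≼ p ⊎ p ≼ q → q ≡ p
    same q∈ (inj₁ le) = U (x∈p∪q⁺ (inj₁ q∈)) (x∈p∪q⁺ (inj₂ (x∈⁅x⁆ p))) le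
    same q∈ (inj₂ le) = sym (U (x∈p∪q⁺ (inj₂ (x∈⁅x⁆ p))) (x∈p∪q⁺ (inj₁ q∈)) le)
  ...   | false = record
    { still   = a
    ; others→ = λ _ m → m
    ; others← = λ _ m → m
    ; this→   = λ m → contradiction (trans (sym ([]=⇒lookup m)) eqA) λ ()
    ; this←   = λ nc → contradiction (trans (sym (Equivalence.to T-≡ (antichain⁺ (U nc)))) eqU) λ () }
    where
    U : ¬ Comparable A p → ∀ {q q′} → q ∈ A ∪ ⁅ p ⁆ → q′ ∈ A ∪ ⁅ p ⁆ → q ≼ q′ → q ≡ q′
    U nc {q} {q′} m m′ le with x∈p∪q⁻ A ⁅ p ⁆ m | x∈p∪q⁻ A ⁅ p ⁆ m′
    ... | inj₁ x | inj₁ y = proj₂ a x y le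
    ... | inj₁ x | inj₂ y = contradiction (q , x , inj₁ (subst (q ≼_) (x∈⁅y⁆⇒x≡y p y) le)) nc
    ... | inj₂ x | inj₁ y = contradiction (q′ , y , inj₂ (subst (_≼ q′) (x∈⁅y⁆⇒x≡y p x) le)) nc
    ... | inj₂ x | inj₂ y = trans (x∈⁅y⁆⇒x≡y p x) (sym (x∈⁅y⁆⇒x≡y p y))

  module _ (J : Subset r) (k : ℕ) where

    selected : Fin n → Bool
    selected p = inΦJ roots J p ∧ (rank p ℕ.≡ᵇ k)

    toggles : List (Fin n) → Subset n → Subset n
    toggles ps A = foldr (λ p B → if selected p then toggle roots p B else B) A ps

    record AllToggled (ps : List (Fin n)) (A B : Subset n) : Set where
      field
        still      : Anti J B
        unlisted→  : ∀ {p} → p ∉ˡ ps → p ∈ B → p ∈ A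
        unlisted←  : ∀ {p} → p ∉ˡ ps → p ∈ A → p ∈ B
        off-rank→  : ∀ {p} → rank p ≢ k → p ∈ B → p ∈ A
        off-rank←  : ∀ {p} → rank p ≢ k → p ∈ A → p ∈ B
        on-rank→   : ∀ {p} → p ∈ˡ ps → rank p ≡ k → p ∈ B → ¬ Comparable A p
        on-rank←   : ∀ {p} → p ∈ˡ ps → Within J p → rank p ≡ k → ¬ Comparable A p → p ∈ B

    -- Elements of equal rank are incomparable unless equal, so toggling one does not affect the
    -- test for another. Each p may therefore be tested against the original `A` instead of the
    -- intermediate set.
    all-toggled : ∀ ps → Unique ps → ∀ {A} → Anti J A → AllToggled ps A (toggles ps A)
    all-toggled [] [] a = record
      { still = a ; unlisted→ = λ _ m → m ; unlisted← = λ _ m → m ; off-rank→ = λ _ m → m ; off-rank← = λ _ m → m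
      ; on-rank→ = λ () ; on-rank← = λ () }
    all-toggled (p ∷ ps) (p∉ps ∷ u) {A} a with selected p in eq
    ... | false = record
      { still = IH.still
      ; unlisted→ = λ h → IH.unlisted→ (h ∘ there) ; unlisted← = λ h → IH.unlisted← (h ∘ there)
      ; off-rank→ = IH.off-rank→ ; off-rank← = IH.off-rank←
      ; on-rank→ = λ { (here refl) e m → contradiction (trans (sym (Equivalence.to T-≡ (Equivalence.from T-∧ (inΦJ⁺ (proj₁ IH.still m) , ℕₚ.≡⇒≡ᵇ (rank p) k e)))) eq) λ () ; (there l) → IH.on-rank→ l }
      ; on-rank← = λ { (here refl) d e nc → contradiction (trans (sym (Equivalence.to T-≡ (Equivalence.from T-∧ (inΦJ⁺ d , ℕₚ.≡⇒≡ᵇ (rank p) k e)))) eq) λ () ; (there l) → IH.on-rank← l } }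
      where module IH = AllToggled (all-toggled ps u a)
    ... | true = record
      { still = Tg.still
      ; unlisted→ = λ h m → IH.unlisted→ (h ∘ there) (Tg.others→ (h ∘ here) m)
      ; unlisted← = λ h m → Tg.others← (h ∘ here) (IH.unlisted← (h ∘ there) m)
      ; off-rank→ = λ ne m → IH.off-rank→ ne (Tg.others→ (λ { refl → ne rkp }) m)
      ; off-rank← = λ ne m → Tg.others← (λ { refl → ne rkp }) (IH.off-rank← ne m)
      ; on-rank→ = λ { (here refl) e m c → Tg.this→ m (cmp→ c)
                     ; {q} (there l) e m → IH.on-rank→ l e (Tg.others→ (λ { refl → All.lookup p∉ps l refl }) m) }
      ; on-rank← = λ { (here refl) d e nc → Tg.this← (λ c → nc (cmp← c))
                     ; {q} (there l) d e nc → Tg.others← (λ { refl → All.lookup p∉ps l refl }) (IH.on-rank← l d e nc) } }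
      where
      B = toggles ps A
      module IH = AllToggled (all-toggled ps u a)
      sel : T (inΦJ roots J p) × T (rank p ℕ.≡ᵇ k)
      sel = Equivalence.to T-∧ (Equivalence.from T-≡ eq)
      rkp : rank p ≡ k
      rkp = ℕₚ.≡ᵇ⇒≡ (rank p) k (proj₂ sel)
      module Tg = Toggled (toggled {J} {p} {B} (inΦJ⁻ (proj₁ sel)) IH.still)
      p∉ : p ∉ˡ ps
      p∉ m = All.lookup p∉ps m refl
      same-rank : ∀ {q} → rank q ≡ k → q ≼ p ⊎ p ≼ q → p ≡ q
      same-rank e (inj₁ le) = sym (≼-rank≡ le (trans e (sym rkp)))
      same-rank e (inj₂ le) = ≼-rank≡ le (trans rkp (sym e))
      cmp→ : Comparable A p → Comparable B p
      cmp→ (q , q∈ , c) with rank q ℕ.≟ k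
      ... | no ne = q , IH.off-rank← ne q∈ , c
      ... | yes e with same-rank e c
      ...   | refl = p , IH.unlisted← p∉ q∈ , c
      cmp← : Comparable B p → Comparable A p
      cmp← (q , q∈ , c) with rank q ℕ.≟ k
      ... | no ne = q , IH.off-rank→ ne q∈ , c
      ... | yes e with same-rank e c
      ...   | refl = p , IH.unlisted→ p∉ q∈ , c

  rankToggle-spec : ∀ J → IsRankToggle (Within J) (rankToggle roots J)
  rankToggle-spec J = record
    { anti = λ {k} a → AllToggled.still (spec k a)
    ; in→  = λ {k} {A} {p} a e → AllToggled.on-rank→ (spec k a) (∈-allFin p) e
    ; in←  = λ {k} {A} {p} a d e → AllToggled.on-rank← (spec k a) (∈-allFin p) d e
    ; out→ = λ {k} a → AllToggled.off-rank→ (spec k a)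
    ; out← = λ {k} a → AllToggled.off-rank← (spec k a) }
    where
    spec : ∀ k {A} → Anti J A → AllToggled J k (allFin n) A (rankToggle roots J k A)
    spec k a = all-toggled J k (allFin n) (Uniqueₚ.allFin⁺ n) a

  rank≤maxRank : ∀ {J p} → Within J p → rank p ℕ.≤ maxRank roots J
  rank≤maxRank {J} {p} d = go (allFin n) (∈-allFin p)
    where
    go : ∀ ps → p ∈ˡ ps → rank p ℕ.≤ foldr (λ q m → if inΦJ roots J q then rank q ⊔ m else m) 0 ps
    go (q ∷ ps) (here refl) rewrite Equivalence.to T-≡ (inΦJ⁺ {J} {p} d) = ℕₚ.m≤m⊔n (rank q) _
    go (q ∷ ps) (there m) with inΦJ roots J q
    ... | true  = ℕₚ.≤-trans (go ps m) (ℕₚ.m≤n⊔m (rank q) _)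
    ... | false = go ps m

  rankToggle-trivial : ∀ J {k} A → suc (maxRank roots J) ℕ.≤ k → rankToggle roots J k A ≡ A
  rankToggle-trivial J {k} A l = go (allFin n)
    where
    go : ∀ ps → toggles J k ps A ≡ A
    go [] = refl
    go (p ∷ ps) with selected J k p in eq
    ... | false = go ps
    ... | true with Equivalence.to T-∧ (Equivalence.from T-≡ eq)
    ...   | t , t′ = contradiction (subst (ℕ._≤ maxRank roots J) (ℕₚ.≡ᵇ⇒≡ (rank p) k t′) (rank≤maxRank {J} {p} (inΦJ⁻ t))) (ℕₚ.<⇒≱ l)

  -- Rowmotion and rowvacuation on the root poset of a parabolic subgroup

  module Rowmotion (J : Subset r) where

    open Operators (rankToggle roots J) public
    open Dihedral rootPoset (Within J) Within-down (rankToggle roots J) (rankToggle-spec J)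
                  (suc (maxRank roots J)) (λ d → s≤s (rank≤maxRank d)) public
      using (up-anti; down-anti; vac-anti; down-up; up-down; vac-up)

    seqUp≡up : ∀ j k A → seqUp roots J j k A ≡ up j k A
    seqUp≡up j zero    A = refl
    seqUp≡up j (suc k) A = seqUp≡up (suc j) k (rankToggle roots J j A)

    seqDown≡down : ∀ j k A → seqDown roots J j k A ≡ down j k A
    seqDown≡down j zero    A = refl
    seqDown≡down j (suc k) A = cong (rankToggle roots J j) (seqDown≡down (suc j) k A)

    -- A handle on the function local to Rvac: Agda solves its body from the type of Rvac-unfold,
    -- in which the with-abstraction turns the arguments of that function into variables.
    mutual
      rounds : Subset n → ℕ → ℕ → Subset n → Subset n
      rounds = _

      Rvac-unfold : ∀ A → Rvac roots J A ≡ rounds A 1 (maxRank roots J) (seqUp roots J 0 (suc (maxRank roots J)) A)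
      Rvac-unfold A with 1 | maxRank roots J | seqUp roots J 0 (suc (maxRank roots J)) A
      ... | _ | _ | _ = refl

    rounds≡vac : ∀ A j k B → j ℕ.+ k ≡ suc (maxRank roots J) → rounds A j k B ≡ vac j k B
    rounds≡vac A j zero    B e = refl
    rounds≡vac A j (suc k) B e = trans (rounds≡vac A (suc j) k _ (trans (sym (ℕₚ.+-suc j k)) e))
      (cong (vac (suc j) k) (trans (cong (λ t → seqUp roots J j t B) (trans (cong (_∸ j) (sym e)) (ℕₚ.m+n∸m≡n j (suc k)))) (seqUp≡up j (suc k) B)))

    M : ℕ
    M = suc (maxRank roots J)

    Row≡up : ∀ A → Row roots J A ≡ up 0 M A
    Row≡up = seqUp≡up 0 M

    RowInv≡down : ∀ A → RowInv roots J A ≡ down 0 M A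
    RowInv≡down = seqDown≡down 0 M

    Rvac≡vac : ∀ A → Rvac roots J A ≡ vac 0 M A
    Rvac≡vac A = trans (Rvac-unfold A) (trans (rounds≡vac A 1 (maxRank roots J) _ refl) (cong (vac 1 (maxRank roots J)) (Row≡up A)))

    ψ : Subset n → Subset n
    ψ A = RowInv roots J (Rvac roots J A)

    ψ≡ : ∀ A → ψ A ≡ down 0 M (vac 0 M A)
    ψ≡ A = trans (RowInv≡down (Rvac roots J A)) (cong (down 0 M) (Rvac≡vac A))

    Row-anti : ∀ {A} → Anti J A → Anti J (Row roots J A)
    Row-anti {A} a = subst (Anti J) (sym (Row≡up A)) (up-anti 0 M a)

    RowInv-anti : ∀ {A} → Anti J A → Anti J (RowInv roots J A)
    RowInv-anti {A} a = subst (Anti J) (sym (RowInv≡down A)) (down-anti 0 M a)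

    ψ-anti : ∀ {A} → Anti J A → Anti J (ψ A)
    ψ-anti {A} a = subst (Anti J) (sym (ψ≡ A)) (down-anti 0 M (vac-anti 0 M a))

    Row-RowInv : ∀ {A} → Anti J A → Row roots J (RowInv roots J A) ≡ A
    Row-RowInv {A} a = trans (Row≡up (RowInv roots J A)) (trans (cong (up 0 M) (RowInv≡down A)) (up-down 0 M a))

    ψ-Row : ∀ {A} → Anti J A → ψ (Row roots J A) ≡ RowInv roots J (ψ A)
    ψ-Row {A} a = begin
      ψ (Row roots J A) ≡⟨ ψ≡ (Row roots J A) ⟩
      down 0 M (vac 0 M (Row roots J A)) ≡⟨ cong (λ t → down 0 M (vac 0 M t)) (Row≡up A) ⟩
      down 0 M (vac 0 M (up 0 M A)) ≡⟨ cong (down 0 M) (vac-up 0 M refl a) ⟩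
      down 0 M (down 0 M (vac 0 M A)) ≡⟨ cong (down 0 M) (sym (ψ≡ A)) ⟩
      down 0 M (ψ A) ≡⟨ sym (RowInv≡down (ψ A)) ⟩
      RowInv roots J (ψ A) ∎
      where open ≡-Reasoning

  -- The maximal ranks of Φ_K⁺ and Φ_J⁺ differ, so both sides are padded with trivial toggles to the
  -- common number of ranks mK + mJ + 1 before they are compared.
  ψ-parabolic : ∀ {K J} → K ⊆ J → ∀ {A} → Anti K A → Rowmotion.ψ J A ≡ Rowmotion.ψ K A
  ψ-parabolic {K} {J} K⊆J {A} a = begin
    RJ.ψ A ≡⟨ RJ.ψ≡ A ⟩
    RJ.down 0 RJ.M (RJ.vac 0 RJ.M A) ≡⟨ sym (RJ.down-vac-stable (rankToggle-trivial J) mK A) ⟩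
    RJ.down 0 (mK ℕ.+ RJ.M) (RJ.vac 0 (mK ℕ.+ RJ.M) A)
                                                  ≡⟨ cong (λ t → RJ.down 0 t (RJ.vac 0 t A)) (ℕₚ.+-suc mK mJ) ⟩
    RJ.down 0 (suc (mK ℕ.+ mJ)) (RJ.vac 0 (suc (mK ℕ.+ mJ)) A)
                                                  ≡⟨ Parabolic.down-vac-parabolic rootPoset (Within? K) Within-down (Within-⊆ K⊆J) minimal (rankToggle-spec K) (rankToggle-spec J) (mK ℕ.+ mJ) a ⟩
    RK.down 0 (suc (mK ℕ.+ mJ)) (RK.vac 0 (suc (mK ℕ.+ mJ)) A)
                                                  ≡⟨ cong (λ t → RK.down 0 t (RK.vac 0 t A)) (trans (cong suc (ℕₚ.+-comm mK mJ)) (sym (ℕₚ.+-suc mJ mK))) ⟩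
    RK.down 0 (mJ ℕ.+ RK.M) (RK.vac 0 (mJ ℕ.+ RK.M) A)
                                                  ≡⟨ RK.down-vac-stable (rankToggle-trivial K) mJ A ⟩
    RK.down 0 RK.M (RK.vac 0 RK.M A) ≡⟨ sym (RK.ψ≡ A) ⟩
    RK.ψ A ∎
    where
    open ≡-Reasoning
    module RJ = Rowmotion J
    module RK = Rowmotion K
    mJ = maxRank roots J
    mK = maxRank roots K
    -- A root of Φ_J⁺ outside Φ_K⁺ has a nonzero coefficient at some k ∉ K, and then αₖ lies below
    -- it.
    minimal : ∀ {p} → Within J p → ¬ Within K p → ∃ λ s → s ≼ p × rank s ≡ 0 × Within J s × ¬ Within K s
    minimal {p} wJ nK with any? (λ k → ¬? (k ∈? K) ×-dec ¬? (lookup (β p) k ℤ.≟ 0ℤ))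
    ... | no h = ⊥-elim (nK λ {k} k∉K → help k k∉K)
      where
      help : ∀ k → k ∉ K → lookup (β p) k ≡ 0ℤ
      help k k∉K with lookup (β p) k ℤ.≟ 0ℤ
      ... | yes e = e
      ... | no ne = ⊥-elim (h (k , k∉K , ne))
    ... | yes (k , k∉K , ne) with index (simple-root k) (e-pos k)
    ...   | s , eq = s , s≼p , trans (cong (λ t → ∣ height t ∣ ∸ 1) eq) (cong (λ t → ∣ t ∣ ∸ 1) (height-e k)) , Within-down wJ s≼p
        , λ w → contradiction (trans (sym (trans (cong (λ t → lookup t k) eq) (trans (lookup-e k k) (δ-refl k)))) (w k∉K)) λ ()
      where
      s≼p : s ≼ p
      s≼p l = subst (_≤ lookup (β p) l) (sym (trans (cong (λ t → lookup t l) eq) (lookup-e k l)))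
                (δ-bound {k} {lookup (β p)} (β-pos p) (≤∧≢⇒< (β-pos p k) (λ e → ne (sym e))) l)

-- Row-orbits and noncrossing partitions

x∈p─q⇒x∉q : ∀ {n} (p q : Subset n) {x} → x ∈ p ─ q → x ∉ q
x∈p─q⇒x∉q (_ ∷ p) (_ ∷ q) (there m) (there m′) = x∈p─q⇒x∉q p q m m′

reverse-unique : ∀ {A : Set} {xs : List A} → Unique xs → Unique (reverse xs)
reverse-unique {xs = []}     []      = []
reverse-unique {xs = x ∷ xs} (h ∷ u) = subst Unique (sym (unfold-reverse x xs))
  (Uniqueₚ.++⁺ (reverse-unique u) ([] ∷ []) λ { (m , here refl) → All≢⇒∉ h (Anyₚ.reverse⁻ m) })

module Main {r : ℕ} (C : Cartan r) (cm : IsCartanMatrix C)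
            {n : ℕ} (roots : Vec (Vec ℤ r) n) (enum : EnumeratesΦ⁺ C roots)
            (L : Subset r) (bip : IsBipartition C L)
            (Θ : Subset r → Subset n → Word r) (ast : IsASTFamily C roots L Θ) where

  open Action C
  open Dichotomy C cm
  open Form C cm roots enum
  open Roots C cm roots enum
  open Factorizations C cm roots enum
  open GroupSolver C cm
  open Coxeter C cm roots enum
  open RootPoset C cm roots enum

  bipartite : ∀ {i j} → lookup L i ≡ lookup L j → i ≢ j → C i j ≡ 0ℤ
  bipartite {i} {j} h ne with C i j ℤ.≟ 0ℤ
  ... | yes e = e
  ... | no ne′ = contradiction h (bip i j ne ne′)

  commuting-L : Commuting L
  commuting-L i∈ j∈ = bipartite (trans ([]=⇒lookup i∈) (sym ([]=⇒lookup j∈)))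

  commuting-∁L : Commuting (∁ L)
  commuting-∁L i∈ j∈ = bipartite (trans (outside i∈) (sym (outside j∈)))
    where
    outside : ∀ {i} → i ∈ ∁ L → lookup L i ≡ false
    outside {i} h = ¬-not λ e → x∈∁p⇒x∉p h (lookup⇒[]= i L e)

  cox : Subset r → Word r
  cox = coxJ L

  ∈-cox⁺ : ∀ {J i} → i ∈ J → i ∈ˡ cox J
  ∈-cox⁺ {J} {i} h with i ∈? L
  ... | yes l = ∈-++⁺ˡ (∈-cX⁺ (x∈p∩q⁺ (l , h)))
  ... | no  l = ∈-++⁺ʳ (cX (L ∩ J)) (∈-cX⁺ (x∈p∩q⁺ (x∉p⇒x∈∁p l , h)))

  ∈-cox⁻ : ∀ {J i} → i ∈ˡ cox J → i ∈ J
  ∈-cox⁻ {J} h = [ (λ m → proj₂ (x∈p∩q⁻ L J (∈-cX⁻ m))) , (λ m → proj₂ (x∈p∩q⁻ (∁ L) J (∈-cX⁻ m))) ]′ (∈-++⁻ (cX (L ∩ J)) h)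

  cox-unique : ∀ J → Unique (cox J)
  cox-unique J = Uniqueₚ.++⁺ (cX-unique (L ∩ J)) (cX-unique (∁ L ∩ J)) λ (m , m′) →
    x∈∁p⇒x∉p (proj₁ (x∈p∩q⁻ (∁ L) J (∈-cX⁻ m′))) (proj₁ (x∈p∩q⁻ L J (∈-cX⁻ m)))

  wordIn : ∀ {J : Subset r} w → (∀ {i} → i ∈ˡ w → i ∈ J) → WordIn C J w
  wordIn w h = All.tabulate h

  module _ {X Y : Subset r} {i : Fin r} where

    ∩⁻ˡ : i ∈ X ∩ Y → i ∈ X
    ∩⁻ˡ m = proj₁ (x∈p∩q⁻ X Y m)

    ∩⁻ʳ : i ∈ X ∩ Y → i ∈ Y
    ∩⁻ʳ m = proj₂ (x∈p∩q⁻ X Y m)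

    ─⁻ : i ∈ X ─ Y → i ∈ X
    ─⁻ m = p─q⊆p X Y m

    ─⁻∉ : i ∈ X ─ Y → i ∉ Y
    ─⁻∉ = x∈p─q⇒x∉q X Y

  ∈-cX∩⁺ : ∀ (X Y : Subset r) {i} → i ∈ X → i ∈ Y → i ∈ˡ cX (X ∩ Y)
  ∈-cX∩⁺ X Y x y = ∈-cX⁺ {X = X ∩ Y} (x∈p∩q⁺ (x , y))

  ∈-cX∩⁻ : ∀ (X Y : Subset r) {i} → i ∈ˡ cX (X ∩ Y) → i ∈ X × i ∈ Y
  ∈-cX∩⁻ X Y m = x∈p∩q⁻ X Y (∈-cX⁻ {X = X ∩ Y} m)

  same-letters : ∀ {S} → Commuting S → ∀ w w′ → Unique w → Unique w′ → (∀ {i} → i ∈ˡ w → i ∈ S) →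
                 (∀ {i} → i ∈ˡ w → i ∈ˡ w′) → (∀ {i} → i ∈ˡ w′ → i ∈ˡ w) → w ≋ w′
  same-letters cS w w′ u u′ wS to from = commuting-≋ cS w w′ (wordIn w wS) (wordIn w′ (λ m → wS (from m))) u u′ to from

  reverse-same : ∀ {S X} → Commuting S → X ⊆ S → cX X ≋ reverse (cX X)
  reverse-same {S} {X} cS X⊆S = same-letters cS (cX X) (reverse (cX X)) (cX-unique X) (reverse-unique (cX-unique X)) (λ m → X⊆S (∈-cX⁻ m)) Anyₚ.reverse⁺ Anyₚ.reverse⁻

  cX-union : ∀ {S X Y Z} → Commuting S → X ⊆ S → (∀ {i} → i ∈ Y → i ∉ Z) → (∀ {i} → i ∈ X → i ∈ Y ⊎ i ∈ Z) →
             Y ⊆ X → Z ⊆ X → cX X ≋ cX Y ++ cX Z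
  cX-union {S} {X} {Y} {Z} cS X⊆S disj split Y⊆X Z⊆X = same-letters cS (cX X) (cX Y ++ cX Z) (cX-unique X)
    (Uniqueₚ.++⁺ (cX-unique Y) (cX-unique Z) λ (m , m′) → disj (∈-cX⁻ m) (∈-cX⁻ m′))
    (λ m → X⊆S (∈-cX⁻ m))
    (λ m → [ (λ y → ∈-++⁺ˡ (∈-cX⁺ y)) , (λ z → ∈-++⁺ʳ (cX Y) (∈-cX⁺ z)) ]′ (split (∈-cX⁻ m)))
    (λ m → [ (λ y → ∈-cX⁺ (Y⊆X (∈-cX⁻ y))) , (λ z → ∈-cX⁺ (Z⊆X (∈-cX⁻ z))) ]′ (∈-++⁻ (cX Y) m))

  cX-remove : ∀ {S X Y i} → Commuting S → X ⊆ S → i ∈ X → i ∉ Y → (∀ {k} → k ∈ X → k ≢ i → k ∈ Y) → Y ⊆ X → cX X ≋ i ∷ cX Y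
  cX-remove {S} {X} {Y} {i} cS X⊆S i∈X i∉Y rest Y⊆X = same-letters cS (cX X) (i ∷ cX Y) (cX-unique X)
    (∉⇒All≢ (cX Y) (λ m → i∉Y (∈-cX⁻ m)) ∷ cX-unique Y) (λ m → X⊆S (∈-cX⁻ m)) to
    λ { (here refl) → ∈-cX⁺ i∈X ; (there m) → ∈-cX⁺ (Y⊆X (∈-cX⁻ m)) }
    where
    to : ∀ {k} → k ∈ˡ cX X → k ∈ˡ i ∷ cX Y
    to {k} m with k ≟F i
    ... | yes e = here e
    ... | no ne = there (∈-cX⁺ (rest (∈-cX⁻ m) ne))

  cX-empty : ∀ {X} → (∀ {i} → i ∉ X) → cX X ≋ []
  cX-empty {X} h = ≡⇒≋ (none (cX X) λ m → h (∈-cX⁻ m))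
    where
    none : ∀ w → (∀ {i} → i ∉ˡ w) → w ≡ []
    none []      h = refl
    none (i ∷ w) h = ⊥-elim (h (here refl))

  module _ {J : Subset r} {A : Subset n} (a : Anti J A) where

    Θ-NC : NC C J (cox J) (Θ J A)
    Θ-NC = IsASTFamily.into ast J A (anti⁺ a)

    Θ-Row : Θ J (Row roots J A) ≋ cox J ++ reverse (Θ J A)
    Θ-Row = ≈⇒≋ {Θ J (Row roots J A)} {cox J ++ reverse (Θ J A)} (IsASTFamily.rowKrew ast J A (anti⁺ a))

    Θ-injective : ∀ {B} → Anti J B → Θ J A ≋ Θ J B → A ≡ B
    Θ-injective {B} b h = IsASTFamily.injective ast J A B (anti⁺ a) (anti⁺ b) (≋⇒≈ {Θ J A} {Θ J B} h)

    supp-⊆ : supp roots A ⊆ J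
    supp-⊆ {i} m with i ∈? J
    ... | yes h = h
    ... | no  h = contradiction (proj₁ a p∈A h) λ e → contradiction (subst₂ _≤_ (trans (lookup-e i i) (δ-refl i)) e (leqᵇ-sound (e′ i) (β p) le i)) λ { (ℤ.+≤+ ()) }
      where
      e′ = Defs.e {r}
      found : ∃ λ p → T (lookup A p ∧ leqᵇ (e′ i) (root roots p))
      found = Any.satisfied (Anyₚ.any⁻ (λ p → lookup A p ∧ leqᵇ (e′ i) (root roots p)) (allFin n)
                (subst T (lookup∘tabulate _ i) (∈⇒T m)))
      p = proj₁ found
      p∈A : p ∈ A
      p∈A = T⇒∈ (proj₁ (Equivalence.to (T-∧ {lookup A p}) (proj₂ found)))
      le : T (leqᵇ (e′ i) (root roots p))
      le = proj₂ (Equivalence.to (T-∧ {lookup A p}) (proj₂ found))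

  Anti-⊆ : ∀ {K J A} → K ⊆ J → Anti K A → Anti J A
  Anti-⊆ K⊆J (d , a) = (λ m → Within-⊆ K⊆J (d m)) , a

  -- The given parabolic induction concerns only the exact support. Comparing J and K each with supp
  -- A, and splitting the prefix at K, extends it to every K that contains the support.
  Θ-parabolic : ∀ {K J} → K ⊆ J → ∀ {A} → Anti K A → Θ J A ≋ cX ((L ∩ J) ─ K) ++ Θ K A
  Θ-parabolic {K} {J} K⊆J {A} a = ≋-trans (≈⇒≋ {Θ J A} {cX ((L ∩ J) ─ s) ++ Θ s A} (IsASTFamily.parabolic ast J A (anti⁺ (Anti-⊆ K⊆J a))))
    (≋-trans (++-cong union (≋-refl {Θ s A}))
    (≋-trans (≡⇒≋ (++-assoc (cX ((L ∩ J) ─ K)) (cX ((L ∩ K) ─ s)) (Θ s A)))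
      (++-cong (≋-refl {cX ((L ∩ J) ─ K)}) (≋-sym (≈⇒≋ {Θ K A} {cX ((L ∩ K) ─ s) ++ Θ s A} (IsASTFamily.parabolic ast K A (anti⁺ a)))))))
    where
    s = supp roots A
    union : cX ((L ∩ J) ─ s) ≋ cX ((L ∩ J) ─ K) ++ cX ((L ∩ K) ─ s)
    union = cX-union commuting-L (λ m → ∩⁻ˡ (─⁻ m)) (λ y z → ─⁻∉ y (∩⁻ʳ (─⁻ z))) split
      (λ y → x∈p∧x∉q⇒x∈p─q (─⁻ y) (λ z → ─⁻∉ y (supp-⊆ a z)))
      (λ z → x∈p∧x∉q⇒x∈p─q (x∈p∩q⁺ (∩⁻ˡ (─⁻ z) , K⊆J (∩⁻ʳ (─⁻ z)))) (─⁻∉ z))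
      where
      split : ∀ {i} → i ∈ (L ∩ J) ─ s → i ∈ (L ∩ J) ─ K ⊎ i ∈ (L ∩ K) ─ s
      split {i} m with i ∈? K
      ... | yes k = inj₂ (x∈p∧x∉q⇒x∈p─q (x∈p∩q⁺ (∩⁻ˡ (─⁻ m) , k)) (─⁻∉ m))
      ... | no  k = inj₁ (x∈p∧x∉q⇒x∈p─q (─⁻ m) k)

  ψ : Subset r → Subset n → Subset n
  ψ = Rowmotion.ψ

  cᴸ : Subset r → Word r
  cᴸ J = cX (L ∩ J)

  -- The identity along Row-orbits and under parabolic inclusion

  Good : Subset r → Subset n → Set
  Good J A = Θ J (ψ J A) ≋ cᴸ J ++ reverse (Θ J A) ++ reverse (cᴸ J)

  l-involution : ∀ J → cᴸ J ≋ reverse (cᴸ J)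
  l-involution J = reverse-same commuting-L ∩⁻ˡ

  ρ-involution : ∀ J → cX (∁ L ∩ J) ≋ reverse (cX (∁ L ∩ J))
  ρ-involution J = reverse-same commuting-∁L ∩⁻ˡ

  pattern v₀ = var zero
  pattern v₁ = var (suc zero)
  pattern v₂ = var (suc (suc zero))
  pattern v₃ = var (suc (suc (suc zero)))

  env : ∀ {m} → Vec (Word r) m → Fin m → Word r
  env = lookup

  -- From ψ Row = Row⁻¹ ψ one gets ψ A = Row ψ Row A, so the identity is pulled back from Row A to
  -- A. In this direction it suffices to meet one good antichain further along the orbit.
  good-Row : ∀ {J A} → Anti J A → Good J (Row roots J A) → Good J A
  good-Row {J} {A} a g = ≋-trans step₁ (≋-trans (++-cong (≋-refl {cox J}) (reverse-cong diag step₂)) (≋-trans step₃ step₄))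
    where
    open Rowmotion J hiding (ψ)
    l ρ w x′ : Word r
    l = cᴸ J
    ρ = cX (∁ L ∩ J)
    w = Θ J A
    x′ = Θ J (ψ J (Row roots J A))
    step₁ : Θ J (ψ J A) ≋ cox J ++ reverse x′
    step₁ = subst (λ B → Θ J B ≋ cox J ++ reverse x′) (Row-RowInv (ψ-anti a))
      (subst (λ B → Θ J (Row roots J (RowInv roots J (ψ J A))) ≋ cox J ++ reverse (Θ J B)) (sym (ψ-Row a)) (Θ-Row (RowInv-anti (ψ-anti a))))
    step₂ : x′ ≋ l ++ reverse (cox J ++ reverse w) ++ reverse l
    step₂ = ≋-trans g (++-cong (≋-refl {l}) (++-cong (reverse-cong diag (Θ-Row a)) (≋-refl {reverse l})))
    -- The second copies of the involutions l and ρ are inverted, so that they cancel the first ones.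
    step₃ : cox J ++ reverse (l ++ reverse (cox J ++ reverse w) ++ reverse l) ≋ (l ++ ρ) ++ reverse l ++ (l ++ reverse ρ) ++ reverse w ++ reverse l
    step₃ = ≋-trans (solve (env (l Vec.∷ ρ Vec.∷ w Vec.∷ Vec.[])) ((v₀ · v₁) · inv (v₀ · (inv ((v₀ · v₁) · inv v₂) · inv v₀)))
        ((v₀ · v₁) · v₀ · (v₀ · v₁) · inv v₂ · inv v₀) refl)
      (++-cong (≋-refl {l ++ ρ}) (++-cong (l-involution J) (++-cong (++-cong (≋-refl {l}) (ρ-involution J)) (≋-refl {reverse w ++ reverse l}))))
    step₄ : (l ++ ρ) ++ reverse l ++ (l ++ reverse ρ) ++ reverse w ++ reverse l ≋ l ++ reverse w ++ reverse l
    step₄ = solve (env (l Vec.∷ ρ Vec.∷ w Vec.∷ Vec.[])) ((v₀ · v₁) · inv v₀ · (v₀ · inv v₁) · inv v₂ · inv v₀) (v₀ · inv v₂ · inv v₀) refl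

  -- With d the product of the sᵢ for i in L ∩ J outside K, and l = c_{L∩K}, one has c_{L∩J} = d l.
  -- Hence Flip for J sends d w to (d l)(w⁻¹ d⁻¹)(d l⁻¹) = d l w⁻¹ l⁻¹, that is, d times Flip of w
  -- for K. For the last factor c_{L∩J} is written as l d⁻¹, which is possible because its letters
  -- commute.
  good-parabolic : ∀ {K J} → K ⊆ J → ∀ {A} → Anti K A → Good K A → Good J A
  good-parabolic {K} {J} K⊆J {A} a g = ≋-trans (≡⇒≋ (cong (Θ J) (ψ-parabolic K⊆J a)))
    (≋-trans (Θ-parabolic K⊆J (Rowmotion.ψ-anti K a))
    (≋-trans (++-cong (≋-refl {d}) g)
    (≋-trans (solve (env (d Vec.∷ l Vec.∷ w Vec.∷ Vec.[])) (v₀ · v₁ · inv v₂ · inv v₁) ((v₀ · v₁) · inv (v₀ · v₂) · inv (v₁ · inv v₀)) refl)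
      (++-cong (≋-sym dl) (++-cong (reverse-cong diag (≋-sym (Θ-parabolic K⊆J a))) (reverse-cong diag (≋-sym ld)))))))
    where
    d l w : Word r
    d = cX ((L ∩ J) ─ K)
    l = cᴸ K
    w = Θ K A
    split : ∀ {i} → i ∈ L ∩ J → i ∈ (L ∩ J) ─ K ⊎ i ∈ L ∩ K
    split {i} m with i ∈? K
    ... | yes k = inj₂ (x∈p∩q⁺ (∩⁻ˡ m , k))
    ... | no  k = inj₁ (x∈p∧x∉q⇒x∈p─q m k)
    K∩ : L ∩ K ⊆ L ∩ J
    K∩ m = x∈p∩q⁺ (∩⁻ˡ m , K⊆J (∩⁻ʳ m))
    dl : cᴸ J ≋ d ++ l
    dl = cX-union commuting-L ∩⁻ˡ (λ y z → ─⁻∉ y (∩⁻ʳ z)) split ─⁻ K∩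
    ld : cᴸ J ≋ l ++ reverse d
    ld = ≋-trans (cX-union commuting-L ∩⁻ˡ (λ z y → ─⁻∉ y (∩⁻ʳ z)) (λ m → Sum⊎.swap (split m)) K∩ ─⁻)
      (++-cong (≋-refl {l}) (reverse-same {L} {(L ∩ J) ─ K} commuting-L (λ m → ∩⁻ˡ (─⁻ m))))

  data Orbit (J : Subset r) (A : Subset n) : Subset n → Set where
    start : Orbit J A A
    next  : ∀ {B} → Orbit J A B → Orbit J A (Row roots J B)

  orbit-anti : ∀ {J A B} → Anti J A → Orbit J A B → Anti J B
  orbit-anti a start    = a
  orbit-anti {J} a (next o) = Rowmotion.Row-anti J (orbit-anti a o)

  good-orbit : ∀ {J A B} → Anti J A → Orbit J A B → Good J B → Good J A
  good-orbit a start    g = g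
  good-orbit a (next o) g = good-orbit a o (good-Row (orbit-anti a o) g)

  orbit-trans : ∀ {J A B D} → Orbit J A B → Orbit J B D → Orbit J A D
  orbit-trans o start     = o
  orbit-trans o (next o′) = next (orbit-trans o o′)

  good-empty : ∀ {J A} → (∀ {i} → i ∉ J) → Anti J A → Good J A
  good-empty {J} {A} empty a = ≋-trans (trivial (Rowmotion.ψ-anti J a))
    (≋-trans (solve (env (cᴸ J Vec.∷ Vec.[])) one (v₀ · inv one · inv v₀) refl)
             (++-cong (≋-refl {cᴸ J}) (++-cong (reverse-cong diag (≋-sym (trivial a))) (≋-refl {reverse (cᴸ J)}))))
    where
    no-roots : ∀ {B p} → Anti J B → p ∉ B
    no-roots {B} {p} b m = root-nonzero (β-root p) λ k → proj₁ b m empty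
    trivial : ∀ {B} → Anti J B → Θ J B ≋ []
    trivial {B} b = subst (λ X → Θ J X ≋ []) (⊆-antisym base∅ (λ m → ⊥-elim (no-roots b m)))
      (≈⇒≋ {Θ J (simpleSet roots (L ∩ J))} {[]} (IsASTFamily.base ast J))
      where
      base∅ : simpleSet roots (L ∩ J) ⊆ B
      base∅ {p} m = ⊥-elim (none (Any.satisfied (Anyₚ.any⁻ (λ i → lookup (L ∩ J) i ∧ eqᵇ (root roots p) (e i)) (allFin r) (subst T (lookup∘tabulate _ p) (∈⇒T m)))))
        where
        none : ¬ (∃ λ i → T (lookup (L ∩ J) i ∧ eqᵇ (root roots p) (e i)))
        none (i , t) = empty (∩⁻ʳ {L} {J} (T⇒∈ (proj₁ (Equivalence.to (T-∧ {lookup (L ∩ J) i}) t))))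

  -- Descent to a maximal proper parabolic subgroup

  ReflFact-⊆ : ∀ {K J w m} → K ⊆ J → ReflFact C K w m → ReflFact C J w m
  ReflFact-⊆ K⊆J (ts , len , h , eq) = ts , len , All.map (λ {t} → IsReflection-⊆ K⊆J {t}) h , eq

  -- Splitting off one simple reflection i from a shortest reflection factorization of the Coxeter element
  -- leaves a shortest factorization of the Coxeter element of J − i, inside the parabolic subgroup of J − i.
  parabolic-NC : ∀ {J i} → i ∈ J → (∀ {m} → ReflFact C J (cox (J ─ ⁅ i ⁆)) m → ReflFact C J (cox J) (suc m)) →
    ∀ y us vs → All (IsReflection C J) us → All (IsReflection C J) vs → concat us ≋ y → concat vs ≋ reverse y ++ cox (J ─ ⁅ i ⁆) →
    Minimal J (cox J) (suc (length us ℕ.+ length vs)) → NC C (J ─ ⁅ i ⁆) (cox (J ─ ⁅ i ⁆)) y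
  parabolic-NC {J} {i} i∈J extend y us vs hu hv eu ev min =
    NC-intro K (cox K) y us vs (Allₚ.++⁻ˡ us inK) (Allₚ.++⁻ʳ us inK) eu ev
      λ m m< f → min (suc m) (s≤s m<) (extend (ReflFact-⊆ {K} {J} {cox K} ─⁻ f))
    where
    K : Subset r
    K = J ─ ⁅ i ⁆
    letters : List (Word r)
    letters = map (λ j → j ∷ []) (cox K)
    -- Otherwise the letters of `cox K`, completed by sᵢ, would be a factorization of `cox J`
    -- shorter than the minimum.
    short : length (us ++ vs) ℕ.≤ length (cox K)
    short = subst₂ ℕ._≤_ (sym (length-++ us)) (length-map (λ j → j ∷ []) (cox K)) (ℕₚ.≮⇒≥ λ l → min _ (s≤s l)
      (extend (letters , refl , word-reflections (cox K) (wordIn (cox K) (λ m → ─⁻ (∈-cox⁻ {K} m)))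
              , ≋⇒≈ {concat letters} {cox K} (≡⇒≋ (concat-letters (cox K))))))
    product : concat (us ++ vs) ≋ cox K
    product = ≋-trans (≡⇒≋ (sym (concat-++ us vs))) (≋-trans (++-cong eu ev)
      (solve (env (y ∷ cox K ∷ Vec.[])) (v₀ · inv v₀ · v₁) v₁ refl))
    inK : All (IsReflection C K) (us ++ vs)
    inK = restrict-factorization K (cox K) (cox-unique K) ∈-cox⁻ (us ++ vs) (Allₚ.++⁺ hu hv) short product

  module _ {J : Subset r} {i : Fin r} (i∈J : i ∈ J) where

    private
      K : Subset r
      K = J ─ ⁅ i ⁆
      i∉K : i ∉ K
      i∉K m = ─⁻∉ m (x∈⁅x⁆ i)
      K⊆J : K ⊆ J
      K⊆J = ─⁻
      remove : ∀ {k} → k ∈ J → k ≢ i → k ∈ K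
      remove k∈J ne = x∈p∧x∉q⇒x∈p─q k∈J λ m → ne (x∈⁅y⁆⇒x≡y i m)

    cox-remove-L : i ∈ L → cox J ≋ i ∷ cox K
    cox-remove-L i∈L = ++-cong
      (cX-remove commuting-L ∩⁻ˡ (x∈p∩q⁺ (i∈L , i∈J)) (λ m → i∉K (∩⁻ʳ m)) (λ m ne → x∈p∩q⁺ (∩⁻ˡ m , remove (∩⁻ʳ m) ne)) (λ m → x∈p∩q⁺ (∩⁻ˡ m , K⊆J (∩⁻ʳ m))))
      (≡⇒≋ (cong cX (⊆-antisym {i = ∁ L ∩ J} {∁ L ∩ K} (λ m → x∈p∩q⁺ (∩⁻ˡ m , remove (∩⁻ʳ m) (λ { refl → x∈∁p⇒x∉p (∩⁻ˡ m) i∈L }))) (λ m → x∈p∩q⁺ (∩⁻ˡ m , K⊆J (∩⁻ʳ m))))))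

    cox-remove-R : i ∉ L → cox J ≋ cox K ++ i ∷ []
    cox-remove-R i∉L = ≋-trans (++-cong
      (≡⇒≋ (cong cX (⊆-antisym {i = L ∩ J} {L ∩ K} (λ m → x∈p∩q⁺ (∩⁻ˡ m , remove (∩⁻ʳ m) (λ { refl → i∉L (∩⁻ˡ m) }))) (λ m → x∈p∩q⁺ (∩⁻ˡ m , K⊆J (∩⁻ʳ m))))))
      last) (≡⇒≋ (sym (++-assoc (cX (L ∩ K)) (cX (∁ L ∩ K)) (i ∷ []))))
      where
      last : cX (∁ L ∩ J) ≋ cX (∁ L ∩ K) ++ i ∷ []
      last = same-letters commuting-∁L (cX (∁ L ∩ J)) (cX (∁ L ∩ K) ++ i ∷ []) (cX-unique (∁ L ∩ J))
        (Uniqueₚ.++⁺ (cX-unique (∁ L ∩ K)) ([] ∷ []) λ { (m , here refl) → i∉K (proj₂ (∈-cX∩⁻ (∁ L) K m)) })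
        (λ m → proj₁ (∈-cX∩⁻ (∁ L) J m)) to
        (λ m → [ (λ y → let (x , z) = ∈-cX∩⁻ (∁ L) K y in ∈-cX∩⁺ (∁ L) J x (K⊆J z)) , (λ { (here refl) → ∈-cX∩⁺ (∁ L) J (x∉p⇒x∈∁p i∉L) i∈J }) ]′ (∈-++⁻ (cX (∁ L ∩ K)) m))
        where
        to : ∀ {k} → k ∈ˡ cX (∁ L ∩ J) → k ∈ˡ cX (∁ L ∩ K) ++ i ∷ []
        to {k} m with k ≟F i
        ... | yes e = ∈-++⁺ʳ (cX (∁ L ∩ K)) (here e)
        ... | no ne = let (x , y) = ∈-cX∩⁻ (∁ L) J m in ∈-++⁺ˡ (∈-cX∩⁺ (∁ L) K x (remove y ne))

    module _ {B : Subset n} (b : Anti J B) ts ts′ (h : All (IsReflection C J) ts) (h′ : All (IsReflection C J) ts′)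
             (first : Θ J B ≋ i ∷ concat ts) (rest : concat ts′ ≋ reverse (Θ J B) ++ cox J)
             (min : Minimal J (cox J) (suc (length ts ℕ.+ length ts′))) where

      -- Here c_J = sᵢ c_K, so z, the rest of the factorization, lies in NC(W_K, c_K) and is the
      -- image of an antichain of Φ_K⁺. In J parabolic induction prefixes exactly sᵢ to it, and
      -- injectivity identifies that antichain with `B`.
      descend-L : i ∈ L → Anti K B
      descend-L i∈L = subst (Anti K) (sym (Θ-injective b (Anti-⊆ K⊆J aK) (≋-trans first (≋-trans (++-cong (≋-sym single) (≋-sym eq)) (≋-sym (Θ-parabolic K⊆J aK)))))) aK
        where
        z : Word r
        z = concat ts
        nc : NC C K (cox K) z
        nc = parabolic-NC i∈J
          (λ { (us , refl , hu , eu) → (i ∷ []) ∷ us , refl , simple-reflection i∈J ∷ hu , ≋⇒≈ {i ∷ concat us} {cox J}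
               (≋-trans (++-cong (≋-refl {i ∷ []}) (≈⇒≋ {concat us} {cox K} eu)) (≋-sym (cox-remove-L i∈L))) })
          z ts ts′ h h′ ≋-refl
          (≋-trans rest (≋-trans (++-cong (reverse-cong diag first) (cox-remove-L i∈L))
            (solve (env (z ∷ (i ∷ []) ∷ cox K ∷ Vec.[])) (inv (v₁ · v₀) · (v₁ · v₂)) (inv v₀ · v₂) refl))) min
        found = IsASTFamily.onto ast K z nc
        A′ = proj₁ found
        aK : Anti K A′
        aK = anti⁻ (proj₁ (proj₂ found))
        eq : Θ K A′ ≋ z
        eq = ≈⇒≋ {Θ K A′} {z} (proj₂ (proj₂ found))
        single : cX ((L ∩ J) ─ K) ≋ i ∷ []
        single = same-letters commuting-L (cX ((L ∩ J) ─ K)) (i ∷ []) (cX-unique X) ([] ∷ []) (λ m → ∩⁻ˡ {L} {J} (─⁻ {L ∩ J} {K} (∈-cX⁻ {X = X} m))) only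
          (λ { (here refl) → ∈-cX⁺ {X = X} (x∈p∧x∉q⇒x∈p─q (x∈p∩q⁺ (i∈L , i∈J)) i∉K) })
          where
          X : Subset r
          X = (L ∩ J) ─ K
          only : ∀ {k} → k ∈ˡ cX ((L ∩ J) ─ K) → k ∈ˡ i ∷ []
          only {k} m with k ≟F i
          ... | yes e = here e
          ... | no ne = contradiction (remove (∩⁻ʳ {L} {J} (─⁻ {L ∩ J} {K} (∈-cX⁻ {X = X} m))) ne) (─⁻∉ {L ∩ J} {K} (∈-cX⁻ {X = X} m))

      -- Here c_J = c_K sᵢ, and Row B corresponds to c_K sᵢ z⁻¹ sᵢ, where sᵢ z is the image of `B`.
      -- This element lies in NC(W_K, c_K), and as i is not in L parabolic induction from K to J
      -- prefixes nothing.
      descend-R : i ∉ L → Anti K (Row roots J B)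
      descend-R i∉L = subst (Anti K) (sym (Θ-injective (Rowmotion.Row-anti J b) (Anti-⊆ K⊆J aK)
          (≋-sym (≋-trans (Θ-parabolic K⊆J aK) (++-cong none eq))))) aK
        where
        y z : Word r
        y = Θ J (Row roots J B)
        z = concat ts
        y≋ : y ≋ (cox K ++ i ∷ []) ++ reverse (i ∷ z)
        y≋ = ≋-trans (Θ-Row b) (++-cong (cox-remove-R i∉L) (reverse-cong diag first))
        us vs : List (Word r)
        -- With w = Θ B, the element y = c w⁻¹ equals c (w⁻¹ c) c⁻¹, so conjugating `ts′` by c
        -- factors y. Its complement y⁻¹ c_K is sᵢ z sᵢ, which is factored by conjugating `ts` by
        -- sᵢ.
        us = map (conj (cox J)) ts′
        vs = map (conj (i ∷ [])) ts
        eu : concat us ≋ y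
        eu = ≋-trans (conj-concat (cox J) ts′) (≋-trans (++-cong (≋-refl {cox J}) (++-cong rest (≋-refl {reverse (cox J)})))
          (≋-trans (solve (env (cox J ∷ Θ J B ∷ Vec.[])) (v₀ · (inv v₁ · v₀) · inv v₀) (v₀ · inv v₁) refl) (≋-sym (Θ-Row b))))
        ev : concat vs ≋ reverse y ++ cox K
        ev = ≋-trans (conj-concat (i ∷ []) ts) (≋-trans
          (solve (env (cox K ∷ (i ∷ []) ∷ z ∷ Vec.[])) (v₁ · v₂ · inv v₁) (inv ((v₀ · v₁) · inv (v₁ · v₂)) · v₀) refl)
          (++-cong (reverse-cong diag (≋-sym y≋)) (≋-refl {cox K})))
        nc : NC C K (cox K) y
        nc = parabolic-NC i∈J
          (λ { (ws , refl , hw , ew) → ws ++ (i ∷ []) ∷ [] , trans (length-++ ws) (ℕₚ.+-comm (length ws) 1) , Allₚ.++⁺ hw (simple-reflection i∈J ∷ [])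
             , ≋⇒≈ {concat (ws ++ (i ∷ []) ∷ [])} {cox J} (≋-trans (≡⇒≋ (sym (concat-++ ws ((i ∷ []) ∷ []))))
                 (≋-trans (++-cong (≈⇒≋ {concat ws} {cox K} ew) (≋-refl {i ∷ []})) (≋-sym (cox-remove-R i∉L)))) })
          y us vs (conj-all (wordIn (cox J) ∈-cox⁻) h′) (conj-all (i∈J ∷ []) h) eu ev
          (subst (λ k → Minimal J (cox J) (suc k)) (trans (ℕₚ.+-comm (length ts) (length ts′)) (cong₂ ℕ._+_ (sym (length-map (conj (cox J)) ts′)) (sym (length-map (conj (i ∷ [])) ts)))) min)
        found = IsASTFamily.onto ast K y nc
        A′ = proj₁ found
        aK : Anti K A′
        aK = anti⁻ (proj₁ (proj₂ found))
        eq : Θ K A′ ≋ y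
        eq = ≈⇒≋ {Θ K A′} {y} (proj₂ (proj₂ found))
        none : cX ((L ∩ J) ─ K) ≋ []
        none = cX-empty {(L ∩ J) ─ K} λ m → ─⁻∉ {L ∩ J} {K} m (remove (∩⁻ʳ {L} {J} (─⁻ {L ∩ J} {K} m)) λ { refl → i∉L (∩⁻ˡ {L} {J} (─⁻ {L ∩ J} {K} m)) })

  -- Conjugation by powers of the Coxeter element

  power : Word r → ℕ → Word r
  power c zero    = []
  power c (suc k) = c ++ power c k

  act-power : ∀ c k v → act C (power c k) v ≡ iterate c k v
  act-power c zero    v = refl
  act-power c (suc k) v = trans (act-++ c (power c k) v) (cong (act C c) (act-power c k v))

  wordIn-power : ∀ {J} k → WordIn C J (power (cox J) k)
  wordIn-power zero    = []
  wordIn-power {J} (suc k) = Allₚ.++⁺ (wordIn (cox J) ∈-cox⁻) (wordIn-power k)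

  conj-reflection-≋ : ∀ g w i → conj g (reflection w i) ≋ reflection (g ++ w) i
  conj-reflection-≋ g w i = solve (env (g ∷ w ∷ (i ∷ []) ∷ Vec.[])) (v₀ · (v₁ · (v₂ · inv v₁)) · inv v₀) ((v₀ · v₁) · (v₂ · inv (v₀ · v₁))) refl

  -- Where the positive root first turns negative along c = c_L c_R, it is a simple root of c_R, or its
  -- image under c is the negative of a simple root of c_L.
  sign-change : ∀ {J γ} → IsRoot C γ → Pos γ → Neg (act C (cox J) γ) →
                ∃ λ i → i ∈ J × (γ ≡ e i ⊎ act C (cox J) γ ≡ -1ℤ ⊙ e i)
  sign-change {J} {γ} rγ p m with root-sign (root-act (cX (∁ L ∩ J)) rγ)
  ... | inj₂ m′ with turning (cX (∁ L ∩ J)) rγ p m′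
  ...   | u , i , v , eq , h = i , ∩⁻ʳ (letter (here refl)) , inj₁ (begin
      γ ≡⟨ sym (act-reverse diag v γ) ⟩
      act C (reverse v) (act C v γ) ≡⟨ cong (act C (reverse v)) h ⟩
      act C (reverse v) (e i) ≡⟨ fix-simple commuting-∁L (reverse v) (wordIn (reverse v) (λ m → ∩⁻ˡ (letter (there (Anyₚ.reverse⁻ m))))) (∩⁻ˡ (letter (here refl))) (∉⇒All≢ (reverse v) λ m → All≢⇒∉ (i∉v (subst Unique eq (cX-unique (∁ L ∩ J)))) (Anyₚ.reverse⁻ m)) ⟩
      e i ∎)
    where
    open ≡-Reasoning
    letter : ∀ {k} → k ∈ˡ i ∷ v → k ∈ ∁ L ∩ J
    letter {k} m = ∈-cX⁻ (subst (k ∈ˡ_) (sym eq) (∈-++⁺ʳ u m))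
    i∉v : ∀ {u} → Unique (u ++ i ∷ v) → All (i ≢_) v
    i∉v {[]}    (h ∷ _) = h
    i∉v {_ ∷ u} (_ ∷ h) = i∉v {u} h
  sign-change {J} {γ} rγ p m | inj₁ p′ with turning (cX (L ∩ J)) (root-act (cX (∁ L ∩ J)) rγ) p′ (subst Neg (act-++ (cX (L ∩ J)) (cX (∁ L ∩ J)) γ) m)
  ... | u , i , v , eq , h = i , ∩⁻ʳ letter-i , inj₂ (begin
      act C (cox J) γ ≡⟨ act-++ (cX (L ∩ J)) (cX (∁ L ∩ J)) γ ⟩
      act C (cX (L ∩ J)) δ′ ≡⟨ cong (λ t → act C t δ′) eq ⟩
      act C (u ++ i ∷ v) δ′ ≡⟨ act-++ u (i ∷ v) δ′ ⟩
      act C u (sref C i (act C v δ′)) ≡⟨ cong (λ t → act C u (sref C i t)) h ⟩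
      act C u (sref C i (e i)) ≡⟨ trans (cong (act C u) (sref-e diag i)) (act-⊙ u -1ℤ (e i)) ⟩
      -1ℤ ⊙ act C u (e i) ≡⟨ cong (-1ℤ ⊙_) (fix-simple commuting-L u (wordIn u letter-u) (∩⁻ˡ letter-i) (∉⇒All≢ u (i∉u u (subst Unique eq (cX-unique (L ∩ J)))))) ⟩
      -1ℤ ⊙ e i ∎)
    where
    open ≡-Reasoning
    δ′ : V
    δ′ = act C (cX (∁ L ∩ J)) γ
    letter-i : i ∈ L ∩ J
    letter-i = ∈-cX⁻ (subst (i ∈ˡ_) (sym eq) (∈-++⁺ʳ u (here refl)))
    letter-u : ∀ {k} → k ∈ˡ u → k ∈ L
    letter-u {k} m = ∩⁻ˡ (∈-cX⁻ (subst (k ∈ˡ_) (sym eq) (∈-++⁺ˡ m)))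
    i∉u : ∀ u → Unique (u ++ i ∷ v) → i ∉ˡ u
    i∉u (x ∷ u) (h ∷ _) (here refl) = All.lookup h (∈-++⁺ʳ u (here refl)) refl
    i∉u (x ∷ u) (_ ∷ h) (there m)   = i∉u u h m

  conjugate-to-simple : ∀ {J} w i₁ → WordIn C J w → i₁ ∈ J → Pos (act C w (e i₁)) →
                        ∃ λ k → ∃ λ i → i ∈ J × conj (power (cox J) k) (reflection w i₁) ≋ i ∷ []
  conjugate-to-simple {J} w i₁ wJ iJ p with orbit-turns (cox J) (cox-unique J) (wordIn (cox J) ∈-cox⁻) ∈-cox⁺ (w , i₁ , refl) p (act-support w (e i₁) wJ (e-support iJ))
  ... | k , pk , turns with sign-change (iterate-root (cox J) k (w , i₁ , refl)) pk turns
  ...   | i , i∈J , inj₁ eq = k , i , i∈J , ≋-trans (conj-reflection-≋ g w i₁) (reflection-unique (g ++ w) i₁ [] i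
            (trans (act-++ g w (e i₁)) (trans (act-power (cox J) k (act C w (e i₁))) eq)))
    where g = power (cox J) k
  -- Here the (k + 1)-st power of c sends the root to -αᵢ, and opposite roots have the same
  -- reflection.
  ...   | i , i∈J , inj₂ eq = suc k , i , i∈J , ≋-trans (conj-reflection-≋ g w i₁) (≋-trans (≋-sym (inverse-root (g ++ w) i₁))
            (reflection-unique ((g ++ w) ++ i₁ ∷ []) i₁ [] i (trans (act-neg (g ++ w) i₁) (trans (cong (-1ℤ ⊙_)
              (trans (act-++ g w (e i₁)) (trans (act-power (cox J) (suc k) (act C w (e i₁))) eq))) (neg-neg (e i))))))
    where g = power (cox J) (suc k)

  double-Row : ∀ {J} → ℕ → Subset n → Subset n
  double-Row zero    A = A
  double-Row {J} (suc k) A = Row roots J (Row roots J (double-Row {J} k A))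

  double-orbit : ∀ {J} k A → Orbit J A (double-Row {J} k A)
  double-orbit zero    A = start
  double-orbit (suc k) A = next (next (double-orbit k A))

  -- Two Kreweras complements are c (c w⁻¹)⁻¹ = c w c⁻¹.
  Θ-double-Row : ∀ {J A} k → Anti J A → Θ J (double-Row {J} k A) ≋ conj (power (cox J) k) (Θ J A)
  Θ-double-Row {J} {A} zero a = solve (env (Θ J A ∷ Vec.[])) v₀ (one · v₀ · inv one) refl
  Θ-double-Row {J} {A} (suc k) a = ≋-trans (Θ-Row (Rowmotion.Row-anti J b)) (≋-trans (++-cong (≋-refl {cox J}) (reverse-cong diag (Θ-Row b)))
    (≋-trans (++-cong (≋-refl {cox J}) (reverse-cong diag (++-cong (≋-refl {cox J}) (reverse-cong diag (Θ-double-Row k a)))))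
      (solve (env (cox J ∷ power (cox J) k ∷ Θ J A ∷ Vec.[])) (v₀ · inv (v₀ · inv (v₁ · v₂ · inv v₁))) ((v₀ · v₁) · v₂ · inv (v₀ · v₁)) refl)))
    where b = orbit-anti a (double-orbit {J} k A)

  power-commutes : ∀ c k → power c k ++ c ≋ c ++ power c k
  power-commutes c zero    = solve (env (c ∷ Vec.[])) (one · v₀) (v₀ · one) refl
  power-commutes c (suc k) = ≋-trans (≡⇒≋ (++-assoc c (power c k) c)) (++-cong (≋-refl {c}) (power-commutes c k))

  Reaches : Subset r → Subset n → Set
  Reaches J A = ∃ λ B → ∃ λ K → Orbit J A B × K ⊂ J × Anti K B

  reaches-nontrivial : ∀ {J A} → Anti J A → ∀ t ts ts′ → IsReflection C J t → All (IsReflection C J) ts → All (IsReflection C J) ts′ →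
    t ++ concat ts ≋ Θ J A → concat ts′ ≋ reverse (Θ J A) ++ cox J → Minimal J (cox J) (suc (length ts ℕ.+ length ts′)) → Reaches J A
  reaches-nontrivial {J} {A} a t ts ts′ (w , i₁ , wJ , iJ , eq) h h′ first rest min = conclude (positive (root-sign (w , i₁ , refl)))
    where
    positive : Pos (act C w (e i₁)) ⊎ Neg (act C w (e i₁)) → ∃ λ w′ → WordIn C J w′ × Pos (act C w′ (e i₁)) × t ≋ reflection w′ i₁
    positive (inj₁ p) = w , wJ , p , ≈⇒≋ {t} {reflection w i₁} eq
    positive (inj₂ m) = w ++ i₁ ∷ [] , Allₚ.++⁺ wJ (iJ ∷ []) , subst Pos (sym (act-neg w i₁)) (Pos-neg {v = act C w (e i₁)} m)
                      , ≋-trans (≈⇒≋ {t} {reflection w i₁} eq) (≋-sym (inverse-root w i₁))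
    conclude : (∃ λ w′ → WordIn C J w′ × Pos (act C w′ (e i₁)) × t ≋ reflection w′ i₁) → Reaches J A
    conclude (w′ , w′J , p , t≋) with conjugate-to-simple w′ i₁ w′J iJ p
    ... | k , i , i∈J , simple = finish (i ∈? L)
      where
      c g : Word r
      c = cox J
      g = power c k
      B : Subset n
      B = double-Row {J} k A
      o : Orbit J A B
      o = double-orbit k A
      b : Anti J B
      b = orbit-anti a o
      us us′ : List (Word r)
      us = map (conj g) ts
      us′ = map (conj g) ts′
      hu = conj-all {J} {g} {ts} (wordIn-power k) h
      hu′ = conj-all {J} {g} {ts′} (wordIn-power k) h′
      firstB : Θ J B ≋ i ∷ concat us
      firstB = ≋-trans (Θ-double-Row k a) (≋-trans (++-cong (≋-refl {g}) (++-cong (≋-trans (≋-sym first) (++-cong t≋ (≋-refl {concat ts}))) (≋-refl {reverse g})))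
        (≋-trans (solve (env (g ∷ reflection w′ i₁ ∷ concat ts ∷ Vec.[])) (v₀ · (v₁ · v₂) · inv v₀) ((v₀ · v₁ · inv v₀) · (v₀ · v₂ · inv v₀)) refl)
          (++-cong simple (≋-sym (conj-concat g ts)))))
      -- As g is a power of c, it commutes with c, so conjugating w⁻¹ c by g gives (g w g⁻¹)⁻¹ c.
      restB : concat us′ ≋ reverse (Θ J B) ++ c
      restB = ≋-trans (conj-concat g ts′) (≋-trans (++-cong (≋-refl {g}) (++-cong rest (≋-refl {reverse g})))
        (≋-trans (solve (env (g ∷ Θ J A ∷ c ∷ Vec.[])) (v₀ · (inv v₁ · v₂) · inv v₀) (inv (v₀ · v₁ · inv v₀) · (v₀ · v₂) · inv v₀) refl)
        (≋-trans (++-cong (≋-refl {reverse (conj g (Θ J A))}) (++-cong (power-commutes c k) (≋-refl {reverse g})))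
        (≋-trans (solve (env (g ∷ conj g (Θ J A) ∷ c ∷ Vec.[])) (inv v₁ · (v₂ · v₀) · inv v₀) (inv v₁ · v₂) refl)
          (++-cong (reverse-cong diag (≋-sym (Θ-double-Row k a))) (≋-refl {c}))))))
      minB : Minimal J c (suc (length us ℕ.+ length us′))
      minB = subst (λ m → Minimal J c (suc m)) (cong₂ ℕ._+_ (sym (length-map (conj g) ts)) (sym (length-map (conj g) ts′))) min
      finish : Dec (i ∈ L) → Reaches J A
      finish (yes l) = B , J ─ ⁅ i ⁆ , o , x∈p⇒p-x⊂p i∈J , descend-L i∈J b us us′ hu hu′ firstB restB minB l
      finish (no  l) = Row roots J B , J ─ ⁅ i ⁆ , next o , x∈p⇒p-x⊂p i∈J , descend-R i∈J b us us′ hu hu′ firstB restB minB l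

  -- If c acted trivially it would fix αᵢ, and `fixed-vector` would make αᵢ pair to 0 instead of 2
  -- with its own coroot.
  cox-nontrivial : ∀ {J i} → i ∈ J → ¬ (cox J ≋ [])
  cox-nontrivial {J} {i} i∈J h = contradiction (trans (sym (diag i)) (trans (sym (pairing-e i i))
    (fixed-vector (cox J) (cox-unique J) (e i) (at h (e i)) (∈-cox⁺ i∈J)))) λ ()

  -- The relation Θ A ≤ c supplies shortest factorizations of Θ A and of its complement whose
  -- lengths add up to that of c. The head of the former is the reflection to be made simple, and it
  -- is missing only when Θ A is the identity.
  reaches-or-trivial : ∀ {J A} → Anti J A → Reaches J A ⊎ Θ J A ≋ []
  reaches-or-trivial {J} {A} a with proj₂ (Θ-NC a)
  ... | _ , _ , (([] , refl , [] , eq) , _) , _ , _ = inj₂ (≋-sym (≈⇒≋ {[]} {Θ J A} eq))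
  ... | _ , _ , ((t ∷ ts , refl , h ∷ hs , eq) , _) , ((ts′ , refl , h′ , eq′) , _) , (_ , min) =
    inj₁ (reaches-nontrivial a t ts ts′ h hs h′ (≈⇒≋ {t ++ concat ts} {Θ J A} eq) (≈⇒≋ {concat ts′} {reverse (Θ J A) ++ cox J} eq′) min)

  -- If Θ A is the identity, then Row A corresponds to c, which is nontrivial because J is
  -- inhabited; so the search succeeds after at most one extra step.
  reaches : ∀ {J A i} → i ∈ J → Anti J A → Reaches J A
  reaches {J} {A} i∈J a with reaches-or-trivial a
  ... | inj₁ x = x
  ... | inj₂ e with reaches-or-trivial (Rowmotion.Row-anti J a)
  ...   | inj₁ (B , K , o , K⊂J , b) = B , K , orbit-trans (next start) o , K⊂J , b
  ...   | inj₂ e′ = ⊥-elim (cox-nontrivial i∈J (≋-trans (solve (env (cox J ∷ Vec.[])) v₀ (v₀ · inv one) refl)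
            (≋-trans (++-cong (≋-refl {cox J}) (reverse-cong diag (≋-sym e))) (≋-trans (≋-sym (Θ-Row a)) e′))))

  good : ∀ J → Acc _⊂_ J → ∀ {A} → Anti J A → Good J A
  good J (acc rs) a with nonempty? J
  ... | no  none = good-empty (λ m → none (_ , m)) a
  ... | yes (_ , i∈J) with reaches i∈J a
  ...   | B , K , o , K⊂J , b = good-orbit a o (good-parabolic (proj₁ K⊂J) b (good K (rs K⊂J) b))

theorem1p5 : (r : ℕ) (C : Cartan r) → IsCartanMatrix C →
    (n : ℕ) (roots : Vec (Vec ℤ r) n) → EnumeratesΦ⁺ C roots →
    (L : Subset r) → IsBipartition C L →
    (Θ : Subset r → Subset n → Word r) → IsASTFamily C roots L Θ →
    ∀ A → IsAntichainIn roots ⊤ A →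
    _≈W_ C (Θ ⊤ (RowInv roots ⊤ (Rvac roots ⊤ A)))
           (cX L ++ reverse (Θ ⊤ A) ++ reverse (cX L))
theorem1p5 r C cm n roots enum L bip Θ ast A antichain =
  Action.≋⇒≈ C {Θ ⊤ (RowInv roots ⊤ (Rvac roots ⊤ A))} {cX L ++ reverse (Θ ⊤ A) ++ reverse (cX L)}
    (subst (λ X → Action._≋_ C (Θ ⊤ (RowInv roots ⊤ (Rvac roots ⊤ A))) (cX X ++ reverse (Θ ⊤ A) ++ reverse (cX X)))
           (∩-identityʳ L)
           (Main.good C cm roots enum L bip Θ ast ⊤ (⊂-wellFounded ⊤)
             (RootPoset.anti⁻ C cm roots enum antichain)))
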